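{- Fix any constants $0 < \epsilon,\beta < 1/8$, and let $\delta(n) \le 1/(200 n^2)$. Let $X\subseteq\mathbb{R}$ be finite and totally ordered, and let $\Delta,t,w$ be such that $\Delta<t\leq n$ and $w\leq \frac{1}{4}\mathrm{tower}(\log(n^{1/5}/40))$. For every $(\epsilon,\delta(n))$-differentially private algorithm that solves the 1-cluster problem $(X,n,t)$ with parameters $(\Delta,w)$ and error probability $\beta$, it holds that $n\geq\Omega(\log^*|X|)$.
   Context: Differential privacy: two databases $S,S'\in U^n$ are neighboring if they differ on at most one row. A randomized algorithm $M:U^n\to Y$ is $(\epsilon,\delta)$-differentially private if for all neighboring $S,S'\in U^n$ and every $T\subseteq Y$, $\Pr[M(S)\in T]\le e^{\epsilon}\Pr[M(S')\in T]+\delta$. 1-cluster problem (dimension $1$): an algorithm $\mathcal M$ solves $(X,n,t)$ (with $n\ge t$) with parameters $(\Delta,w)$ and error probability $\beta$ if for every $S\in X^n$, $\mathcal M(S)$ outputs a center $c$ and a radius $r$ such that with probability at least $1-\beta$: (1) the ball (interval) of radius $r$ around $c$ contains at least $t-\Delta$ input points from $S$ (with multiplicity); (2) $r\le w\cdot r_{opt}$, where $r_{opt}$ is the radius of the smallest ball in $X$ containing at least $t$ input points. Iterated exponentials: $\mathrm{tower}(0)=1$ and $\mathrm{tower}(j)=2^{\mathrm{tower}(j-1)}$. $\log^*$ is the iterated logarithm. -}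

module Defs where

open import Level using (0ℓ)
open import Algebra.Bundles using (CommutativeRing)
open import Data.Nat as ℕ using (ℕ; zero; suc)
open import Data.Fin using (Fin; toℕ)
open import Data.Fin.Subset using (Subset; ∣_∣; _∈_)
open import Data.Product using (_×_; _,_; proj₁; proj₂; ∃; ∃-syntax)
open import Data.Vec using (Vec; lookup)
open import Relation.Binary using (Rel; IsTotalOrder; TotalOrder)
open import Relation.Binary.PropositionalEquality using (_≡_; _≢_)
open import Relation.Nullary using (¬_)
open import Relation.Unary using (Pred; _⊆_; _≐_; _∩_; Empty; Universal)
import Algebra.Construct.NaturalChoice.Max as Max
import Algebra.Properties.CommutativeMonoid.Sum as Sum
import Algebra.Properties.Semiring.Exp as Exp
import Algebra.Properties.Semiring.Mult as Mult
import Relation.Binary.Construct.NonStrictToStrict as Strict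

-- The real numbers, characterised up to isomorphism as the complete ordered
-- field.  As usual for total operations, _⁻¹ is unconstrained at 0 and sup is
-- unconstrained on sets that are empty or unbounded above.

record CompleteOrderedField : Set₁ where
  infix 4 _≤_
  infix 8 _⁻¹
  field
    commutativeRing : CommutativeRing 0ℓ 0ℓ
  open CommutativeRing commutativeRing public
  field
    _≤_          : Rel Carrier 0ℓ
    isTotalOrder : IsTotalOrder _≈_ _≤_
    +-monoˡ-≤    : ∀ {x y} z → x ≤ y → x + z ≤ y + z
    *-nonNeg     : ∀ {x y} → 0# ≤ x → 0# ≤ y → 0# ≤ x * y
    0≉1          : ¬ 0# ≈ 1#
    _⁻¹          : Carrier → Carrier
    *-inverseʳ   : ∀ {x} → ¬ x ≈ 0# → x * x ⁻¹ ≈ 1#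
    sup          : Pred Carrier 0ℓ → Carrier
    sup-upper    : ∀ (P : Pred Carrier 0ℓ) {b} → (∀ {x} → P x → x ≤ b) →
                   ∀ {x} → P x → x ≤ sup P
    sup-least    : ∀ (P : Pred Carrier 0ℓ) {b} → ∃ P →
                   (∀ {x} → P x → x ≤ b) → sup P ≤ b

  totalOrder : TotalOrder 0ℓ 0ℓ 0ℓ
  totalOrder = record { isTotalOrder = isTotalOrder }

  open Strict _≈_ _≤_ public using (_<_)

tower : ℕ → ℕ
tower zero    = 1
tower (suc j) = 2 ℕ.^ tower j

iterate : ∀ {a} {A : Set a} → (A → A) → ℕ → A → A
iterate f zero    x = x
iterate f (suc k) x = iterate f k (f x)

IsLeastℕ : Pred ℕ 0ℓ → Pred ℕ 0ℓ
IsLeastℕ P k = P k × (∀ j → P j → k ℕ.≤ j)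

Neighboring : ∀ {U : Set} {n} → Vec U n → Vec U n → Set
Neighboring S S′ = ∀ i j → lookup S i ≢ lookup S′ i → lookup S j ≢ lookup S′ j → i ≡ j

module OverReals (R : CompleteOrderedField) where

  open CompleteOrderedField R public using (_≈_; _+_; _-_; _*_; _⁻¹; -_; 0#; 1#; _≤_; _<_; sup)
    renaming (Carrier to ℝ)
  open CompleteOrderedField R using (semiring; +-commutativeMonoid; totalOrder)
  open Exp semiring public using (_^_)
  open Mult semiring using () renaming (_×_ to _·_)
  open Sum +-commutativeMonoid using (sum)
  open Max totalOrder using (_⊔_)

  fromℕ : ℕ → ℝ
  fromℕ n = n · 1#

  infixl 7 _/_
  _/_ : ℝ → ℝ → ℝ
  x / y = x * y ⁻¹

  abs : ℝ → ℝ
  abs x = x ⊔ (- x)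

  -- Definite description: for a predicate holding of exactly one real number
  -- (up to ≈), the supremum of its extension is that number.
  the : Pred ℝ 0ℓ → ℝ
  the = sup

  infix 4 _⟶_
  _⟶_ : (ℕ → ℝ) → ℝ → Set
  a ⟶ l = ∀ η → 0# < η → ∃[ N ] (∀ m → N ℕ.≤ m → abs (a m - l) < η)

  partialSums : (ℕ → ℝ) → ℕ → ℝ
  partialSums a m = sum {m} (λ k → a (toℕ k))

  exp : ℝ → ℝ
  exp x = the (partialSums (λ k → (x ^ k) / fromℕ (k ℕ.!)) ⟶_)

  ln : ℝ → ℝ
  ln x = the (λ y → exp y ≈ x)

  log₂ : ℝ → ℝ
  log₂ x = ln x / ln (fromℕ 2)

  fifthRoot : ℝ → ℝ
  fifthRoot x = the (λ y → 0# ≤ y × (y ^ 5) ≈ x)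

  -- The number of times log₂ has to be applied before the value is at most 1.
  log* : ℝ → ℝ
  log* x = the (λ v → ∃[ k ] (IsLeastℕ (λ j → iterate log₂ j x ≤ 1#) k × v ≈ fromℕ k))

  -- The tower function is only given at natural numbers; at a real argument it
  -- is evaluated at the least natural number that is not below the argument.
  -- In particular the value is tower 0 = 1 at negative arguments.
  towerℝ : ℝ → ℝ
  towerℝ x = the (λ v → ∃[ k ] (IsLeastℕ (λ j → x ≤ fromℕ j) k × v ≈ fromℕ (tower k)))

  -- Codes for the Borel subsets of ℝ × ℝ, generated from closed half-planes.
  -- Different codes may denote the same set.
  data Borel : Set where
    fst≤ snd≤  : ℝ → Borel
    complement : Borel → Borel
    ⋃          : (ℕ → Borel) → Borel

  ⟦_⟧ : Borel → Pred (ℝ × ℝ) 0ℓ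
  ⟦ fst≤ a ⟧       y = proj₁ y ≤ a
  ⟦ snd≤ a ⟧       y = proj₂ y ≤ a
  ⟦ complement A ⟧ y = ¬ ⟦ A ⟧ y
  ⟦ ⋃ A ⟧          y = ∃[ k ] ⟦ A k ⟧ y

  record ProbabilityMeasure : Set where
    field
      Pr         : Borel → ℝ
      Pr-cong    : ∀ {A B} → ⟦ A ⟧ ≐ ⟦ B ⟧ → Pr A ≈ Pr B
      Pr-nonNeg  : ∀ A → 0# ≤ Pr A
      Pr-total   : ∀ {A} → Universal ⟦ A ⟧ → Pr A ≈ 1#
      Pr-σ-add   : ∀ (A : ℕ → Borel) → (∀ {i j} → i ≢ j → Empty (⟦ A i ⟧ ∩ ⟦ A j ⟧)) →
                   partialSums (λ k → Pr (A k)) ⟶ Pr (⋃ A)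

  open ProbabilityMeasure public

  -- The property P holds with probability at least p: some event of
  -- probability at least p implies P.
  HoldsWithProb : ProbabilityMeasure → ℝ → Pred (ℝ × ℝ) 0ℓ → Set
  HoldsWithProb μ p P = ∃[ A ] (⟦ A ⟧ ⊆ P × p ≤ Pr μ A)

  -- A randomized algorithm is given by the distribution of its output on each
  -- database.  The output is a pair (center , radius); the center may be any
  -- real number, not only a point of the domain.
  Algorithm : Set → ℕ → Set
  Algorithm U n = Vec U n → ProbabilityMeasure

  DifferentiallyPrivate : ∀ {U n} → ℝ → ℝ → Algorithm U n → Set
  DifferentiallyPrivate {U} {n} ε δ M =
    ∀ (S S′ : Vec U n) → Neighboring S S′ →
    ∀ T → Pr (M S) T ≤ exp ε * Pr (M S′) T + δ

  record FiniteSubset : Set where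
    field
      size            : ℕ
      point           : Fin size → ℝ
      point-injective : ∀ {i j} → point i ≈ point j → i ≡ j

  module _ (X : FiniteSubset) where
    open FiniteSubset X

    Database : ℕ → Set
    Database = Vec (Fin size)

    -- The closed ball of radius r around c contains at least κ rows of S,
    -- counted with multiplicity, where κ need not be an integer.
    BallContains : ∀ {n} → Database n → ℝ → ℝ → ℝ → Set
    BallContains {n} S c r κ =
      ∃[ I ] (κ ≤ fromℕ ∣ I ∣ × (∀ (i : Fin n) → i ∈ I → abs (point (lookup S i) - c) ≤ r))

    -- r is the radius of a ball in X, so one centered at a point of X, that
    -- contains at least t rows of S.
    IsFeasibleRadius : ∀ {n} → Database n → ℕ → Pred ℝ 0ℓ
    IsFeasibleRadius S t r = 0# ≤ r × (∃[ c ] BallContains S (point c) r (fromℕ t))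

    r-opt : ∀ {n} → Database n → ℕ → ℝ
    r-opt S t = the (λ r → IsFeasibleRadius S t r ×
                           (∀ r′ → IsFeasibleRadius S t r′ → r ≤ r′))

    Solves1Cluster : ∀ {n} → (t : ℕ) (Δ w β : ℝ) → Algorithm (Fin size) n → Set
    Solves1Cluster {n} t Δ w β M =
      ∀ (S : Database n) → HoldsWithProb (M S) (1# - β) λ (c , r) →
        BallContains S c r (fromℕ t - Δ) × r ≤ w * r-opt S t

{-# OPTIONS --safe #-}

-- Let W = tower n, so that w ≤ W.  By Ramsey's theorem, a domain with more than
-- tower (36 n) points contains points b, y₁, y₂, … whose distances u from b grow
-- by a factor of more than 4 + 2W at each step.  On a database z₁, …, zₙ of such
-- points r-opt ≤ u zₙ, hence with probability 1 - β the output satisfies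
-- r ≤ W * u zₙ and its interval meets the database.  Then max (|c - b|, r) lies
-- between (2 + W) * u z₀ and (2 + W) * u zₙ for each chosen point z₀ before z₁,
-- and some step from zₐ to zₐ₊₁ carries probability at least 3/(4n).  Passing to
-- a further homogeneous subset, a does not depend on the database.  Two changes
-- of a row move zₐ and zₐ₊₁ anywhere in a middle part of that subset, so by
-- privacy a single fixed database puts probability at least 1/(8n) between any
-- two points there, which is impossible for more than 8n + 1 points.
module Submission where

open import Defs
open import Level using (0ℓ)
open import Algebra.Solver.Ring.AlmostCommutativeRing using (_-Raw-AlmostCommutative⟶_; fromCommutativeRing)
open import Axiom.ExcludedMiddle using (ExcludedMiddle)
open import Data.Empty using (⊥-elim)
open import Data.Fin using (Fin; zero; suc; toℕ; fromℕ<)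
import Data.Fin.Properties as FinP
open import Data.Fin.Subset using (⊤; ∣_∣)
import Data.Fin.Subset.Properties as SubsetP
open import Data.Integer as ℤ using (ℤ; +_; -[1+_]; _⊖_)
import Data.Integer.Properties as ℤP
open import Data.List using (List; []; _∷_; _++_; _ʳ++_; length; map; reverse; take; drop; allFin; cartesianProductWith)
import Data.List.Properties as ListP
open import Data.List.Membership.Propositional renaming (_∈_ to _∈ₗ_) using ()
open import Data.List.Membership.Propositional.Properties
  using (∈-++⁺ˡ; ∈-++⁺ʳ; ∈-map⁺; ∈-allFin; ∈-cartesianProductWith⁺; ∈-cartesianProductWith⁻)
open import Data.List.Relation.Binary.Sublist.Propositional
  using (_⊆_; []; _∷_; _∷ʳ_; ⊆-refl; ⊆-trans; minimum; lookup; from∈)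
open import Data.List.Relation.Binary.Sublist.Propositional.Properties
  using (All-resp-⊆; ʳ++⁺; reverse⁺; take-⊆; ∷ˡ⁻; ++⁺)
open import Data.List.Relation.Unary.All as All using (All; []; _∷_)
open import Data.List.Relation.Unary.AllPairs using (AllPairs; _∷_)
open import Data.List.Relation.Unary.Any using (here; there)
open import Data.List.Relation.Unary.Unique.Propositional.Properties using (allFin⁺)
open import Data.Maybe using (Maybe; just; nothing)
open import Data.Nat as ℕ using (ℕ; zero; suc; NonZero)
import Data.Nat.Properties as ℕP
import Data.Nat.Tactic.RingSolver as ℕSolver
open import Data.Product using (_×_; _,_; proj₁; proj₂; ∃; ∃-syntax)
open import Data.Sum using (_⊎_; inj₁; inj₂)
open import Data.Vec as Vec using (Vec; []; _∷_)
open import Function using (_∘_)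
open import Relation.Binary using (IsTotalOrder; TotalOrder)
open import Relation.Binary.PropositionalEquality as ≡ using (_≡_)
open import Relation.Nullary using (¬_; Dec; yes; no; contradiction)
import Algebra.Construct.NaturalChoice.Max as Max
import Algebra.Construct.NaturalChoice.MaxOp as MaxOp
import Algebra.Properties.Ring as RingP
import Algebra.Properties.Semiring.Mult as Mult
import Algebra.Solver.Ring as RingSolver
import Relation.Binary.Reasoning.PartialOrder as PartialOrderReasoning
import Relation.Binary.Reasoning.Setoid as SetoidReasoning
import Relation.Unary as U

-- Ramsey's theorem with tower bounds

-- No single coordinate of the output is informative: a center near `b` may come with a large
-- radius, and a small radius with a distant center. Only both together are trapped, since an
-- interval that meets the rows cannot have |c - b| and r below (2 + W) * u z₀ at once. The
-- thresholds sit at the listed points themselves, so the event between two of them refers to two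
-- points of the domain and to no database; it stays fixed while rows are exchanged. All sizes are
-- counted in levels of the tower, and the count has to be linear in n. In Ramsey's theorem each
-- unit of list length costs three exponentials here, so lists of n + 1 points cost 3(n + 1) levels.
-- The growth factor built from W = `tower n` costs n levels and a constant, once; polynomials in n
-- cost n levels and a constant at most. The total is 4n + 32 ≤ 36n, which is the origin of the
-- constant 1/36.

separate : ∀ {A : Set} {P : A → Set} → (∀ x → Dec (P x)) → ∀ xs →
  ∃[ ys ] ∃[ zs ] ys ⊆ xs × zs ⊆ xs × All P ys × All (¬_ ∘ P) zs × length ys ℕ.+ length zs ≡ length xs
separate P? []       = [] , [] , [] , [] , [] , [] , ≡.refl
separate P? (x ∷ xs) with P? x | separate P? xs
... | yes Px | ys , zs , ys⊆ , zs⊆ , Pys , ¬Pzs , eq = x ∷ ys , zs , ≡.refl ∷ ys⊆ , x ∷ʳ zs⊆ , Px ∷ Pys , ¬Pzs ,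
    ≡.cong suc eq
... | no ¬Px | ys , zs , ys⊆ , zs⊆ , Pys , ¬Pzs , eq = ys , x ∷ zs , x ∷ʳ ys⊆ , ≡.refl ∷ zs⊆ , Pys , ¬Px ∷ ¬Pzs ,
  ≡.trans (ℕP.+-suc (length ys) (length zs)) (≡.cong suc eq)

ConstantOn : ∀ {A B : Set} → (A → B) → List A → Set
ConstantOn g xs = ∀ {x y} → x ∈ₗ xs → y ∈ₗ xs → g x ≡ g y

-- Induction on the number of colours: either the top colour already has more than `M` elements, or
-- discarding it leaves more than q * M elements with one colour fewer.
pigeonhole-ℕ : ∀ {A : Set} (f : A → ℕ) q M xs → All (λ x → f x ℕ.< q) xs → q ℕ.* M ℕ.< length xs →
  ∃[ ys ] ys ⊆ xs × M ℕ.< length ys × ConstantOn f ys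
pigeonhole-ℕ f zero    M (x ∷ xs) (() ∷ _) _
pigeonhole-ℕ f (suc q) M xs f<q large with separate (λ x → f x ℕP.≟ q) xs
... | ys , zs , ys⊆ , zs⊆ , f≡q , f≢q , eq with M ℕP.<? length ys
...   | yes M<ys = ys , ys⊆ , M<ys , λ x∈ y∈ → ≡.trans (All.lookup f≡q x∈) (≡.sym (All.lookup f≡q y∈))
...   | no  M≮ys =
  let ws , ws⊆ , M<ws , const = pigeonhole-ℕ f q M zs
        (All.zipWith (λ (f<1+q , f≢q) → ℕP.≤∧≢⇒< (ℕ.s≤s⁻¹ f<1+q) f≢q) (All-resp-⊆ zs⊆ f<q , f≢q))
        (ℕP.+-cancelˡ-< M _ _ (ℕP.<-≤-trans large (ℕP.≤-trans (ℕP.≤-reflexive (≡.sym eq))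
            (ℕP.+-monoˡ-≤ (length zs) (ℕP.≮⇒≥ M≮ys)))))
  in ws , ⊆-trans ws⊆ zs⊆ , M<ws , const

pigeonhole : ∀ {A : Set} {q} (f : A → Fin q) M xs → q ℕ.* M ℕ.< length xs →
  ∃[ ys ] ys ⊆ xs × M ℕ.< length ys × ConstantOn f ys
pigeonhole {q = q} f M xs large =
  let ys , ys⊆ , M<ys , const = pigeonhole-ℕ (toℕ ∘ f) q M xs (All.universal (FinP.toℕ<n ∘ f) xs) large
  in ys , ys⊆ , M<ys , λ x∈ y∈ → FinP.toℕ-injective (const x∈ y∈)

pigeonhole-All : ∀ {A : Set} {q} (gs : List (A → Fin q)) M xs → (q ℕ.^ length gs) ℕ.* M ℕ.< length xs →
  ∃[ ys ] ys ⊆ xs × M ℕ.< length ys × All (λ g → ConstantOn g ys) gs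
pigeonhole-All         []       M xs large = xs , ⊆-refl , ≡.subst (ℕ._< length xs) (ℕP.+-identityʳ M) large , []
pigeonhole-All {q = q} (g ∷ gs) M xs large =
  let ys , ys⊆ , ys-large , g-const = pigeonhole g (q ℕ.^ length gs ℕ.* M) xs
        (≡.subst (ℕ._< length xs) (ℕP.*-assoc q (q ℕ.^ length gs) M) large)
      zs , zs⊆ , zs-large , gs-const = pigeonhole-All gs M ys ys-large
  in zs , ⊆-trans zs⊆ ys⊆ , zs-large , (λ x∈ y∈ → g-const (lookup zs⊆ x∈) (lookup zs⊆ y∈)) ∷ gs-const

sublists : ∀ {A : Set} → List A → List (List A)
sublists []       = [] ∷ []
sublists (x ∷ xs) = sublists xs ++ map (x ∷_) (sublists xs)

length-sublists : ∀ {A : Set} (xs : List A) → length (sublists xs) ≡ 2 ℕ.^ length xs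
length-sublists []       = ≡.refl
length-sublists (x ∷ xs) = ≡.trans (ListP.length-++ (sublists xs)) (≡.cong₂ ℕ._+_ (length-sublists xs)
  (≡.trans (ListP.length-map (x ∷_) (sublists xs)) (≡.trans (length-sublists xs) (≡.sym (ℕP.+-identityʳ _)))))

∈-sublists : ∀ {A : Set} {xs ys : List A} → ys ⊆ xs → ys ∈ₗ sublists xs
∈-sublists []                       = here ≡.refl
∈-sublists (_ ∷ʳ ys⊆xs)             = ∈-++⁺ˡ (∈-sublists ys⊆xs)
∈-sublists {xs = x ∷ xs} (≡.refl ∷ ys⊆xs) = ∈-++⁺ʳ (sublists xs) (∈-map⁺ (x ∷_) (∈-sublists ys⊆xs))

-- The chosen elements cs are listed with the latest first.
end-homogeneous : ∀ {A : Set} {q} .{{_ : NonZero q}} (f : List A → Fin q) (xs : List A) T L (cs rs : List A) →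
  cs ʳ++ rs ⊆ xs → length cs ℕ.+ L ℕ.≤ T → suc (q ℕ.^ (2 ℕ.^ T)) ℕ.^ L ℕ.≤ length rs →
  (∀ x p → x ∷ p ⊆ cs → ∀ {z} → z ∈ₗ rs → f (x ∷ p) ≡ f (z ∷ p)) →
  ∃[ cs′ ] ∃[ z ] reverse cs′ ⊆ xs × length cs′ ≡ length cs ℕ.+ L × (∀ x p → x ∷ p ⊆ cs′ → f (x ∷ p) ≡ f (z ∷ p))
end-homogeneous f xs T zero    cs []       _  _   ()
end-homogeneous f xs T zero    cs (z ∷ rs) ⊆xs _ _ stable =
  cs , z , ⊆-trans (ʳ++⁺ (⊆-refl {x = cs}) (minimum (z ∷ rs))) ⊆xs , ≡.sym (ℕP.+-identityʳ (length cs)) ,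
      λ x p xp⊆cs → stable x p xp⊆cs (here ≡.refl)
end-homogeneous {q = q} f xs T (suc L) cs rs ⊆xs ≤T large stable = continue (pigeonhole-All gs M rs enough)
  where
  M : ℕ
  M = suc (q ℕ.^ (2 ℕ.^ T)) ℕ.^ L

  -- Every sublist `p` of the chosen elements colours the candidates for the next head. Once all
  -- these colourings are constant on the survivors, any survivor may replace any other in front of
  -- `p`.
  gs : List _
  gs = map (λ p z → f (z ∷ p)) (sublists cs)

  length-gs : length gs ≡ 2 ℕ.^ length cs
  length-gs = ≡.trans (ListP.length-map _ (sublists cs)) (length-sublists cs)

  -- `T` bounds the number of choices over all rounds, so each round loses the same factor; its
  -- successor makes the inequality strict and thereby pays for the element `y` picked next.
  enough : q ℕ.^ length gs ℕ.* M ℕ.< length rs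
  enough = ℕP.<-≤-trans (ℕP.*-monoˡ-< M {{ℕP.m^n≢0 (suc (q ℕ.^ (2 ℕ.^ T))) L}}
    (ℕ.s≤s (ℕP.^-monoʳ-≤ q (ℕP.≤-trans (ℕP.≤-reflexive length-gs)
        (ℕP.^-monoʳ-≤ 2 (ℕP.m+n≤o⇒m≤o (length cs) ≤T)))))) large

  continue : ∃[ ys ] ys ⊆ rs × M ℕ.< length ys × All (λ g → ConstantOn g ys) gs → _
  continue ([]     , _     , ()     , _)
  continue (y ∷ ys , ys⊆rs , M<ys , const) =
    let cs′ , z , ⊆xs′ , length-cs′ , homogeneous = end-homogeneous f xs T L (y ∷ cs) ys
          (⊆-trans (ʳ++⁺ (⊆-refl {x = cs}) ys⊆rs) ⊆xs)
          (≡.subst (ℕ._≤ T) (ℕP.+-suc (length cs) L) ≤T) (ℕ.s≤s⁻¹ M<ys) stable′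
    in cs′ , z , ⊆xs′ , ≡.trans length-cs′ (≡.sym (ℕP.+-suc (length cs) L)) , homogeneous
    where
    stable′ : ∀ x p → x ∷ p ⊆ y ∷ cs → ∀ {z} → z ∈ₗ ys → f (x ∷ p) ≡ f (z ∷ p)
    stable′ x p (_ ∷ʳ xp⊆cs)  z∈ys = stable x p xp⊆cs (lookup ys⊆rs (there z∈ys))
    stable′ x p (≡.refl ∷ p⊆cs) z∈ys = All.lookup const (∈-map⁺ (λ p z → f (z ∷ p)) (∈-sublists p⊆cs))
        (here ≡.refl) (there z∈ys)

1≤2^ : ∀ n → 1 ℕ.≤ 2 ℕ.^ n
1≤2^ n = ℕP.m^n>0 2 n

2*2^ : ∀ n → 2 ℕ.^ n ℕ.+ 2 ℕ.^ n ≡ 2 ℕ.^ suc n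
2*2^ n = ≡.cong (2 ℕ.^ n ℕ.+_) (≡.sym (ℕP.+-identityʳ (2 ℕ.^ n)))

n<2^n : ∀ n → n ℕ.< 2 ℕ.^ n
n<2^n zero    = ℕ.s≤s ℕ.z≤n
n<2^n (suc n) = ℕP.≤-trans (ℕP.+-mono-≤ (1≤2^ n) (n<2^n n)) (ℕP.≤-reflexive (2*2^ n))

3*n≤2^n : ∀ {n} → 4 ℕ.≤ n → 3 ℕ.* n ℕ.≤ 2 ℕ.^ n
3*n≤2^n 4≤n = go (ℕP.≤⇒≤′ 4≤n)
  where
  go : ∀ {n} → 4 ℕ.≤′ n → 3 ℕ.* n ℕ.≤ 2 ℕ.^ n
  go (ℕ.≤′-reflexive ≡.refl) = ℕP.m≤m+n 12 4
  go {suc n} (ℕ.≤′-step 4≤′n) = ℕP.≤-trans (ℕP.≤-reflexive (ℕP.*-suc 3 n)) (ℕP.≤-trans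
    (ℕP.+-mono-≤ (ℕP.≤-trans (ℕP.≤-trans (ℕP.n≤1+n 3) (ℕP.≤′⇒≤ 4≤′n)) (ℕP.<⇒≤ (n<2^n n))) (go 4≤′n))
    (ℕP.≤-reflexive (2*2^ n)))

-- With P = 2 ^ L the base is at most 2 ^ (L * P + 1), so the power is at most 2 ^ (P * P * P), and
-- 3 * L ≤ 2 ^ L absorbs the cube. This is where three exponentials per unit of list length come
-- from.
end-homogeneous-bound : ∀ {q} L → q ℕ.≤ L → 4 ℕ.≤ L → suc (q ℕ.^ (2 ℕ.^ L)) ℕ.^ L ℕ.≤ 2 ℕ.^ (2 ℕ.^ (2 ℕ.^ L))
end-homogeneous-bound {q} L q≤L 4≤L = begin
  suc (q ℕ.^ P) ℕ.^ L               ≤⟨ ℕP.^-monoˡ-≤ L (ℕ.s≤s (ℕP.^-monoˡ-≤ P (ℕP.≤-trans q≤L (ℕP.<⇒≤ (n<2^n L))))) ⟩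
  suc ((2 ℕ.^ L) ℕ.^ P) ℕ.^ L       ≡⟨ ≡.cong (λ x → suc x ℕ.^ L) (ℕP.^-*-assoc 2 L P) ⟩
  suc (2 ℕ.^ (L ℕ.* P)) ℕ.^ L       ≤⟨ ℕP.^-monoˡ-≤ L (ℕP.≤-trans (ℕP.+-monoˡ-≤ _ (1≤2^ (L ℕ.* P)))
      (ℕP.≤-reflexive (2*2^ (L ℕ.* P)))) ⟩
  (2 ℕ.^ suc (L ℕ.* P)) ℕ.^ L       ≡⟨ ℕP.^-*-assoc 2 (suc (L ℕ.* P)) L ⟩
  2 ℕ.^ (suc (L ℕ.* P) ℕ.* L)       ≤⟨ ℕP.^-monoʳ-≤ 2 (ℕP.*-mono-≤ 1+LP≤PP (ℕP.<⇒≤ (n<2^n L))) ⟩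
  2 ℕ.^ (P ℕ.* P ℕ.* P)             ≡⟨ ≡.cong (2 ℕ.^_) cube ⟩
  2 ℕ.^ (2 ℕ.^ (3 ℕ.* L))           ≤⟨ ℕP.^-monoʳ-≤ 2 (ℕP.^-monoʳ-≤ 2 (3*n≤2^n 4≤L)) ⟩
  2 ℕ.^ (2 ℕ.^ P)                   ∎
  where
  open ℕP.≤-Reasoning
  P : ℕ
  P = 2 ℕ.^ L

  1+LP≤PP : suc (L ℕ.* P) ℕ.≤ P ℕ.* P
  1+LP≤PP = ℕP.≤-trans (ℕP.+-monoˡ-≤ (L ℕ.* P) (1≤2^ L)) (ℕP.*-monoˡ-≤ P (n<2^n L))

  cube : P ℕ.* P ℕ.* P ≡ 2 ℕ.^ (3 ℕ.* L)
  cube = ≡.trans (≡.trans (ℕP.*-assoc P P P) (≡.cong (λ x → P ℕ.* (P ℕ.* x)) (≡.sym (ℕP.*-identityʳ P))))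
    (≡.trans (ℕP.^-*-assoc 2 L 3) (≡.cong (2 ℕ.^_) (ℕP.*-comm L 3)))

n<tower : ∀ n → n ℕ.< tower n
n<tower zero    = ℕ.s≤s ℕ.z≤n
n<tower (suc n) = ℕP.≤-<-trans (n<tower n) (n<2^n (tower n))

tower-mono-≤ : ∀ {m n} → m ℕ.≤ n → tower m ℕ.≤ tower n
tower-mono-≤ {n = n} ℕ.z≤n = ℕP.≤-trans (ℕ.s≤s ℕ.z≤n) (n<tower n)
tower-mono-≤ (ℕ.s≤s m≤n)   = ℕP.^-monoʳ-≤ 2 (tower-mono-≤ m≤n)

Homogeneous : ∀ {A B : Set} → ℕ → (List A → B) → List A → Set
Homogeneous k f ys = ∀ {p p′} → p ⊆ ys → p′ ⊆ ys → length p ≡ k → length p′ ≡ k → f p ≡ f p′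

-- The stepping-up argument of Erdős and Rado.
ramsey : ∀ {A : Set} {q} .{{_ : NonZero q}} k h (f : List A → Fin q) xs → q ℕ.≤ tower h → 2 ℕ.≤ h →
  tower (k ℕ.* 3 ℕ.+ h) ℕ.≤ length xs → ∃[ ys ] ys ⊆ xs × length ys ≡ tower h × Homogeneous k f ys
ramsey zero    h f xs q≤ 2≤h large = take (tower h) xs , take-⊆ (tower h) xs ,
  ≡.trans (ListP.length-take (tower h) xs) (ℕP.m≤n⇒m⊓n≡m large) , λ { {[]} {[]} _ _ _ _ → ≡.refl }
ramsey (suc k) h f xs q≤ 2≤h large =
  let L = tower (k ℕ.* 3 ℕ.+ h)
      cs , z , cs⊆ , length-cs , end = end-homogeneous (f ∘ reverse) xs L L [] xs ⊆-refl ℕP.≤-refl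
        (ℕP.≤-trans (end-homogeneous-bound L (ℕP.≤-trans q≤ (tower-mono-≤ (ℕP.m≤n+m h (k ℕ.* 3))))
          (tower-mono-≤ (ℕP.≤-trans 2≤h (ℕP.m≤n+m h (k ℕ.* 3))))) large) (λ _ _ ())
      -- The induced colouring of shorter lists is `f` after appending `z` at the end; the two
      -- reversals only serve to append.
      ys , ys⊆ , length-ys , homogeneous = ramsey k h (λ p → f (reverse (z ∷ reverse p))) (reverse cs) q≤ 2≤h
        (ℕP.≤-reflexive (≡.sym (≡.trans (ListP.length-reverse cs) length-cs)))
  in ys , ⊆-trans ys⊆ cs⊆ , length-ys , λ {p} {p′} p⊆ p′⊆ |p| |p′| →
    let r , r⊆ , |r| , fp = last-irrelevant {cs} {z} end ys⊆ p p⊆ |p|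
        r′ , r′⊆ , |r′| , fp′ = last-irrelevant {cs} {z} end ys⊆ p′ p′⊆ |p′|
    in ≡.trans fp (≡.trans (homogeneous r⊆ r′⊆ |r| |r′|) (≡.sym fp′))
  where
  -- Reversal moves the last element of `p` to the head, where `end` exchanges it for `z`. The list
  -- `r` is `p` without its last element.
  last-irrelevant : ∀ {cs z ys} → (∀ x p → x ∷ p ⊆ cs → f (reverse (x ∷ p)) ≡ f (reverse (z ∷ p))) → ys ⊆ reverse cs →
    ∀ p → p ⊆ ys → length p ≡ suc k → ∃[ r ] r ⊆ ys × length r ≡ k × f p ≡ f (reverse (z ∷ reverse r))
  last-irrelevant {cs} {z} {ys} end ys⊆ p p⊆ |p| with reverse p in eq
  ... | [] = contradiction (≡.trans (≡.sym |p|) (≡.trans (≡.sym (ListP.length-reverse p)) (≡.cong length eq))) λ ()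
  ... | x ∷ s = reverse s ,
    ⊆-trans (≡.subst (reverse s ⊆_) (≡.trans (≡.cong reverse (≡.sym eq)) (ListP.reverse-involutive p))
        (reverse⁺ {as = s} {bs = x ∷ s} (x ∷ʳ ⊆-refl))) p⊆ ,
    ≡.trans (ListP.length-reverse s) (ℕP.suc-injective (≡.trans (≡.cong length (≡.sym eq))
        (≡.trans (ListP.length-reverse p) |p|))) ,
    (begin
      f p                                    ≡⟨ ≡.cong f (ListP.reverse-involutive p) ⟨
      f (reverse (reverse p))                ≡⟨ ≡.cong (f ∘ reverse) eq ⟩
      f (reverse (x ∷ s))                    ≡⟨ end x s xs⊆cs ⟩
      f (reverse (z ∷ s))                    ≡⟨ ≡.cong (λ t → f (reverse (z ∷ t))) (ListP.reverse-involutive s) ⟨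
      f (reverse (z ∷ reverse (reverse s)))  ∎)
    where
    open ≡.≡-Reasoning
    xs⊆cs : x ∷ s ⊆ cs
    xs⊆cs = ≡.subst₂ _⊆_ eq (ListP.reverse-involutive cs) (reverse⁺ (⊆-trans p⊆ ys⊆))

-- Excluded middle makes a predicate a colouring with two colours. It also decides whether some list
-- of length k satisfies `P`, so the dichotomy makes sense even if `ys` is shorter than k.
ramsey-predicate : ExcludedMiddle 0ℓ → ∀ {A : Set} k h (P : List A → Set) xs → 2 ℕ.≤ h →
    tower (k ℕ.* 3 ℕ.+ h) ℕ.≤ length xs →
  ∃[ ys ] ys ⊆ xs × length ys ≡ tower h ×
    ((∀ {p} → p ⊆ ys → length p ≡ k → P p) ⊎ (∀ {p} → p ⊆ ys → length p ≡ k → ¬ P p))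
ramsey-predicate em {A} k h P xs 2≤h large =
  let ys , ys⊆ , length-ys , homogeneous = ramsey k h colour xs (ℕP.≤-trans (ℕP.m≤m+n 2 2) (tower-mono-≤ 2≤h)) 2≤h large
  in ys , ys⊆ , length-ys , monochromatic homogeneous
  where
  colourᵈ : ∀ {B : Set} → Dec B → Fin 2
  colourᵈ (yes _) = zero
  colourᵈ (no  _) = suc zero

  colour : List A → Fin 2
  colour p = colourᵈ (em {P p})

  same : ∀ {B C : Set} (b : Dec B) (c : Dec C) → colourᵈ b ≡ colourᵈ c → B → C
  same _        (yes c) _  _ = c
  same (no ¬b)  (no ¬c) _  b = contradiction b ¬b
  same (yes _)  (no ¬c) () _

  monochromatic : ∀ {ys} → Homogeneous k colour ys →
    (∀ {p} → p ⊆ ys → length p ≡ k → P p) ⊎ (∀ {p} → p ⊆ ys → length p ≡ k → ¬ P p)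
  monochromatic {ys} homogeneous with em {∃[ p ] p ⊆ ys × length p ≡ k × P p}
  ... | yes (p , p⊆ , |p| , Pp) = inj₁ λ {p′} p′⊆ |p′| → same (em {P p}) (em {P p′}) (homogeneous p⊆ p′⊆ |p| |p′|) Pp
  ... | no ∄p                   = inj₂ λ {p′} p′⊆ |p′| Pp′ → ∄p (p′ , p′⊆ , |p′| , Pp′)

module OverField (em : ExcludedMiddle 0ℓ) (R : CompleteOrderedField) where

  open OverReals R
  open CompleteOrderedField R using
    ( commutativeRing; isTotalOrder; +-monoˡ-≤; *-nonNeg; 0≉1; *-inverseʳ; sup-upper; sup-least; totalOrder
    ; +-cong; +-congˡ; +-congʳ; *-cong; *-congˡ; *-congʳ; -‿cong; +-comm; +-assoc; *-comm; *-assoc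
    ; +-identityˡ; +-identityʳ; *-identityˡ; *-identityʳ; zeroˡ; zeroʳ; -‿inverseʳ
    ; distribˡ; distribʳ; setoid; ring; semiring )
    renaming (refl to ≈-refl; sym to ≈-sym; trans to ≈-trans; reflexive to ≈-reflexive)
  open Mult semiring using (×-homo-+; ×1-homo-*)
  open RingP ring using (-‿distribˡ-*; -‿distribʳ-*; -‿involutive; -0#≈0#; -‿+-comm)

  -- Numerals and a ring solver with integer coefficients

  fromℕ-+ : ∀ m n → fromℕ (m ℕ.+ n) ≈ fromℕ m + fromℕ n
  fromℕ-+ = ×-homo-+ 1#

  fromℕ-* : ∀ m n → fromℕ (m ℕ.* n) ≈ fromℕ m * fromℕ n
  fromℕ-* = ×1-homo-*

  module Solver where
    open SetoidReasoning setoid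

    -- The clause for 1 is separate because `fromℕ 1` is `1# + 0#`. In this form `con (+ 0)` and
    -- `con (+ 1)` are `0#` and `1#` by computation, and larger constants are `fromℕ` of the
    -- numeral, so that solver equations match the goals.
    ⟦_⟧ℤ : ℤ → ℝ
    ⟦ + 0 ⟧ℤ           = 0#
    ⟦ + 1 ⟧ℤ           = 1#
    ⟦ + suc (suc n) ⟧ℤ = fromℕ (suc (suc n))
    ⟦ -[1+ n ] ⟧ℤ      = - fromℕ (suc n)

    ⟦+_⟧ : ∀ n → ⟦ + n ⟧ℤ ≈ fromℕ n
    ⟦+ 0 ⟧           = ≈-refl
    ⟦+ 1 ⟧           = ≈-sym (+-identityʳ 1#)
    ⟦+ suc (suc n) ⟧ = ≈-refl

    ⟦⊖⟧ : ∀ m n → ⟦ m ⊖ n ⟧ℤ ≈ fromℕ m - fromℕ n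
    ⟦⊖⟧ zero    zero    = ≈-sym (-‿inverseʳ 0#)
    ⟦⊖⟧ zero    (suc n) = ≈-sym (+-identityˡ _)
    ⟦⊖⟧ (suc m) zero    = begin
      ⟦ + suc m ⟧ℤ        ≈⟨ ⟦+ suc m ⟧ ⟩
      fromℕ (suc m)       ≈⟨ +-identityʳ _ ⟨
      fromℕ (suc m) + 0#  ≈⟨ +-congˡ -0#≈0# ⟨
      fromℕ (suc m) - 0#  ∎
    ⟦⊖⟧ (suc m) (suc n) = begin
      ⟦ suc m ⊖ suc n ⟧ℤ                    ≡⟨ ≡.cong ⟦_⟧ℤ (ℤP.[1+m]⊖[1+n]≡m⊖n m n) ⟩
      ⟦ m ⊖ n ⟧ℤ                            ≈⟨ ⟦⊖⟧ m n ⟩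
      fromℕ m - fromℕ n                     ≈⟨ +-identityˡ _ ⟨
      0# + (fromℕ m - fromℕ n)              ≈⟨ +-congʳ (-‿inverseʳ 1#) ⟨
      (1# - 1#) + (fromℕ m - fromℕ n)       ≈⟨ +-assoc _ _ _ ⟩
      1# + (- 1# + (fromℕ m - fromℕ n))     ≈⟨ +-congˡ (+-assoc _ _ _) ⟨
      1# + ((- 1# + fromℕ m) - fromℕ n)     ≈⟨ +-congˡ (+-congʳ (+-comm _ _)) ⟩
      1# + ((fromℕ m - 1#) - fromℕ n)       ≈⟨ +-congˡ (+-assoc _ _ _) ⟩
      1# + (fromℕ m + (- 1# - fromℕ n))     ≈⟨ +-assoc _ _ _ ⟨
      fromℕ (suc m) + (- 1# - fromℕ n)      ≈⟨ +-congˡ (-‿+-comm 1# (fromℕ n)) ⟩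
      fromℕ (suc m) - fromℕ (suc n)         ∎

    ⟦⟧-+ : ∀ i j → ⟦ i ℤ.+ j ⟧ℤ ≈ ⟦ i ⟧ℤ + ⟦ j ⟧ℤ
    ⟦⟧-+ (+ m)    (+ n)    = begin
      ⟦ + (m ℕ.+ n) ⟧ℤ      ≈⟨ ⟦+ m ℕ.+ n ⟧ ⟩
      fromℕ (m ℕ.+ n)       ≈⟨ fromℕ-+ m n ⟩
      fromℕ m + fromℕ n     ≈⟨ +-cong ⟦+ m ⟧ ⟦+ n ⟧ ⟨
      ⟦ + m ⟧ℤ + ⟦ + n ⟧ℤ   ∎
    ⟦⟧-+ (+ m)    -[1+ n ] = ≈-trans (⟦⊖⟧ m (suc n)) (+-congʳ (≈-sym ⟦+ m ⟧))
    ⟦⟧-+ -[1+ m ] (+ n)    = ≈-trans (⟦⊖⟧ n (suc m)) (≈-trans (+-comm _ _) (+-congˡ (≈-sym ⟦+ n ⟧)))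
    ⟦⟧-+ -[1+ m ] -[1+ n ] = begin
      - fromℕ (suc (suc (m ℕ.+ n)))    ≡⟨ ≡.cong (λ k → - fromℕ (suc k)) (ℕP.+-suc m n) ⟨
      - fromℕ (suc m ℕ.+ suc n)        ≈⟨ -‿cong (fromℕ-+ (suc m) (suc n)) ⟩
      - (fromℕ (suc m) + fromℕ (suc n)) ≈⟨ -‿+-comm _ _ ⟨
      - fromℕ (suc m) - fromℕ (suc n)  ∎

    ⟦⟧-neg : ∀ i → ⟦ ℤ.- i ⟧ℤ ≈ - ⟦ i ⟧ℤ
    ⟦⟧-neg (+ 0)     = ≈-sym -0#≈0#
    ⟦⟧-neg (+ suc n) = -‿cong (≈-sym ⟦+ suc n ⟧)
    ⟦⟧-neg -[1+ n ]  = ≈-trans ⟦+ suc n ⟧ (≈-sym (-‿involutive _))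

    ⟦⟧-pos-* : ∀ m n → ⟦ + m ℤ.* + n ⟧ℤ ≈ ⟦ + m ⟧ℤ * ⟦ + n ⟧ℤ
    ⟦⟧-pos-* m n = begin
      ⟦ + m ℤ.* + n ⟧ℤ     ≡⟨ ≡.cong ⟦_⟧ℤ (ℤP.pos-* m n) ⟨
      ⟦ + (m ℕ.* n) ⟧ℤ     ≈⟨ ⟦+ m ℕ.* n ⟧ ⟩
      fromℕ (m ℕ.* n)      ≈⟨ fromℕ-* m n ⟩
      fromℕ m * fromℕ n    ≈⟨ *-cong ⟦+ m ⟧ ⟦+ n ⟧ ⟨
      ⟦ + m ⟧ℤ * ⟦ + n ⟧ℤ  ∎

    ⟦⟧-* : ∀ i j → ⟦ i ℤ.* j ⟧ℤ ≈ ⟦ i ⟧ℤ * ⟦ j ⟧ℤ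
    ⟦⟧-* (+ m)    (+ n)    = ⟦⟧-pos-* m n
    ⟦⟧-* (+ m)    -[1+ n ] = begin
      ⟦ + m ℤ.* ℤ.- (+ suc n) ⟧ℤ   ≡⟨ ≡.cong ⟦_⟧ℤ (ℤP.neg-distribʳ-* (+ m) (+ suc n)) ⟨
      ⟦ ℤ.- (+ m ℤ.* + suc n) ⟧ℤ   ≈⟨ ⟦⟧-neg (+ m ℤ.* + suc n) ⟩
      - ⟦ + m ℤ.* + suc n ⟧ℤ       ≈⟨ -‿cong (⟦⟧-pos-* m (suc n)) ⟩
      - (⟦ + m ⟧ℤ * ⟦ + suc n ⟧ℤ)  ≈⟨ -‿distribʳ-* _ _ ⟩
      ⟦ + m ⟧ℤ * - ⟦ + suc n ⟧ℤ    ≈⟨ *-congˡ (-‿cong ⟦+ suc n ⟧) ⟩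
      ⟦ + m ⟧ℤ * ⟦ -[1+ n ] ⟧ℤ     ∎
    ⟦⟧-* -[1+ m ] (+ n)    = begin
      ⟦ ℤ.- (+ suc m) ℤ.* + n ⟧ℤ   ≡⟨ ≡.cong ⟦_⟧ℤ (ℤP.neg-distribˡ-* (+ suc m) (+ n)) ⟨
      ⟦ ℤ.- (+ suc m ℤ.* + n) ⟧ℤ   ≈⟨ ⟦⟧-neg (+ suc m ℤ.* + n) ⟩
      - ⟦ + suc m ℤ.* + n ⟧ℤ       ≈⟨ -‿cong (⟦⟧-pos-* (suc m) n) ⟩
      - (⟦ + suc m ⟧ℤ * ⟦ + n ⟧ℤ)  ≈⟨ -‿distribˡ-* _ _ ⟩
      - ⟦ + suc m ⟧ℤ * ⟦ + n ⟧ℤ    ≈⟨ *-congʳ (-‿cong ⟦+ suc m ⟧) ⟩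
      ⟦ -[1+ m ] ⟧ℤ * ⟦ + n ⟧ℤ     ∎
    ⟦⟧-* -[1+ m ] -[1+ n ] = begin
      ⟦ + suc m ℤ.* + suc n ⟧ℤ         ≈⟨ ⟦⟧-pos-* (suc m) (suc n) ⟩
      ⟦ + suc m ⟧ℤ * ⟦ + suc n ⟧ℤ      ≈⟨ *-cong ⟦+ suc m ⟧ ⟦+ suc n ⟧ ⟩
      fromℕ (suc m) * fromℕ (suc n)    ≈⟨ -‿involutive _ ⟨
      - - (fromℕ (suc m) * fromℕ (suc n)) ≈⟨ -‿cong (-‿distribˡ-* _ _) ⟩
      - (- fromℕ (suc m) * fromℕ (suc n)) ≈⟨ -‿distribʳ-* _ _ ⟩
      - fromℕ (suc m) * - fromℕ (suc n) ∎

    ℤ⟶ℝ : ℤ.+-*-rawRing -Raw-AlmostCommutative⟶ fromCommutativeRing commutativeRing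
    ℤ⟶ℝ = record
      { ⟦_⟧ = ⟦_⟧ℤ ; +-homo = ⟦⟧-+ ; *-homo = ⟦⟧-* ; -‿homo = ⟦⟧-neg ; 0-homo = ≈-refl ; 1-homo = ≈-refl }

    _≟ℤ_ : ∀ i j → Maybe (⟦ i ⟧ℤ ≈ ⟦ j ⟧ℤ)
    i ≟ℤ j with i ℤP.≟ j
    ... | yes i≡j = just (≈-reflexive (≡.cong ⟦_⟧ℤ i≡j))
    ... | no  _   = nothing

    open RingSolver ℤ.+-*-rawRing (fromCommutativeRing commutativeRing) ℤ⟶ℝ _≟ℤ_ public
      using (solve; _:=_; _:+_; _:*_; _:-_; :-_; _:^_; con)

  open Solver public using (solve; _:=_; _:+_; _:*_; _:-_; :-_; _:^_; con)

  open IsTotalOrder isTotalOrder using ()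
    renaming (refl to ≤-refl; reflexive to ≤-reflexive; trans to ≤-trans; antisym to ≤-antisym; total to ≤-total;
        ≤-respˡ-≈ to ≤-respˡ; ≤-respʳ-≈ to ≤-respʳ) public
  module ≤-Reasoning = PartialOrderReasoning (TotalOrder.poset totalOrder)

  -- Inequalities in an ordered field

  infixl 6 _⊕_ _⊕<_
  infixl 7 _⊗_ _⊗<_

  -- An inequality x ≤ y is usually proved by writing y - x, up to the ring
  -- solver, as a combination of quantities known to be nonnegative.
  Δ : ∀ {x y} → x ≤ y → 0# ≤ y - x
  Δ {x} x≤y = ≤-respˡ (-‿inverseʳ x) (+-monoˡ-≤ (- x) x≤y)

  _⊕_ : ∀ {x y} → 0# ≤ x → 0# ≤ y → 0# ≤ x + y
  _⊕_ {x} {y} 0≤x 0≤y = ≤-trans 0≤y (≤-respˡ (+-identityˡ y) (+-monoˡ-≤ y 0≤x))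

  _⊗_ : ∀ {x y} → 0# ≤ x → 0# ≤ y → 0# ≤ x * y
  _⊗_ = *-nonNeg

  ≤-by : ∀ {x y p} → 0# ≤ p → y - x ≈ p → x ≤ y
  ≤-by {x} {y} {p} 0≤p eq = begin
    x            ≈⟨ +-identityˡ x ⟨
    0# + x       ≤⟨ +-monoˡ-≤ x 0≤p ⟩
    p + x        ≈⟨ +-congʳ eq ⟨
    (y - x) + x  ≈⟨ solve 2 (λ x y → (y :- x) :+ x := y) ≈-refl x y ⟩
    y            ∎
    where open ≤-Reasoning

  ≰⇒≥ : ∀ {x y} → ¬ x ≤ y → y ≤ x
  ≰⇒≥ {x} {y} x≰y with ≤-total x y
  ... | inj₁ x≤y = contradiction x≤y x≰y
  ... | inj₂ y≤x = y≤x

  ≰⇒> : ∀ {x y} → ¬ x ≤ y → y < x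
  ≰⇒> x≰y = ≰⇒≥ x≰y , λ y≈x → x≰y (≤-reflexive (≈-sym y≈x))

  <⇒≱ : ∀ {x y} → x < y → ¬ y ≤ x
  <⇒≱ (x≤y , x≉y) y≤x = x≉y (≤-antisym x≤y y≤x)

  <⇒≤ : ∀ {x y} → x < y → x ≤ y
  <⇒≤ = proj₁

  ≤-<-trans : ∀ {x y z} → x ≤ y → y < z → x < z
  ≤-<-trans x≤y y<z = ≰⇒> λ z≤x → <⇒≱ y<z (≤-trans z≤x x≤y)

  <-≤-trans : ∀ {x y z} → x < y → y ≤ z → x < z
  <-≤-trans x<y y≤z = ≰⇒> λ z≤x → <⇒≱ x<y (≤-trans y≤z z≤x)

  Δ< : ∀ {x y} → x < y → 0# < y - x
  Δ< {x} {y} x<y = ≰⇒> λ y-x≤0 → <⇒≱ x<y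
    (≤-by (Δ y-x≤0) (solve 2 (λ x y → x :- y := con (+ 0) :- (y :- x)) ≈-refl x y))

  <-by : ∀ {x y p} → 0# < p → y - x ≈ p → x < y
  <-by {x} {y} {p} 0<p eq = ≰⇒> λ y≤x → <⇒≱ 0<p
    (≤-by (Δ y≤x) (≈-trans (+-congˡ (-‿cong (≈-sym eq)))
      (solve 2 (λ x y → con (+ 0) :- (y :- x) := x :- y) ≈-refl x y)))

  _⊕<_ : ∀ {x y} → 0# < x → 0# ≤ y → 0# < x + y
  _⊕<_ {x} {y} 0<x 0≤y = <-≤-trans 0<x (≤-by 0≤y (solve 2 (λ x y → x :+ y :- x := y) ≈-refl x y))

  >⇒≉0 : ∀ {x} → 0# < x → ¬ x ≈ 0#
  >⇒≉0 0<x x≈0 = proj₂ 0<x (≈-sym x≈0)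

  _⊗<_ : ∀ {x y} → 0# < x → 0# < y → 0# < x * y
  _⊗<_ {x} {y} 0<x 0<y = <⇒≤ 0<x ⊗ <⇒≤ 0<y , λ 0≈xy → >⇒≉0 0<x (begin
    x                ≈⟨ *-identityʳ x ⟨
    x * 1#           ≈⟨ *-congˡ (*-inverseʳ (>⇒≉0 0<y)) ⟨
    x * (y * y ⁻¹)   ≈⟨ *-assoc x y (y ⁻¹) ⟨
    x * y * y ⁻¹     ≈⟨ *-congʳ 0≈xy ⟨
    0# * y ⁻¹        ≈⟨ zeroˡ (y ⁻¹) ⟩
    0#               ∎)
    where open SetoidReasoning setoid

  0≤-x : ∀ {x} → x ≤ 0# → 0# ≤ - x
  0≤-x {x} x≤0 = ≤-by (Δ x≤0) (solve 1 (λ x → :- x :- con (+ 0) := con (+ 0) :- x) ≈-refl x)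

  0≤x*x : ∀ x → 0# ≤ x * x
  0≤x*x x with ≤-total 0# x
  ... | inj₁ 0≤x = 0≤x ⊗ 0≤x
  ... | inj₂ x≤0 = ≤-respʳ (solve 1 (λ x → :- x :* :- x := x :* x) ≈-refl x) (0≤-x x≤0 ⊗ 0≤-x x≤0)

  0<1 : 0# < 1#
  0<1 = ≤-respʳ (*-identityʳ 1#) (0≤x*x 1#) , 0≉1

  0≤1 : 0# ≤ 1#
  0≤1 = <⇒≤ 0<1

  0≤fromℕ : ∀ n → 0# ≤ fromℕ n
  0≤fromℕ zero    = ≤-refl
  0≤fromℕ (suc n) = 0≤1 ⊕ 0≤fromℕ n

  0<fromℕ-suc : ∀ n → 0# < fromℕ (suc n)
  0<fromℕ-suc n = 0<1 ⊕< 0≤fromℕ n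

  0<fromℕ : ∀ {n} → 1 ℕ.≤ n → 0# < fromℕ n
  0<fromℕ {suc n} _ = 0<fromℕ-suc n

  fromℕ-mono : ∀ {m n} → m ℕ.≤ n → fromℕ m ≤ fromℕ n
  fromℕ-mono {n = n} ℕ.z≤n = 0≤fromℕ n
  fromℕ-mono {suc m} {suc n} (ℕ.s≤s m≤n) = ≤-by (Δ (fromℕ-mono m≤n))
    (solve 2 (λ m n → (con (+ 1) :+ n) :- (con (+ 1) :+ m) := n :- m) ≈-refl (fromℕ m) (fromℕ n))

  *-monoʳ-≤ : ∀ {x y z} → 0# ≤ z → x ≤ y → z * x ≤ z * y
  *-monoʳ-≤ {x} {y} {z} 0≤z x≤y = ≤-by (0≤z ⊗ Δ x≤y)
    (solve 3 (λ x y z → z :* y :- z :* x := z :* (y :- x)) ≈-refl x y z)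

  *-mono-≤ : ∀ {x y u v} → 0# ≤ x → x ≤ y → 0# ≤ u → u ≤ v → x * u ≤ y * v
  *-mono-≤ {x} {y} {u} {v} 0≤x x≤y 0≤u u≤v = ≤-by (Δ x≤y ⊗ (0≤u ⊕ Δ u≤v) ⊕ 0≤x ⊗ Δ u≤v)
    (solve 4 (λ x y u v → y :* v :- x :* u := (y :- x) :* (u :+ (v :- u)) :+ x :* (v :- u)) ≈-refl x y u v)

  *-cancelʳ-≤ : ∀ {x y z} → 0# < z → x * z ≤ y * z → x ≤ y
  *-cancelʳ-≤ {x} {y} {z} 0<z xz≤yz with em {x ≤ y}
  ... | yes x≤y = x≤y
  ... | no  x≰y = contradiction xz≤yz (<⇒≱ (<-by (Δ< (≰⇒> x≰y) ⊗< 0<z)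
    (solve 3 (λ x y z → x :* z :- y :* z := (x :- y) :* z) ≈-refl x y z)))

  0<⁻¹ : ∀ {x} → 0# < x → 0# < x ⁻¹
  0<⁻¹ {x} 0<x = ≰⇒> λ x⁻¹≤0 → <⇒≱ 0<1 (begin
    1#              ≈⟨ *-inverseʳ (>⇒≉0 0<x) ⟨
    x * x ⁻¹        ≤⟨ *-monoʳ-≤ (<⇒≤ 0<x) x⁻¹≤0 ⟩
    x * 0#          ≈⟨ zeroʳ x ⟩
    0#              ∎)
    where open ≤-Reasoning

  0</ : ∀ {x y} → 0# < x → 0# < y → 0# < x / y
  0</ 0<x 0<y = 0<x ⊗< 0<⁻¹ 0<y

  /-* : ∀ x {y} → 0# < y → x / y * y ≈ x
  /-* x {y} 0<y = begin
    x * y ⁻¹ * y    ≈⟨ *-assoc x (y ⁻¹) y ⟩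
    x * (y ⁻¹ * y)  ≈⟨ *-congˡ (*-comm (y ⁻¹) y) ⟩
    x * (y * y ⁻¹)  ≈⟨ *-congˡ (*-inverseʳ (>⇒≉0 0<y)) ⟩
    x * 1#          ≈⟨ *-identityʳ x ⟩
    x               ∎
    where open SetoidReasoning setoid

  ≤-/ : ∀ {x y z} → 0# < z → x * z ≤ y → x ≤ y / z
  ≤-/ {x} {y} 0<z xz≤y = *-cancelʳ-≤ 0<z (≤-respʳ (≈-sym (/-* y 0<z)) xz≤y)

  /-≤ : ∀ {x y z} → 0# < z → x ≤ y * z → x / z ≤ y
  /-≤ {x} {y} 0<z x≤yz = *-cancelʳ-≤ 0<z (≤-respˡ (≈-sym (/-* x 0<z)) x≤yz)

  -- The axioms for `sup` speak only of inhabited and bounded sets; by uniqueness, `v` serves both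
  -- as an element and as a bound.
  the-≈ : ∀ {P v} → P v → (∀ {u} → P u → u ≈ v) → the P ≈ v
  the-≈ {P} {v} Pv unique = ≤-antisym (sup-least P (v , Pv) ub) (sup-upper P ub Pv)
    where
    ub : ∀ {u} → P u → u ≤ v
    ub Pu = ≤-reflexive (unique Pu)

  -- If all naturals were at most `x`, they would have a supremum s; as n + 1 ≤ s for every n,
  -- already s - 1 would be an upper bound.
  archimedean : ∀ x → ∃[ n ] x < fromℕ n
  archimedean x with em {∃[ n ] x < fromℕ n}
  ... | yes ∃n = ∃n
  ... | no ¬∃n = contradiction (sup-least ℕs (0# , 0 , ≈-refl) s-1-bound) (<⇒≱ (<-by 0<1
          (solve 1 (λ s → s :- (s :- con (+ 1)) := con (+ 1)) ≈-refl (sup ℕs))))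
    where
    ℕs : ℝ → Set
    ℕs y = ∃[ n ] y ≈ fromℕ n

    bound : ∀ {y} → ℕs y → y ≤ x
    bound (n , y≈n) with em {fromℕ n ≤ x}
    ... | yes n≤x = ≤-respˡ (≈-sym y≈n) n≤x
    ... | no  n≰x = contradiction (n , ≰⇒> n≰x) ¬∃n

    s-1-bound : ∀ {y} → ℕs y → y ≤ sup ℕs - 1#
    s-1-bound {y} (n , y≈n) = ≤-by (Δ (sup-upper ℕs bound (suc n , +-congˡ y≈n)))
      (solve 2 (λ y s → s :- con (+ 1) :- y := s :- (con (+ 1) :+ y)) ≈-refl y (sup ℕs))

  module Abs where
    open Max totalOrder using (maxOperator)
    open MaxOp maxOperator using (x≤x⊔y; x≤y⊔x; ⊔-lub)

    x≤abs : ∀ x → x ≤ abs x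
    x≤abs x = x≤x⊔y x (- x)

    -x≤abs : ∀ x → - x ≤ abs x
    -x≤abs x = x≤y⊔x x (- x)

    abs-≤ : ∀ {x b} → x ≤ b → - x ≤ b → abs x ≤ b
    abs-≤ = ⊔-lub

  open Abs public

  abs-< : ∀ {x b} → x < b → - x < b → abs x < b
  abs-< {x} x<b -x<b with ≤-total x (- x)
  ... | inj₁ x≤-x = ≤-<-trans (abs-≤ x≤-x ≤-refl) -x<b
  ... | inj₂ -x≤x = ≤-<-trans (abs-≤ ≤-refl -x≤x) x<b

  0≤abs : ∀ x → 0# ≤ abs x
  0≤abs x with ≤-total 0# x
  ... | inj₁ 0≤x = ≤-trans 0≤x (x≤abs x)
  ... | inj₂ x≤0 = ≤-trans (0≤-x x≤0) (-x≤abs x)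

  ½ : ℝ
  ½ = 1# / fromℕ 2

  0<½ : 0# < ½
  0<½ = 0</ 0<1 (0<fromℕ-suc 1)

  ½+½ : ∀ x → x * ½ + x * ½ ≈ x
  ½+½ x = ≈-trans (solve 2 (λ x h → x :* h :+ x :* h := x :* (h :* con (+ 2))) ≈-refl x ½)
    (≈-trans (*-congˡ (/-* 1# (0<fromℕ-suc 1))) (*-identityʳ x))

  -- Limits

  ⟶-intro : ∀ {a l} →
    (∀ η → 0# < η → ∃[ N ] (∀ m → N ℕ.≤ m → a m - l < η × l - a m < η)) → a ⟶ l
  ⟶-intro {a} {l} h η 0<η with h η 0<η
  ... | N , close = N , λ m N≤m → abs-< (proj₁ (close m N≤m))
    (≤-<-trans (≤-reflexive (solve 2 (λ x y → :- (x :- y) := y :- x) ≈-refl (a m) l)) (proj₂ (close m N≤m)))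

  ⟶-upper : ∀ {a l} → a ⟶ l → ∀ η → 0# < η → ∃[ N ] (∀ m → N ℕ.≤ m → a m - l < η)
  ⟶-upper a⟶l η 0<η with a⟶l η 0<η
  ... | N , close = N , λ m N≤m → ≤-<-trans (x≤abs _) (close m N≤m)

  ⟶-lower : ∀ {a l} → a ⟶ l → ∀ η → 0# < η → ∃[ N ] (∀ m → N ℕ.≤ m → l - a m < η)
  ⟶-lower {a} {l} a⟶l η 0<η with a⟶l η 0<η
  ... | N , close = N , λ m N≤m → ≤-<-trans
    (≤-respˡ (solve 2 (λ x y → :- (x :- y) := y :- x) ≈-refl (a m) l) (-x≤abs _)) (close m N≤m)

  limit-≤ : ∀ {a l b} → a ⟶ l → (∀ m → a m ≤ b) → l ≤ b
  limit-≤ {a} {l} {b} a⟶l a≤b with em {l ≤ b}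
  ... | yes l≤b = l≤b
  ... | no  l≰b =
    let N , close = ⟶-lower a⟶l (l - b) (Δ< (≰⇒> l≰b)) in
    contradiction (≤-by (Δ (a≤b N)) (solve 3 (λ l a b → l :- a :- (l :- b) := b :- a) ≈-refl l (a N) b))
      (<⇒≱ (close N ℕP.≤-refl))

  limit-≥ : ∀ {a l b} k → a ⟶ l → (∀ m → k ℕ.≤ m → b ≤ a m) → b ≤ l
  limit-≥ {a} {l} {b} k a⟶l b≤a with em {b ≤ l}
  ... | yes b≤l = b≤l
  ... | no  b≰l =
    let N , close = ⟶-upper a⟶l (b - l) (Δ< (≰⇒> b≰l)) in
    contradiction (≤-by (Δ (b≤a (N ℕ.+ k) (ℕP.m≤n+m k N)))
      (solve 3 (λ l a b → a :- l :- (b :- l) := a :- b) ≈-refl l (a (N ℕ.+ k)) b))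
      (<⇒≱ (close (N ℕ.+ k) (ℕP.m≤m+n N k)))

  ⟶-cong : ∀ {a b l k} → (∀ m → a m ≈ b m) → l ≈ k → a ⟶ l → b ⟶ k
  ⟶-cong {a} {b} {l} {k} a≈b l≈k a⟶l = ⟶-intro λ η 0<η →
    let N₁ , up = ⟶-upper a⟶l η 0<η ; N₂ , low = ⟶-lower a⟶l η 0<η in
    N₁ ℕ.⊔ N₂ , λ m N≤m →
      ≤-<-trans (≤-reflexive (≈-sym (+-cong (a≈b m) (-‿cong l≈k)))) (up m (ℕP.m⊔n≤o⇒m≤o N₁ N₂ N≤m)) ,
      ≤-<-trans (≤-reflexive (≈-sym (+-cong l≈k (-‿cong (a≈b m))))) (low m (ℕP.m⊔n≤o⇒n≤o N₁ N₂ N≤m))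

  ⟶-+ : ∀ {a b l k} → a ⟶ l → b ⟶ k → (λ m → a m + b m) ⟶ (l + k)
  ⟶-+ {a} {b} {l} {k} a⟶l b⟶k = ⟶-intro λ η 0<η →
    let 0<η/2   = 0<η ⊗< 0<½
        N₁ , u₁ = ⟶-upper a⟶l _ 0<η/2
        N₂ , l₁ = ⟶-lower a⟶l _ 0<η/2
        N₃ , u₂ = ⟶-upper b⟶k _ 0<η/2
        N₄ , l₂ = ⟶-lower b⟶k _ 0<η/2
    in (N₁ ℕ.⊔ N₂) ℕ.⊔ (N₃ ℕ.⊔ N₄) , λ m N≤m →
      let N₁₂≤m = ℕP.m⊔n≤o⇒m≤o (N₁ ℕ.⊔ N₂) _ N≤m
          N₃₄≤m = ℕP.m⊔n≤o⇒n≤o (N₁ ℕ.⊔ N₂) _ N≤m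
      in halves (u₁ m (ℕP.m⊔n≤o⇒m≤o N₁ N₂ N₁₂≤m)) (u₂ m (ℕP.m⊔n≤o⇒m≤o N₃ N₄ N₃₄≤m))
           (solve 4 (λ a b l k → a :+ b :- (l :+ k) := (a :- l) :+ (b :- k)) ≈-refl (a m) (b m) l k) ,
         halves (l₁ m (ℕP.m⊔n≤o⇒n≤o N₁ N₂ N₁₂≤m)) (l₂ m (ℕP.m⊔n≤o⇒n≤o N₃ N₄ N₃₄≤m))
           (solve 4 (λ a b l k → l :+ k :- (a :+ b) := (l :- a) :+ (k :- b)) ≈-refl (a m) (b m) l k)
    where
    halves : ∀ {x y z η} → x < η * ½ → y < η * ½ → z ≈ x + y → z < η
    halves {x} {y} {z} {η} x< y< eq = <-by (Δ< x< ⊕< Δ (<⇒≤ y<))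
      (≈-trans (+-cong (≈-sym (½+½ η)) (-‿cong eq))
        (solve 3 (λ h x y → h :+ h :- (x :+ y) := (h :- x) :+ (h :- y)) ≈-refl (η * ½) x y))

  ⟶-const : ∀ l → (λ _ → l) ⟶ l
  ⟶-const l = ⟶-intro λ η 0<η → 0 , λ m _ →
    ≤-<-trans (≤-reflexive (-‿inverseʳ l)) 0<η , ≤-<-trans (≤-reflexive (-‿inverseʳ l)) 0<η

  ⟶-unique : ∀ {a l k} → a ⟶ l → a ⟶ k → l ≈ k
  ⟶-unique a⟶l a⟶k = ≤-antisym (unique-≤ a⟶l a⟶k) (unique-≤ a⟶k a⟶l)
    where
    unique-≤ : ∀ {a l k} → a ⟶ l → a ⟶ k → l ≤ k
    unique-≤ {a} {l} {k} a⟶l a⟶k with em {l ≤ k}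
    ... | yes l≤k = l≤k
    ... | no  l≰k =
      let 0<d    = Δ< (≰⇒> l≰k) ⊗< 0<½
          N₁ , f = ⟶-lower a⟶l _ 0<d
          N₂ , g = ⟶-upper a⟶k _ 0<d
          m      = N₁ ℕ.⊔ N₂
      in contradiction (≤-reflexive (≈-trans (½+½ (l - k))
           (solve 3 (λ l k a → l :- k := (l :- a) :+ (a :- k)) ≈-refl l k (a m))))
         (<⇒≱ (<-by (Δ< (f m (ℕP.m≤m⊔n N₁ N₂)) ⊕< Δ (<⇒≤ (g m (ℕP.m≤n⊔m N₁ N₂))))
           (solve 3 (λ x y h → h :+ h :- (x :+ y) := (h :- x) :+ (h :- y)) ≈-refl (l - a m) (a m - k) ((l - k) * ½))))

  squeeze-null : ∀ {c d : ℕ → ℝ} → c ⟶ 0# → (∀ m → d m ≤ c m) → (∀ m → - d m ≤ c m) → d ⟶ 0#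
  squeeze-null {c} {d} c⟶0 d≤c -d≤c = ⟶-intro λ η 0<η →
    let N , f = ⟶-upper c⟶0 η 0<η in N , λ m N≤m →
      ≤-<-trans (≤-by (Δ (d≤c m)) (solve 2 (λ c d → c :- con (+ 0) :- (d :- con (+ 0)) := c :- d) ≈-refl (c m)
          (d m))) (f m N≤m) ,
      ≤-<-trans (≤-by (Δ (-d≤c m)) (solve 2 (λ c d → c :- con (+ 0) :- (con (+ 0) :- d) := c :- :- d) ≈-refl (c m)
          (d m))) (f m N≤m)

  x*½<x : ∀ {x} → 0# < x → x * ½ < x
  x*½<x {x} 0<x = <-by (0<x ⊗< 0<½) (≈-trans (+-congʳ (≈-sym (½+½ x)))
    (solve 1 (λ h → h :+ h :- h := h) ≈-refl (x * ½)))

  -- Twice b * q - c * d equals (b - c) * (q + d) + (b + c) * (q - d), a sum of products of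
  -- nonnegative factors. No case distinction on signs is needed.
  *-abs-≤ : ∀ {c d b q} → c ≤ b → - c ≤ b → d ≤ q → - d ≤ q → c * d ≤ b * q
  *-abs-≤ {c} {d} {b} {q} c≤b -c≤b d≤q -d≤q =
    ≤-by ((Δ c≤b ⊗ Δ -d≤q ⊕ Δ -c≤b ⊗ Δ d≤q) ⊗ <⇒≤ 0<½)
      (≈-trans (≈-sym (½+½ _)) (solve 5 (λ b c d q h → (b :* q :- c :* d) :* h :+ (b :* q :- c :* d) :* h
        := ((b :- c) :* (q :- :- d) :+ (b :- :- c) :* (q :- d)) :* h) ≈-refl b c d q ½))

  bounded*null : ∀ {b} {c d : ℕ → ℝ} → 0# < b → (∀ m → c m ≤ b) → (∀ m → - c m ≤ b) → d ⟶ 0# → (λ m → c m * d m) ⟶ 0#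
  bounded*null {b} {c} {d} 0<b c≤b -c≤b d⟶0 = ⟶-intro λ η 0<η →
    -- The product is only bounded weakly by b * q; aiming at η/2 recovers the strict inequality.
    let 0<q     = 0</ (0<η ⊗< 0<½) 0<b
        N₁ , f  = ⟶-upper d⟶0 _ 0<q
        N₂ , g  = ⟶-lower d⟶0 _ 0<q
        qb≈η/2  = ≈-trans (*-comm b (η * ½ / b)) (/-* (η * ½) 0<b)
    in N₁ ℕ.⊔ N₂ , λ m N≤m →
      let d≤q   = ≤-respˡ (d-0 (d m)) (<⇒≤ (f m (ℕP.m⊔n≤o⇒m≤o N₁ N₂ N≤m)))
          -d≤q  = ≤-respˡ (0-d (d m)) (<⇒≤ (g m (ℕP.m⊔n≤o⇒n≤o N₁ N₂ N≤m)))
          d≤q″ = ≤-respˡ (≈-sym (-‿involutive (d m))) d≤q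
      in ≤-<-trans (≤-respˡ (≈-sym (d-0 _)) (≤-respʳ qb≈η/2 (*-abs-≤ (c≤b m) (-c≤b m) d≤q -d≤q))) (x*½<x 0<η) ,
         ≤-<-trans (≤-respˡ (solve 2 (λ c d → c :* :- d := con (+ 0) :- c :* d) ≈-refl (c m) (d m))
           (≤-respʳ qb≈η/2 (*-abs-≤ (c≤b m) (-c≤b m) -d≤q d≤q″))) (x*½<x 0<η)
    where
    d-0 : ∀ d → d - 0# ≈ d
    d-0 = solve 1 (λ d → d :- con (+ 0) := d) ≈-refl

    0-d : ∀ d → 0# - d ≈ - d
    0-d = solve 1 (λ d → con (+ 0) :- d := :- d) ≈-refl

  ⟶-*ˡ : ∀ c {a l} → a ⟶ l → (λ m → c * a m) ⟶ (c * l)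
  ⟶-*ˡ c {a} {l} a⟶l = ⟶-cong
    (λ m → solve 3 (λ c a l → c :* (a :- l) :+ c :* l := c :* a) ≈-refl c (a m) l) (+-identityˡ _)
    -- The bound 1 + |c| is positive even when `c` vanishes.
    (⟶-+ (bounded*null {c = λ _ → c} {λ m → a m - l} (0<1 ⊕< 0≤abs c) (λ _ → c≤) (λ _ → -c≤)
      (⟶-cong (λ m → ≈-refl) (-‿inverseʳ l) (⟶-+ a⟶l (⟶-const (- l))))) (⟶-const (c * l)))
    where
    c≤  = ≤-trans (x≤abs c) (≤-by 0≤1 (solve 1 (λ a → con (+ 1) :+ a :- a := con (+ 1)) ≈-refl (abs c)))
    -c≤ = ≤-trans (-x≤abs c) (≤-by 0≤1 (solve 1 (λ a → con (+ 1) :+ a :- a := con (+ 1)) ≈-refl (abs c)))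

  ⟶-* : ∀ {a b : ℕ → ℝ} {l k B} → 0# < B → (∀ m → a m ≤ B) → (∀ m → - a m ≤ B) → a ⟶ l → b ⟶ k →
      (λ m → a m * b m) ⟶ (l * k)
  ⟶-* {a} {b} {l} {k} 0<B a≤B -a≤B a⟶l b⟶k = ⟶-cong
    (λ m → solve 3 (λ a b k → a :* (b :- k) :+ k :* a := a :* b) ≈-refl (a m) (b m) k)
    (≈-trans (+-identityˡ _) (*-comm k l))
    (⟶-+ (bounded*null {c = a} {λ m → b m - k} 0<B a≤B -a≤B
        (⟶-cong (λ m → ≈-refl) (-‿inverseʳ k) (⟶-+ b⟶k (⟶-const (- k))))) (⟶-*ˡ k a⟶l))

  monotone-chain : ∀ {a : ℕ → ℝ} → (∀ m → a m ≤ a (suc m)) → ∀ {m n} → m ℕ.≤ n → a m ≤ a n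
  monotone-chain {a} mono m≤n = go (ℕP.≤⇒≤′ m≤n)
    where
    go : ∀ {m n} → m ℕ.≤′ n → a m ≤ a n
    go (ℕ.≤′-reflexive ≡.refl) = ≤-refl
    go (ℕ.≤′-step m≤′n)        = ≤-trans (go m≤′n) (mono _)

  monotone-convergence : ∀ {a : ℕ → ℝ} {b} → (∀ m → a m ≤ a (suc m)) → (∀ m → a m ≤ b) → ∃[ l ] a ⟶ l
  monotone-convergence {a} {b} mono a≤b = sup V , ⟶-intro close
    where
    V : ℝ → Set
    V x = ∃[ m ] x ≈ a m

    ub : ∀ {x} → V x → x ≤ b
    ub (m , x≈am) = ≤-respˡ (≈-sym x≈am) (a≤b m)

    a≤s : ∀ m → a m ≤ sup V
    a≤s m = sup-upper V ub (m , ≈-refl)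

    close : ∀ η → 0# < η → ∃[ N ] (∀ m → N ℕ.≤ m → a m - sup V < η × sup V - a m < η)
    close η 0<η with em {∃[ N ] sup V - η < a N}
    ... | yes (N , near) = N , λ m N≤m →
          <-by (0<η ⊕< Δ (a≤s m)) (solve 3 (λ a s e → e :- (a :- s) := e :+ (s :- a)) ≈-refl (a m) (sup V) η) ,
          <-by (Δ< near ⊕< Δ (monotone-chain {a} mono N≤m))
            (solve 4 (λ a s e n → e :- (s :- a) := (n :- (s :- e)) :+ (a :- n)) ≈-refl (a m) (sup V) η (a N))
    ... | no ¬near = contradiction (sup-least V (a 0 , 0 , ≈-refl) below) (<⇒≱ (<-by 0<η
            (solve 2 (λ s e → s :- (s :- e) := e) ≈-refl (sup V) η)))
      where
      below : ∀ {x} → V x → x ≤ sup V - η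
      below (m , x≈am) with em {a m ≤ sup V - η}
      ... | yes am≤ = ≤-respˡ (≈-sym x≈am) am≤
      ... | no  am≰ = contradiction (m , ≰⇒> am≰) ¬near

  -- Series

  partialSums-cong : ∀ {f g} → (∀ k → f k ≈ g k) → ∀ n → partialSums f n ≈ partialSums g n
  partialSums-cong f≈g zero    = ≈-refl
  partialSums-cong f≈g (suc n) = +-cong (f≈g 0) (partialSums-cong (λ k → f≈g (suc k)) n)

  partialSums-last : ∀ f n → partialSums f (suc n) ≈ partialSums f n + f n
  partialSums-last f zero    = +-comm _ _
  partialSums-last f (suc n) = ≈-trans (+-congˡ (partialSums-last (λ k → f (suc k)) n)) (≈-sym (+-assoc _ _ _))

  partialSums-mono-≤ : ∀ {f g} → (∀ k → f k ≤ g k) → ∀ n → partialSums f n ≤ partialSums g n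
  partialSums-mono-≤ f≤g zero    = ≤-refl
  partialSums-mono-≤ {f} {g} f≤g (suc n) = ≤-by (Δ (f≤g 0) ⊕ Δ (partialSums-mono-≤ (λ k → f≤g (suc k)) n))
    (solve 4 (λ a b c d → b :+ d :- (a :+ c) := (b :- a) :+ (d :- c)) ≈-refl
      (f 0) (g 0) (partialSums (λ k → f (suc k)) n) (partialSums (λ k → g (suc k)) n))

  partialSums-*ˡ : ∀ c f n → partialSums (λ k → c * f k) n ≈ c * partialSums f n
  partialSums-*ˡ c f zero    = ≈-sym (zeroʳ c)
  partialSums-*ˡ c f (suc n) = ≈-trans (+-congˡ (partialSums-*ˡ c (λ k → f (suc k)) n)) (≈-sym (distribˡ c _ _))

  0≤partialSums : ∀ {f} → (∀ k → 0# ≤ f k) → ∀ n → 0# ≤ partialSums f n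
  0≤partialSums 0≤f zero    = ≤-refl
  0≤partialSums 0≤f (suc n) = 0≤f 0 ⊕ 0≤partialSums (λ k → 0≤f (suc k)) n

  partialSums-increasing : ∀ {f} → (∀ k → 0# ≤ f k) → ∀ n → partialSums f n ≤ partialSums f (suc n)
  partialSums-increasing {f} 0≤f n = ≤-by (0≤f n) (≈-trans (+-congʳ (partialSums-last f n))
    (solve 2 (λ s a → s :+ a :- s := a) ≈-refl (partialSums f n) (f n)))

  infix 4 _⋖_
  -- This is |u| ≤ v. As a pair of linear inequalities it passes directly through sums and products,
  -- and so from the terms of a series to its partial sums and their differences.
  _⋖_ : ℝ → ℝ → Set
  u ⋖ v = u ≤ v × - u ≤ v

  ⋖-+ : ∀ {u v u′ v′} → u ⋖ v → u′ ⋖ v′ → u + u′ ⋖ v + v′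
  ⋖-+ {u} {v} {u′} {v′} (p , q) (p′ , q′) =
    ≤-by (Δ p ⊕ Δ p′) (solve 4 (λ u v x y → v :+ y :- (u :+ x) := (v :- u) :+ (y :- x)) ≈-refl u v u′ v′) ,
    ≤-by (Δ q ⊕ Δ q′) (solve 4 (λ u v x y → v :+ y :- :- (u :+ x) := (v :- :- u) :+ (y :- :- x)) ≈-refl u v u′ v′)

  ⋖-* : ∀ {u v u′ v′} → u ⋖ v → u′ ⋖ v′ → u * u′ ⋖ v * v′
  ⋖-* {u} {v} {u′} {v′} (p , q) (p′ , q′) = *-abs-≤ p q p′ q′ ,
    ≤-respˡ (solve 2 (λ u x → u :* :- x := :- (u :* x)) ≈-refl u u′)
      (*-abs-≤ p q q′ (≤-respˡ (≈-sym (-‿involutive u′)) p′))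

  ⋖-resp : ∀ {u v u′ v′} → u ≈ u′ → v ≈ v′ → u ⋖ v → u′ ⋖ v′
  ⋖-resp u≈ v≈ (p , q) = ≤-respˡ u≈ (≤-respʳ v≈ p) , ≤-respˡ (-‿cong u≈) (≤-respʳ v≈ q)

  ⋖-partialSums : ∀ {f F} → (∀ k → f k ⋖ F k) → ∀ n → partialSums f n ⋖ partialSums F n
  ⋖-partialSums f⋖F zero    = ≤-refl , ≤-reflexive -0#≈0#
  ⋖-partialSums f⋖F (suc n) = ⋖-+ (f⋖F 0) (⋖-partialSums (λ k → f⋖F (suc k)) n)

  ⋖-tail : ∀ {f F} → (∀ k → f k ⋖ F k) → ∀ {m n} → m ℕ.≤ n →
    partialSums f n - partialSums f m ⋖ partialSums F n - partialSums F m
  ⋖-tail {f} {F} f⋖F {n = n} ℕ.z≤n = ⋖-resp (x-0 _) (x-0 _) (⋖-partialSums f⋖F n)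
    where
    x-0 : ∀ x → x ≈ x - 0#
    x-0 = solve 1 (λ x → x := x :- con (+ 0)) ≈-refl
  ⋖-tail {f} {F} f⋖F {suc m} {suc n} (ℕ.s≤s m≤n) = ⋖-resp (cancel _ _ _) (cancel _ _ _) (⋖-tail (λ k → f⋖F (suc k)) m≤n)
    where
    cancel : ∀ a s t → s - t ≈ (a + s) - (a + t)
    cancel = solve 3 (λ a s t → s :- t := (a :+ s) :- (a :+ t)) ≈-refl

  -- Cauchy products

  -- The coefficients of a product of power series. The recursion removes the first coefficient of
  -- `f` and leaves `g` alone, which fixes the shape of the inductions below.
  convolution : (ℕ → ℝ) → (ℕ → ℝ) → ℕ → ℝ
  convolution f g zero    = f 0 * g 0
  convolution f g (suc k) = f 0 * g (suc k) + convolution (λ i → f (suc i)) g k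

  convolution-cong : ∀ {f f′ g g′} → (∀ k → f k ≈ f′ k) → (∀ k → g k ≈ g′ k) → ∀ k →
      convolution f g k ≈ convolution f′ g′ k
  convolution-cong f≈ g≈ zero    = *-cong (f≈ 0) (g≈ 0)
  convolution-cong f≈ g≈ (suc k) = +-cong (*-cong (f≈ 0) (g≈ (suc k))) (convolution-cong (λ i → f≈ (suc i)) g≈ k)

  convolution-+ : ∀ f f′ g k → convolution (λ i → f i + f′ i) g k ≈ convolution f g k + convolution f′ g k
  convolution-+ f f′ g zero    = distribʳ (g 0) (f 0) (f′ 0)
  convolution-+ f f′ g (suc k) = ≈-trans (+-congˡ (convolution-+ (λ i → f (suc i)) (λ i → f′ (suc i)) g k))
    (solve 5 (λ a b c u v → (a :+ b) :* c :+ (u :+ v) := a :* c :+ u :+ (b :* c :+ v)) ≈-refl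
      (f 0) (f′ 0) (g (suc k)) (convolution (λ i → f (suc i)) g k) (convolution (λ i → f′ (suc i)) g k))

  convolution-*ˡ : ∀ c f g k → convolution (λ i → c * f i) g k ≈ c * convolution f g k
  convolution-*ˡ c f g zero    = *-assoc c (f 0) (g 0)
  convolution-*ˡ c f g (suc k) = ≈-trans (+-cong (*-assoc _ _ _) (convolution-*ˡ c (λ i → f (suc i)) g k))
      (≈-sym (distribˡ c _ _))

  convolution-*ʳ : ∀ c f g k → convolution f (λ i → c * g i) k ≈ c * convolution f g k
  convolution-*ʳ c f g zero    = solve 3 (λ c a b → a :* (c :* b) := c :* (a :* b)) ≈-refl c (f 0) (g 0)
  convolution-*ʳ c f g (suc k) = ≈-trans (+-congˡ (convolution-*ʳ c (λ i → f (suc i)) g k))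
    (solve 4 (λ c a b s → a :* (c :* b) :+ c :* s := c :* (a :* b :+ s)) ≈-refl c (f 0) (g (suc k)) _)

  -- The coefficients of the formal derivative of the power series with coefficients `f`.
  derivative : (ℕ → ℝ) → ℕ → ℝ
  derivative f k = fromℕ (suc k) * f (suc k)

  -- The product rule for formal power series. It replaces the binomial theorem in `expTerm-+`.
  leibniz : ∀ f g k →
    derivative (convolution f g) k ≈ convolution (derivative f) g k + convolution f (derivative g) k
  leibniz f g zero    = solve 4 (λ a b c d → (con (+ 1) :+ con (+ 0)) :* (a :* b :+ c :* d)
    := (con (+ 1) :+ con (+ 0)) :* c :* d :+ a :* ((con (+ 1) :+ con (+ 0)) :* b)) ≈-refl (f 0) (g 1) (f 1) (g 0)
  leibniz f g (suc k) = begin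
    fromℕ (suc (suc k)) * (f 0 * g (suc (suc k)) + (f 1 * g (suc k) + c″))
      ≈⟨ solve 6 (λ n a b c d s → (con (+ 1) :+ n) :* (a :* b :+ (c :* d :+ s))
           := (con (+ 1) :+ con (+ 0)) :* c :* d :+ s :+ (a :* ((con (+ 1) :+ n) :* b) :+ n :* (c :* d :+ s)))
           ≈-refl (fromℕ (suc k)) (f 0) (g (suc (suc k))) (f 1) (g (suc k)) c″ ⟩
    fromℕ 1 * f 1 * g (suc k) + c″ + (f 0 * derivative g (suc k) + derivative (convolution f′ g) k)
      ≈⟨ +-congˡ (+-congˡ (leibniz f′ g k)) ⟩
    fromℕ 1 * f 1 * g (suc k) + c″ + (f 0 * derivative g (suc k)
        + (convolution (derivative f′) g k + convolution f′ (derivative g) k))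
      ≈⟨ solve 5 (λ a b c d e → a :+ b :+ (c :+ (d :+ e)) := a :+ (b :+ d) :+ (c :+ e)) ≈-refl _ _ _ _ _ ⟩
    fromℕ 1 * f 1 * g (suc k) + (c″ + convolution (derivative f′) g k) + convolution f (derivative g) (suc k)
      ≈⟨ +-congʳ (+-congˡ (convolution-+ f″ (derivative f′) g k)) ⟨
    fromℕ 1 * f 1 * g (suc k) + convolution (λ i → f″ i + derivative f′ i) g k + convolution f (derivative g) (suc k)
      -- Differentiation and the shift do not commute: after the shift each weight is one too small,
      -- and the extra summand `f″` compensates.
      ≈⟨ +-congʳ (+-congˡ (convolution-cong (λ i → solve 2 (λ n a → a :+ n :* a := (con (+ 1) :+ n) :* a)
          ≈-refl (fromℕ (suc i)) (f″ i))
           (λ _ → ≈-refl) k)) ⟩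
    convolution (derivative f) g (suc k) + convolution f (derivative g) (suc k) ∎
    where
    open SetoidReasoning setoid
    f′ f″ : ℕ → ℝ
    f′ i = f (suc i)
    f″ i = f (suc (suc i))
    c″ : ℝ
    c″ = convolution f″ g k

  -- The sum of all products f i * g j with i + j below the given bound.
  triangle : (ℕ → ℝ) → (ℕ → ℝ) → ℕ → ℝ
  triangle f g = partialSums (convolution f g)

  triangle-suc : ∀ f g n → triangle f g (suc n) ≈ f 0 * partialSums g (suc n) + triangle (λ i → f (suc i)) g n
  triangle-suc f g n = ≈-trans (+-congˡ (go n g (convolution (λ i → f (suc i)) g)))
    (solve 4 (λ a b s t → a :* b :+ (a :* s :+ t) := a :* (b :+ s) :+ t) ≈-refl (f 0) (g 0)
        (partialSums (λ k → g (suc k)) n) _)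
    where
    go : ∀ n g h → partialSums (λ k → f 0 * g (suc k) + h k) n ≈ f 0 * partialSums (λ k → g (suc k)) n + partialSums h n
    go zero    g h = solve 1 (λ a → con (+ 0) := a :* con (+ 0) :+ con (+ 0)) ≈-refl (f 0)
    go (suc n) g h = ≈-trans (+-congˡ (go n (λ k → g (suc k)) (λ k → h (suc k))))
      (solve 5 (λ a b c s t → a :* b :+ c :+ (a :* s :+ t) := a :* (b :+ s) :+ (c :+ t)) ≈-refl (f 0) (g 1) (h 0) _ _)

  -- The difference consists of the products f i * g j with i < m, j < n and i + j ≥ m, each
  -- dominated by its counterpart. The square is generalised to a rectangle because removing `f 0`
  -- shortens only one side.
  square-triangle-⋖ : ∀ {f F g G} → (∀ k → f k ⋖ F k) → (∀ k → g k ⋖ G k) → ∀ {m n} → m ℕ.≤ n →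
    partialSums f m * partialSums g n - triangle f g m ⋖ partialSums F m * partialSums G n - triangle F G m
  square-triangle-⋖ {f} {F} {g} {G} f⋖F g⋖G {zero} {n} m≤n = ⋖-resp (0≈ _) (0≈ _) (≤-refl , ≤-reflexive -0#≈0#)
    where
    0≈ : ∀ x → 0# ≈ 0# * x - 0#
    0≈ = solve 1 (λ x → con (+ 0) := con (+ 0) :* x :- con (+ 0)) ≈-refl
  square-triangle-⋖ {f} {F} {g} {G} f⋖F g⋖G {suc m} {n} m<n = ⋖-resp (peel f g) (peel F G)
    (⋖-+ (⋖-* (f⋖F 0) (⋖-tail g⋖G m<n)) (square-triangle-⋖ (λ k → f⋖F (suc k)) g⋖G (ℕP.<⇒≤ m<n)))
    where
    peel : ∀ f g →
      f 0 * (partialSums g n - partialSums g (suc m)) + (partialSums (λ k → f (suc k))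
          m * partialSums g n - triangle (λ k → f (suc k)) g m)
      ≈ partialSums f (suc m) * partialSums g n - triangle f g (suc m)
    peel f g = ≈-trans
      (solve 5 (λ a s t u v → a :* (s :- t) :+ (u :* s :- v) := (a :+ u) :* s :- (a :* t :+ v)) ≈-refl
        (f 0) (partialSums g n) (partialSums g (suc m)) _ _)
      (+-congˡ (-‿cong (≈-sym (triangle-suc f g m))))

  0≤convolution : ∀ {f g} → (∀ k → 0# ≤ f k) → (∀ k → 0# ≤ g k) → ∀ k → 0# ≤ convolution f g k
  0≤convolution 0≤f 0≤g zero    = 0≤f 0 ⊗ 0≤g 0
  0≤convolution 0≤f 0≤g (suc k) = 0≤f 0 ⊗ 0≤g (suc k) ⊕ 0≤convolution (λ i → 0≤f (suc i)) 0≤g k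

  -- From i < m and j < n follows i + j < m + n, and the further products in the triangle are
  -- nonnegative.
  rectangle≤triangle : ∀ {f g} → (∀ k → 0# ≤ f k) → (∀ k → 0# ≤ g k) → ∀ m n →
    partialSums f m * partialSums g n ≤ triangle f g (m ℕ.+ n)
  rectangle≤triangle 0≤f 0≤g zero    n = ≤-respˡ (≈-sym (zeroˡ _)) (0≤partialSums (0≤convolution 0≤f 0≤g) n)
  rectangle≤triangle {f} {g} 0≤f 0≤g (suc m) n = ≤-by
    (0≤f 0 ⊗ Δ (monotone-chain (partialSums-increasing 0≤g) (ℕP.m≤n+m n (suc m)))
        ⊕ Δ (rectangle≤triangle (λ k → 0≤f (suc k)) 0≤g m n))
    (≈-trans (+-congʳ (triangle-suc f g (m ℕ.+ n)))
      (solve 5 (λ a s t u v → (a :* t :+ v) :- (a :+ u) :* s := a :* (t :- s) :+ (v :- u :* s)) ≈-refl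
        (f 0) (partialSums g n) (partialSums g (suc m ℕ.+ n)) _ _))

  -- The exponential function

  *-cancelʳ-≈ : ∀ {x y z} → 0# < z → x * z ≈ y * z → x ≈ y
  *-cancelʳ-≈ 0<z eq = ≤-antisym (*-cancelʳ-≤ 0<z (≤-reflexive eq)) (*-cancelʳ-≤ 0<z (≤-reflexive (≈-sym eq)))

  expTerm : ℝ → ℕ → ℝ
  expTerm x k = (x ^ k) / fromℕ (k ℕ.!)

  0<fromℕ-! : ∀ k → 0# < fromℕ (k ℕ.!)
  0<fromℕ-! k = 0<fromℕ (ℕP.1≤n! k)

  expTerm-0 : ∀ x → expTerm x 0 ≈ 1#
  expTerm-0 x = *-cancelʳ-≈ (0<fromℕ-suc 0) (≈-trans (/-* 1# (0<fromℕ-suc 0))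
    (solve 0 (con (+ 1) := con (+ 1) :* (con (+ 1) :+ con (+ 0))) ≈-refl))

  expTerm-derivative : ∀ x k → derivative (expTerm x) k ≈ x * expTerm x k
  expTerm-derivative x k = *-cancelʳ-≈ (0<fromℕ-! k) (begin
    n * (x * x ^ k * g ⁻¹) * f    ≈⟨ solve 4 (λ n p g f → n :* (p :* g) :* f := p :* g :* (n :* f)) ≈-refl n _ _ f ⟩
    x * x ^ k * g ⁻¹ * (n * f)    ≈⟨ *-congˡ (fromℕ-* (suc k) (k ℕ.!)) ⟨
    x * x ^ k * g ⁻¹ * g          ≈⟨ /-* (x * x ^ k) (0<fromℕ-! (suc k)) ⟩
    x * x ^ k                     ≈⟨ *-congˡ (/-* (x ^ k) (0<fromℕ-! k)) ⟨
    x * (x ^ k * f ⁻¹ * f)        ≈⟨ *-assoc x _ f ⟨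
    x * expTerm x k * f           ∎)
    where
    open SetoidReasoning setoid
    n f g : ℝ
    n = fromℕ (suc k)
    f = fromℕ (k ℕ.!)
    g = fromℕ (suc k ℕ.!)

  -- Both sides are 1 at index 0 and satisfy the recursion (k + 1) * a (k + 1) = (x + y) * a k, the
  -- left one by the product rule. This is the differential equation of the exponential function,
  -- read off coefficients.
  expTerm-+ : ∀ x y k → convolution (expTerm x) (expTerm y) k ≈ expTerm (x + y) k
  expTerm-+ x y zero    = ≈-trans (*-cong (expTerm-0 x) (expTerm-0 y))
      (≈-trans (*-identityˡ 1#) (≈-sym (expTerm-0 (x + y))))
  expTerm-+ x y (suc k) = *-cancelʳ-≈ (0<fromℕ-suc k) (≈-trans (*-comm _ _) (begin
    derivative (convolution (expTerm x) (expTerm y)) k  ≈⟨ leibniz (expTerm x) (expTerm y) k ⟩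
    convolution (derivative (expTerm x)) (expTerm y) k + convolution (expTerm x) (derivative (expTerm y)) k
      ≈⟨ +-cong (convolution-cong (expTerm-derivative x) (λ _ → ≈-refl) k)
          (convolution-cong (λ _ → ≈-refl) (expTerm-derivative y) k) ⟩
    convolution (λ i → x * expTerm x i) (expTerm y) k + convolution (expTerm x) (λ i → y * expTerm y i) k
      ≈⟨ +-cong (convolution-*ˡ x (expTerm x) (expTerm y) k) (convolution-*ʳ y (expTerm x) (expTerm y) k) ⟩
    x * convolution (expTerm x) (expTerm y) k + y * convolution (expTerm x) (expTerm y) k  ≈⟨ distribʳ _ x y ⟨
    (x + y) * convolution (expTerm x) (expTerm y) k     ≈⟨ *-congˡ (expTerm-+ x y k) ⟩
    (x + y) * expTerm (x + y) k                         ≈⟨ expTerm-derivative (x + y) k ⟨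
    derivative (expTerm (x + y)) k                      ≈⟨ *-comm _ _ ⟩
    expTerm (x + y) (suc k) * fromℕ (suc k)             ∎))
    where open SetoidReasoning setoid

  ^-⋖ : ∀ {x y} → x ⋖ y → ∀ k → x ^ k ⋖ y ^ k
  ^-⋖ {x} {y} x⋖y zero    = ≤-refl , ≤-by (0≤1 ⊕ 0≤1) (solve 0
      (con (+ 1) :- :- con (+ 1) := con (+ 1) :+ con (+ 1)) ≈-refl)
  ^-⋖ {x} {y} x⋖y (suc k) = ⋖-* x⋖y (^-⋖ x⋖y k)

  0≤⇒⋖ : ∀ {x} → 0# ≤ x → x ⋖ x
  0≤⇒⋖ {x} 0≤x = ≤-refl , ≤-by (0≤x ⊕ 0≤x) (solve 1 (λ x → x :- :- x := x :+ x) ≈-refl x)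

  ⋖⇒0≤ : ∀ {x y} → x ⋖ y → 0# ≤ y
  ⋖⇒0≤ {x} {y} (x≤y , -x≤y) = ≤-respʳ (½+½ y) (≤-by ((Δ x≤y ⊕ Δ -x≤y) ⊗ <⇒≤ 0<½)
    (solve 3 (λ x y h → y :* h :+ y :* h :- con (+ 0) := ((y :- x) :+ (y :- :- x)) :* h) ≈-refl x y ½))

  expTerm-⋖ : ∀ {x y} → x ⋖ y → ∀ k → expTerm x k ⋖ expTerm y k
  expTerm-⋖ x⋖y k = ⋖-* (^-⋖ x⋖y k) (0≤⇒⋖ (<⇒≤ (0<⁻¹ (0<fromℕ-! k))))

  0≤expTerm : ∀ {x} → 0# ≤ x → ∀ k → 0# ≤ expTerm x k
  0≤expTerm 0≤x k = ⋖⇒0≤ (expTerm-⋖ (0≤⇒⋖ 0≤x) k)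

  expSum : ℝ → ℕ → ℝ
  expSum x = partialSums (expTerm x)

  triangle-expSum : ∀ x y n → triangle (expTerm x) (expTerm y) n ≈ expSum (x + y) n
  triangle-expSum x y = partialSums-cong (expTerm-+ x y)

  expSum-+-≤ : ∀ {x y} → 0# ≤ x → 0# ≤ y → ∀ n → expSum (x + y) n ≤ expSum x n * expSum y n
  expSum-+-≤ {x} {y} 0≤x 0≤y n = ≤-by
    (⋖⇒0≤ (square-triangle-⋖ (λ k → 0≤⇒⋖ (0≤expTerm 0≤x k)) (λ k → 0≤⇒⋖ (0≤expTerm 0≤y k)) (ℕP.≤-refl {n})))
    (+-congˡ (-‿cong (≈-sym (triangle-expSum x y n))))

  expSum-mono-≤ : ∀ {x y} → 0# ≤ x → x ≤ y → ∀ n → expSum x n ≤ expSum y n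
  expSum-mono-≤ {x} {y} 0≤x x≤y = partialSums-mono-≤ λ k →
      proj₁ (expTerm-⋖ {x} {y} (x≤y , ≤-trans (proj₂ (0≤⇒⋖ 0≤x)) x≤y) k)

  -- Each term after the first is at most `x` times its predecessor, so a partial sum s satisfies s
  -- ≤ 1 + x * s.
  expSum-geometric : ∀ {x} → 0# ≤ x → x < 1# → ∀ n → expSum x n ≤ 1# / (1# - x)
  expSum-geometric {x} 0≤x x<1 n = ≤-/ (Δ< x<1) (≤-by (Δ (begin
    expSum x n                                        ≤⟨ partialSums-increasing (0≤expTerm 0≤x) n ⟩
    expTerm x 0 + partialSums (λ k → expTerm x (suc k)) n
      ≤⟨ ≤-by (Δ (partialSums-mono-≤ step n)) (solve 3 (λ a s t → (a :+ t) :- (a :+ s) := t :- s) ≈-refl _ _ _) ⟩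
    expTerm x 0 + partialSums (λ k → x * expTerm x k) n  ≈⟨ +-cong (expTerm-0 x) (partialSums-*ˡ x (expTerm x) n) ⟩
    1# + x * expSum x n                               ∎))
    (solve 2 (λ x s → con (+ 1) :- s :* (con (+ 1) :- x) := (con (+ 1) :+ x :* s) :- s) ≈-refl x (expSum x n)))
    where
    open ≤-Reasoning
    step : ∀ k → expTerm x (suc k) ≤ x * expTerm x k
    step k = ≤-respʳ (expTerm-derivative x k) (≤-by (0≤fromℕ k ⊗ 0≤expTerm 0≤x (suc k))
      (solve 2 (λ n e → (con (+ 1) :+ n) :* e :- e := n :* e) ≈-refl (fromℕ k) (expTerm x (suc k))))

  ½<1 : ½ < 1#
  ½<1 = <-by 0<½ (≈-trans (+-congʳ (≈-sym (½+½ 1#))) (solve 1 (λ h → (con (+ 1) :* h :+ con (+ 1) :* h) :- h := h)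
      ≈-refl ½))

  -- The geometric bound works only below 1. A larger argument is replaced by a multiple of one
  -- half, and `expSum-+-≤` multiplies the bounds for the halves.
  expSum-bounded : ∀ {x} → 0# ≤ x → ∃[ b ] 0# < b × (∀ n → expSum x n ≤ b)
  expSum-bounded {x} 0≤x =
    let m , x/½<m = archimedean (x / ½)
        b , 0<b , ub = multiples m
    in b , 0<b , λ n → ≤-trans (expSum-mono-≤ 0≤x (≤-trans (≤-reflexive (≈-sym (/-* x 0<½)))
         (≤-by (Δ (<⇒≤ x/½<m) ⊗ <⇒≤ 0<½) (solve 3 (λ m q h → m :* h :- q :* h := (m :- q) :* h) ≈-refl (fromℕ m)
             (x / ½) ½))) n) (ub n)
    where
    base : ℝ
    base = 1# / (1# - ½)

    multiples : ∀ m → ∃[ b ] 0# < b × (∀ n → expSum (fromℕ m * ½) n ≤ b)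
    multiples zero    = 1# / (1# - 0#) , 0</ 0<1 (Δ< 0<1) , λ n →
      ≤-trans (expSum-mono-≤ (≤-reflexive (≈-sym (zeroˡ ½))) (≤-reflexive (zeroˡ ½)) n) (expSum-geometric ≤-refl 0<1 n)
    multiples (suc m) = let b , 0<b , ub = multiples m in
      base * b , 0</ 0<1 (Δ< ½<1) ⊗< 0<b , λ n →
      ≤-trans (expSum-mono-≤ (0≤fromℕ (suc m) ⊗ <⇒≤ 0<½) (≤-reflexive
          (≈-trans (distribʳ ½ 1# (fromℕ m)) (+-congʳ (*-identityˡ ½)))) n)
        (≤-trans (expSum-+-≤ (<⇒≤ 0<½) (0≤fromℕ m ⊗ <⇒≤ 0<½) n)
          (*-mono-≤ (0≤partialSums (0≤expTerm (<⇒≤ 0<½)) n) (expSum-geometric (<⇒≤ 0<½) ½<1 n)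
            (0≤partialSums (0≤expTerm (0≤fromℕ m ⊗ <⇒≤ 0<½)) n) (ub n)))

  ⋖abs : ∀ x → x ⋖ abs x
  ⋖abs x = x≤abs x , -x≤abs x

  -- For arguments of either sign the partial sums need not be monotone, but after adding those for
  -- |x| every term is nonnegative. Two monotone limits are then subtracted.
  expSum-converges : ∀ x → ∃[ l ] expSum x ⟶ l
  expSum-converges x =
    let b , _ , ub  = expSum-bounded (0≤abs x)
        l₁ , lim₁   = monotone-convergence (partialSums-increasing (0≤expTerm (0≤abs x))) ub
        l₂ , lim₂   = monotone-convergence {λ n → expSum (abs x) n + expSum x n} increasing
          (λ n → ≤-trans (≤-by (Δ (proj₁ (sum⋖ n))) (solve 2 (λ s t → t :+ t :- (t :+ s) := t :- s)
              ≈-refl (expSum x n) (expSum (abs x) n)))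
                   (≤-by (Δ (ub n) ⊕ Δ (ub n)) (solve 2 (λ b t → b :+ b :- (t :+ t) := (b :- t) :+ (b :- t))
                       ≈-refl b (expSum (abs x) n))))
    in l₂ + - 1# * l₁ , ⟶-cong (λ n → solve 2 (λ s t → (t :+ s) :+ :- con (+ 1) :* t := s) ≈-refl (expSum x n)
          (expSum (abs x) n)) ≈-refl
         (⟶-+ lim₂ (⟶-*ˡ (- 1#) lim₁))
    where
    sum⋖ : ∀ n → expSum x n ⋖ expSum (abs x) n
    sum⋖ = ⋖-partialSums (expTerm-⋖ (⋖abs x))

    increasing : ∀ n → expSum (abs x) n + expSum x n ≤ expSum (abs x) (suc n) + expSum x (suc n)
    increasing n = ≤-by (Δ (proj₂ (expTerm-⋖ (⋖abs x) n))) (≈-trans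
      (+-congʳ (+-cong (partialSums-last (expTerm (abs x)) n) (partialSums-last (expTerm x) n)))
      (solve 4 (λ s t a b → (t :+ b) :+ (s :+ a) :- (t :+ s) := b :- :- a) ≈-refl (expSum x n) (expSum (abs x) n)
          (expTerm x n) (expTerm (abs x) n)))

  expSum⟶exp : ∀ x → expSum x ⟶ exp x
  expSum⟶exp x = let l , lim = expSum-converges x in
    ⟶-cong (λ _ → ≈-refl) (≈-sym (the-≈ lim (λ lim′ → ⟶-unique lim′ lim))) lim

  -- The difference of square and triangle is dominated by the one for |x| and
  -- |y|, where a triangle of twice the size contains the square.
  exp-+ : ∀ x y → exp (x + y) ≈ exp x * exp y
  exp-+ x y =
    let b , 0<b , ub = expSum-bounded (0≤abs x)
    in ⟶-unique (expSum⟶exp (x + y)) (⟶-cong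
         (λ n → solve 2 (λ p q → p :+ :- con (+ 1) :* (p :- q) := q) ≈-refl _ _)
         (solve 1 (λ l → l :+ :- con (+ 1) :* con (+ 0) := l) ≈-refl _)
         (⟶-+ (⟶-* 0<b (λ n → ≤-trans (proj₁ (sum⋖ x n)) (ub n)) (λ n → ≤-trans (proj₂ (sum⋖ x n)) (ub n))
             (expSum⟶exp x) (expSum⟶exp y))
           (⟶-*ˡ (- 1#) difference-null)))
    where
    X Y : ℝ
    X = abs x
    Y = abs y

    sum⋖ : ∀ x n → expSum x n ⋖ expSum (abs x) n
    sum⋖ x = ⋖-partialSums (expTerm-⋖ (⋖abs x))

    doubled : (λ n → expSum (X + Y) (n ℕ.+ n)) ⟶ exp (X + Y)
    doubled η 0<η = let N , close = expSum⟶exp (X + Y) η 0<η in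
      N , λ m N≤m → close (m ℕ.+ m) (ℕP.≤-trans N≤m (ℕP.m≤m+n m m))

    gap-null : (λ n → expSum (X + Y) (n ℕ.+ n) + - 1# * expSum (X + Y) n) ⟶ 0#
    gap-null = ⟶-cong (λ _ → ≈-refl) (solve 1 (λ l → l :+ :- con (+ 1) :* l := con (+ 0)) ≈-refl _)
      (⟶-+ doubled (⟶-*ˡ (- 1#) (expSum⟶exp (X + Y))))

    dominated : ∀ n → expSum x n * expSum y n - expSum (x + y) n ⋖ expSum (X + Y) (n ℕ.+ n) + - 1# * expSum (X + Y) n
    dominated n =
      let p , q = ⋖-resp (+-congˡ (-‿cong (triangle-expSum x y n))) (+-congˡ (-‿cong (triangle-expSum X Y n)))
                    (square-triangle-⋖ (expTerm-⋖ (⋖abs x)) (expTerm-⋖ (⋖abs y)) (ℕP.≤-refl {n}))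
          square≤ : expSum X n * expSum Y n - expSum (X + Y) n ≤ expSum (X + Y) (n ℕ.+ n) + - 1# * expSum (X + Y) n
          square≤ = ≤-by (Δ (≤-respʳ (triangle-expSum X Y (n ℕ.+ n))
              (rectangle≤triangle (0≤expTerm (0≤abs x)) (0≤expTerm (0≤abs y)) n n)))
            (solve 3 (λ s t u → (u :+ :- con (+ 1) :* t) :- (s :- t) := u :- s) ≈-refl _ _ _)
      in ≤-trans p square≤ , ≤-trans q square≤

    difference-null : (λ n → expSum x n * expSum y n - expSum (x + y) n) ⟶ 0#
    difference-null = squeeze-null gap-null (λ n → proj₁ (dominated n)) (λ n → proj₂ (dominated n))

  exp≤ : ∀ {x} → 0# ≤ x → x < 1# → exp x ≤ 1# / (1# - x)
  exp≤ 0≤x x<1 = limit-≤ (expSum⟶exp _) (expSum-geometric 0≤x x<1)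

  1+x≤exp : ∀ {x} → 0# ≤ x → 1# + x ≤ exp x
  1+x≤exp {x} 0≤x = limit-≥ 2 (expSum⟶exp x) λ m 2≤m →
    ≤-trans (≤-reflexive (≈-sym (+-cong (expTerm-0 x) (≈-trans (+-identityʳ _)
      (≈-trans (solve 1 (λ t → t := (con (+ 1) :+ con (+ 0)) :* t) ≈-refl (expTerm x 1))
        (≈-trans (expTerm-derivative x 0) (≈-trans (*-congˡ (expTerm-0 x)) (*-identityʳ x))))))))
      (monotone-chain (partialSums-increasing (0≤expTerm 0≤x)) 2≤m)

  ^-cong : ∀ {x y} → x ≈ y → ∀ n → x ^ n ≈ y ^ n
  ^-cong x≈y zero    = ≈-refl
  ^-cong x≈y (suc n) = *-cong x≈y (^-cong x≈y n)

  exp-cong : ∀ {x y} → x ≈ y → exp x ≈ exp y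
  exp-cong {x} {y} x≈y = ⟶-unique (expSum⟶exp x) (⟶-cong
    (λ n → partialSums-cong (λ k → *-congʳ {fromℕ (k ℕ.!) ⁻¹} (^-cong (≈-sym x≈y) k)) n) ≈-refl (expSum⟶exp y))

  exp-0 : exp 0# ≈ 1#
  exp-0 = ≤-antisym (≤-respʳ (*-cancelʳ-≈ (Δ< 0<1) (≈-trans (/-* 1# (Δ< 0<1))
      (solve 0 (con (+ 1) := con (+ 1) :* (con (+ 1) :- con (+ 0))) ≈-refl))) (exp≤ ≤-refl 0<1))
    (≤-respˡ (+-identityʳ 1#) (1+x≤exp ≤-refl))

  exp-neg : ∀ x → exp x * exp (- x) ≈ 1#
  exp-neg x = ≈-trans (≈-sym (exp-+ x (- x))) (≈-trans (exp-cong (-‿inverseʳ x)) exp-0)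

  0<exp-nonNeg : ∀ {x} → 0# ≤ x → 0# < exp x
  0<exp-nonNeg 0≤x = <-≤-trans (0<1 ⊕< 0≤x) (1+x≤exp 0≤x)

  0<exp : ∀ x → 0# < exp x
  0<exp x with ≤-total 0# x
  ... | inj₁ 0≤x = 0<exp-nonNeg 0≤x
  ... | inj₂ x≤0 = ≰⇒> λ expx≤0 → <⇒≱ 0<1 (≤-trans (≤-reflexive (≈-sym (exp-neg x)))
    (≤-trans (*-monoˡ expx≤0) (≤-reflexive (zeroˡ _))))
    where
    *-monoˡ : exp x ≤ 0# → exp x * exp (- x) ≤ 0# * exp (- x)
    *-monoˡ le = ≤-by (Δ le ⊗ <⇒≤ (0<exp-nonNeg (0≤-x x≤0)))
      (solve 2 (λ a b → con (+ 0) :* b :- a :* b := (con (+ 0) :- a) :* b) ≈-refl (exp x) (exp (- x)))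

  exp-mono-< : ∀ {x y} → x < y → exp x < exp y
  exp-mono-< {x} {y} x<y = <-by (0<exp x ⊗< <-≤-trans (Δ< x<y) (≤-by (Δ (1+x≤exp (Δ (<⇒≤ x<y)))) 
      (solve 2 (λ d e → e :- con (+ 1) :- d := e :- (con (+ 1) :+ d)) ≈-refl (y - x) (exp (y - x)))))
    (≈-trans (+-congʳ (≈-trans (exp-cong (solve 2 (λ x y → y := x :+ (y :- x)) ≈-refl x y)) (exp-+ x (y - x))))
      (solve 2 (λ a e → a :* e :- a := a :* (e :- con (+ 1))) ≈-refl (exp x) (exp (y - x))))

  exp-cancel-≤ : ∀ {x y} → exp x ≤ exp y → x ≤ y
  exp-cancel-≤ {x} {y} le with em {x ≤ y}
  ... | yes x≤y = x≤y
  ... | no  x≰y = contradiction le (<⇒≱ (exp-mono-< (≰⇒> x≰y)))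

  -- Logarithms and iterated exponentials

  -- The preimage is the supremum s of all z with exp z ≤ y. Continuity enters through exp h * (1 -
  -- h) ≤ 1 for 0 < h < 1: if exp s and y differ, with h their relative gap, then either s - h is
  -- still an upper bound or s + h still belongs to the set.
  exp-surjective : ∀ {y} → 0# < y → ∃[ z ] exp z ≈ y
  exp-surjective {y} 0<y = s , ≤-antisym exp-s≤y y≤exp-s
    where
    Below : ℝ → Set
    Below z = exp z ≤ y

    bounded : ∀ {z} → Below z → z ≤ y
    bounded {z} exp≤y with ≤-total 0# z
    ... | inj₁ 0≤z = ≤-trans (≤-by 0≤1 (solve 1 (λ z → con (+ 1) :+ z :- z := con (+ 1)) ≈-refl z))
        (≤-trans (1+x≤exp 0≤z) exp≤y)
    ... | inj₂ z≤0 = ≤-trans z≤0 (<⇒≤ 0<y)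

    -- exp (- 1/y) = 1 / exp (1/y) ≤ y
    inhabited : Below (- (1# / y))
    inhabited = *-cancelʳ-≤ (0<exp (1# / y)) (≤-trans
      (≤-reflexive (≈-trans (*-comm _ _) (≈-trans (exp-neg (1# / y)) (≈-trans (≈-sym (/-* 1# 0<y)) (*-comm _ _)))))
      (*-monoʳ-≤ (<⇒≤ 0<y) (≤-trans (≤-by 0≤1 (solve 1 (λ z → con (+ 1) :+ z :- z := con (+ 1)) ≈-refl (1# / y)))
        (1+x≤exp (<⇒≤ (0</ 0<1 0<y))))))

    s : ℝ
    s = sup Below

    relative-gap : ∀ {a b} → 0# < b → 0# < a → a < b → ∃[ h ] 0# < h × h < 1# × a ≈ b * (1# - h)
    relative-gap {a} {b} 0<b 0<a a<b = (b - a) / b , 0</ (Δ< a<b) 0<b ,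
      <-by (0</ 0<a 0<b) (*-cancelʳ-≈ 0<b (≈-trans
        (≈-trans (solve 2 (λ q b → (con (+ 1) :- q) :* b := b :- q :* b) ≈-refl ((b - a) / b) b)
          (≈-trans (+-congˡ (-‿cong (/-* (b - a) 0<b))) (solve 2 (λ a b → b :- (b :- a) := a) ≈-refl a b)))
        (≈-sym (/-* a 0<b)))) ,
      ≈-sym (≈-trans (solve 2 (λ q b → b :* (con (+ 1) :- q) := b :- q :* b) ≈-refl ((b - a) / b) b)
          (≈-trans (+-congˡ (-‿cong (/-* (b - a) 0<b))) (solve 2 (λ a b → b :- (b :- a) := a) ≈-refl a b)))

    exp*[1-h]≤1 : ∀ {h} → 0# < h → h < 1# → exp h * (1# - h) ≤ 1#
    exp*[1-h]≤1 {h} 0<h h<1 = ≤-trans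
      (≤-by (Δ (exp≤ (<⇒≤ 0<h) h<1) ⊗ Δ (<⇒≤ h<1)) (solve 3 (λ e q d → q :* d :- e :* d := (q :- e) :* d)
          ≈-refl (exp h) (1# / (1# - h)) (1# - h)))
      (≤-reflexive (/-* 1# (Δ< h<1)))

    exp-s≤y : exp s ≤ y
    exp-s≤y with em {exp s ≤ y}
    ... | yes le = le
    ... | no ¬le =
      let h , 0<h , h<1 , y≈ = relative-gap (0<exp s) 0<y (≰⇒> ¬le)
          y≤ : y ≤ exp (s - h)
          y≤ = *-cancelʳ-≤ (0<exp h) (≤-trans (≤-reflexive (*-congʳ y≈))
            (≤-by (<⇒≤ (0<exp s) ⊗ Δ (exp*[1-h]≤1 0<h h<1))
              (≈-trans (+-congʳ (≈-trans (≈-sym (exp-+ (s - h) h))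
                  (exp-cong (solve 2 (λ s h → s :- h :+ h := s) ≈-refl s h))))
                (solve 3 (λ e h x → e :- e :* (con (+ 1) :- h) :* x := e :* (con (+ 1) :- x :* (con (+ 1) :- h)))
                    ≈-refl (exp s) h (exp h)))))
      in contradiction (sup-least Below (_ , inhabited) (λ Bz → exp-cancel-≤ (≤-trans Bz y≤)))
           (<⇒≱ (<-by 0<h (solve 2 (λ s h → s :- (s :- h) := h) ≈-refl s h)))

    y≤exp-s : y ≤ exp s
    y≤exp-s with em {y ≤ exp s}
    ... | yes le = le
    ... | no ¬le =
      let h , 0<h , h<1 , s≈ = relative-gap 0<y (0<exp s) (≰⇒> ¬le)
          below : Below (s + h)
          below = *-cancelʳ-≤ (Δ< h<1) (≤-trans (≤-reflexive (*-congʳ (exp-+ s h)))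
            (≤-trans (≤-by (<⇒≤ (0<exp s) ⊗ Δ (exp*[1-h]≤1 0<h h<1))
               (solve 3 (λ e x d → e :- e :* x :* d := e :* (con (+ 1) :- x :* d)) ≈-refl (exp s) (exp h) (1# - h)))
              (≤-reflexive s≈)))
      in contradiction (sup-upper Below bounded below) (<⇒≱ (<-by 0<h (solve 2 (λ s h → s :+ h :- s := h) ≈-refl s h)))

  exp-injective : ∀ {x y} → exp x ≈ exp y → x ≈ y
  exp-injective eq = ≤-antisym (exp-cancel-≤ (≤-reflexive eq)) (exp-cancel-≤ (≤-reflexive (≈-sym eq)))

  exp-ln : ∀ {y} → 0# < y → exp (ln y) ≈ y
  exp-ln {y} 0<y = let z , exp-z≈y = exp-surjective 0<y in
    ≈-trans (exp-cong (the-≈ exp-z≈y (λ exp-u≈y → exp-injective (≈-trans exp-u≈y (≈-sym exp-z≈y))))) exp-z≈y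

  exp-fromℕ-* : ∀ n x → exp (fromℕ n * x) ≈ exp x ^ n
  exp-fromℕ-* zero    x = ≈-trans (exp-cong (zeroˡ x)) exp-0
  exp-fromℕ-* (suc n) x = ≈-trans (exp-cong (≈-trans (distribʳ x 1# (fromℕ n)) (+-congʳ (*-identityˡ x))))
    (≈-trans (exp-+ x (fromℕ n * x)) (*-congˡ (exp-fromℕ-* n x)))

  fromℕ-^ : ∀ m n → fromℕ (m ℕ.^ n) ≈ fromℕ m ^ n
  fromℕ-^ m zero    = +-identityʳ 1#
  fromℕ-^ m (suc n) = ≈-trans (fromℕ-* m (m ℕ.^ n)) (*-congˡ (fromℕ-^ m n))

  0<ln2 : 0# < ln (fromℕ 2)
  0<ln2 = ≰⇒> λ ln2≤0 → <⇒≱ (<-by (0<fromℕ-suc 0)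
      (solve 0 (con (+ 2) :- con (+ 1) := con (+ 1) :+ con (+ 0)) ≈-refl))
    (≤-trans (≤-reflexive (≈-sym (exp-ln (0<fromℕ-suc 1)))) (≤-trans (exp-mono-≤ ln2≤0) (≤-reflexive exp-0)))
    where
    exp-mono-≤ : ∀ {x y} → x ≤ y → exp x ≤ exp y
    exp-mono-≤ {x} {y} x≤y with em {exp x ≤ exp y}
    ... | yes le = le
    ... | no ¬le = contradiction x≤y (<⇒≱ (≰⇒> λ y≥x → ¬le
        (≤-reflexive (exp-cong (≤-antisym x≤y (exp-cancel-≤ (≰⇒≥ ¬le)))))))

  log₂-≤ : ∀ {x} k → 0# < x → x ≤ fromℕ (2 ℕ.^ k) → log₂ x ≤ fromℕ k
  log₂-≤ {x} k 0<x x≤2^k = /-≤ 0<ln2 (exp-cancel-≤ (begin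
    exp (ln x)                    ≈⟨ exp-ln 0<x ⟩
    x                             ≤⟨ x≤2^k ⟩
    fromℕ (2 ℕ.^ k)               ≈⟨ fromℕ-^ 2 k ⟩
    fromℕ 2 ^ k                   ≈⟨ ^-cong (exp-ln (0<fromℕ-suc 1)) k ⟨
    exp (ln (fromℕ 2)) ^ k        ≈⟨ exp-fromℕ-* k (ln (fromℕ 2)) ⟨
    exp (fromℕ k * ln (fromℕ 2))  ∎))
    where open ≤-Reasoning

  leastℕ : ∀ {P : ℕ → Set} {k} → P k → ∃[ j ] IsLeastℕ P j
  leastℕ {P} {zero}  P0 = 0 , P0 , λ _ _ → ℕ.z≤n
  leastℕ {P} {suc k} Pk with em {P 0}
  ... | yes P0 = 0 , P0 , λ _ _ → ℕ.z≤n
  ... | no ¬P0 = let j , Pj , least = leastℕ {λ i → P (suc i)} {k} Pk in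
    suc j , Pj , λ { zero P0 → contradiction P0 ¬P0 ; (suc i) Pi → ℕ.s≤s (least i Pi) }

  the-least≤ : ∀ (f : ℕ → ℕ) {P : ℕ → Set} {b} → ∃ P → (∀ {k} → IsLeastℕ P k → f k ℕ.≤ b) →
    the (λ v → ∃[ k ] (IsLeastℕ P k × v ≈ fromℕ (f k))) ≤ fromℕ b
  the-least≤ f (_ , Pk) bound = let j , least = leastℕ Pk in
    sup-least _ (fromℕ (f j) , j , least , ≈-refl) λ { (k , least-k , v≈) →
        ≤-respˡ (≈-sym v≈) (fromℕ-mono (bound least-k)) }

  log*-≤ : ∀ {x} k → x ≤ fromℕ (tower k) → log* x ≤ fromℕ k
  log*-≤ {x} k x≤tower = let j , j≤k , Pj = iterates k x≤tower in
    the-least≤ (λ i → i) (j , Pj) (λ least → ℕP.≤-trans (proj₂ least j Pj) j≤k)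
    where
    iterates : ∀ k {x} → x ≤ fromℕ (tower k) → ∃[ j ] j ℕ.≤ k × iterate log₂ j x ≤ 1#
    iterates zero        x≤ = 0 , ℕ.z≤n , ≤-trans x≤ (≤-reflexive (+-identityʳ 1#))
    -- Iteration has to stop at values up to 1, because the next logarithm need not be positive and
    -- `log₂` is controlled only at positive arguments.
    iterates (suc k) {x} x≤ with em {x ≤ 1#}
    ... | yes x≤1 = 0 , ℕ.z≤n , x≤1
    ... | no  x≰1 = let j , j≤k , Pj = iterates k (log₂-≤ (tower k) (≤-<-trans 0≤1 (≰⇒> x≰1)) x≤) in
      suc j , ℕ.s≤s j≤k , Pj

  towerℝ-≤ : ∀ {x} k → x ≤ fromℕ k → towerℝ x ≤ fromℕ (tower k)
  towerℝ-≤ k x≤k = the-least≤ tower (k , x≤k) (λ least → tower-mono-≤ (proj₂ least k x≤k))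

  -- The root exp (ln n / 5) shows that the described set is inhabited. Any root y above n would be
  -- above 1 as well, and then y ≤ y ^ 5 = n.
  fifthRoot-bounds : ∀ {n} → 1 ℕ.≤ n → 0# < fifthRoot (fromℕ n) × fifthRoot (fromℕ n) ≤ fromℕ n
  fifthRoot-bounds {n} 1≤n =
    <-≤-trans (0<exp _) (sup-upper _ (λ { (0≤y , y^5≈n) → root≤ y^5≈n }) root) ,
    sup-least _ (_ , root) (λ { (0≤y , y^5≈n) → root≤ y^5≈n })
    where
    ν z : ℝ
    ν = fromℕ n
    z = ln ν / fromℕ 5

    1≤ν : 1# ≤ ν
    1≤ν = ≤-trans (≤-reflexive (≈-sym (+-identityʳ 1#))) (fromℕ-mono 1≤n)

    root : 0# ≤ exp z × exp z ^ 5 ≈ ν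
    root = <⇒≤ (0<exp z) , ≈-trans (≈-sym (exp-fromℕ-* 5 z))
      (≈-trans (exp-cong (≈-trans (*-comm _ _) (/-* (ln ν) (0<fromℕ-suc 4)))) (exp-ln (0<fromℕ 1≤n)))

    root≤ : ∀ {y} → y ^ 5 ≈ ν → y ≤ ν
    root≤ {y} y^5≈n with em {y ≤ ν}
    ... | yes y≤ν = y≤ν
    ... | no  y≰ν = ≤-trans (≤-trans (≤-reflexive (≈-sym (*-identityʳ y))) (*-monoʳ-≤ 0≤y (1≤y^ 4))) (≤-reflexive y^5≈n)
      where
      1≤y : 1# ≤ y
      1≤y = ≤-trans 1≤ν (≰⇒≥ y≰ν)

      0≤y : 0# ≤ y
      0≤y = ≤-trans 0≤1 1≤y

      1≤y^ : ∀ k → 1# ≤ y ^ k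
      1≤y^ zero    = ≤-refl
      1≤y^ (suc k) = ≤-respˡ (*-identityˡ 1#) (*-mono-≤ 0≤1 1≤y 0≤1 (1≤y^ k))

  -- The fifth root is at most n, hence at most 40 * 2 ^ n, so the logarithm is at most n. Such a
  -- coarse estimate suffices because n levels of the tower are a linear cost.
  width-bound : ∀ {n} → 1 ℕ.≤ n → towerℝ (log₂ (fifthRoot (fromℕ n) / fromℕ 40)) ≤ fromℕ (tower n)
  width-bound {n} 1≤n = let 0<root , root≤n = fifthRoot-bounds 1≤n in
    towerℝ-≤ n (log₂-≤ n (0</ 0<root (0<fromℕ-suc 39)) (/-≤ (0<fromℕ-suc 39) (begin
      fifthRoot (fromℕ n)               ≤⟨ root≤n ⟩
      fromℕ n                           ≤⟨ fromℕ-mono (ℕP.<⇒≤ (n<2^n n)) ⟩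
      fromℕ (2 ℕ.^ n)                   ≤⟨ fromℕ-mono (ℕP.m≤m*n (2 ℕ.^ n) 40) ⟩
      fromℕ (2 ℕ.^ n ℕ.* 40)            ≈⟨ fromℕ-* (2 ℕ.^ n) 40 ⟩
      fromℕ (2 ℕ.^ n) * fromℕ 40        ∎)))
    where open ≤-Reasoning

  -- Lacunary sequences

  abs-cong : ∀ {x y} → x ≈ y → abs x ≈ abs y
  abs-cong {x} {y} x≈y = ≤-antisym (half x≈y) (half (≈-sym x≈y))
    where
    half : ∀ {x y} → x ≈ y → abs x ≤ abs y
    half {x} {y} x≈y = abs-≤ (≤-respˡ (≈-sym x≈y) (x≤abs y)) (≤-respˡ (-‿cong (≈-sym x≈y)) (-x≤abs y))

  abs-neg : ∀ x → abs (- x) ≈ abs x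
  abs-neg x = ≤-antisym (abs-≤ (-x≤abs x) (≤-respˡ (≈-sym (-‿involutive x)) (x≤abs x)))
    (abs-≤ (≤-respˡ (-‿involutive x) (-x≤abs (- x))) (x≤abs (- x)))

  abs-nonNeg : ∀ {x} → 0# ≤ x → abs x ≈ x
  abs-nonNeg {x} 0≤x = ≤-antisym (abs-≤ ≤-refl (≤-by (0≤x ⊕ 0≤x) (solve 1 (λ x → x :- :- x := x :+ x) ≈-refl x)))
      (x≤abs x)

  abs-+ : ∀ x y → abs (x + y) ≤ abs x + abs y
  abs-+ x y = abs-≤
    (≤-by (Δ (x≤abs x) ⊕ Δ (x≤abs y)) (solve 4 (λ x y a b → a :+ b :- (x :+ y) := (a :- x) :+ (b :- y))
        ≈-refl x y (abs x) (abs y)))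
    (≤-by (Δ (-x≤abs x) ⊕ Δ (-x≤abs y)) (solve 4 (λ x y a b → a :+ b :- :- (x :+ y) := (a :- :- x) :+ (b :- :- y))
        ≈-refl x y (abs x) (abs y)))

  dist : ℝ → ℝ → ℝ
  dist x y = abs (x - y)

  dist-sym : ∀ x y → dist x y ≈ dist y x
  dist-sym x y = ≈-trans (≈-sym (abs-neg (x - y))) (abs-cong (solve 2 (λ x y → :- (x :- y) := y :- x) ≈-refl x y))

  dist-triangle : ∀ x y z → dist x z ≤ dist x y + dist y z
  dist-triangle x y z = ≤-respˡ (abs-cong (solve 3 (λ x y z → (x :- y) :+ (y :- z) := x :- z) ≈-refl x y z))
      (abs-+ (x - y) (y - z))

  dist-between : ∀ {x y z} → x ≤ y → y ≤ z → dist x z ≈ dist x y + dist y z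
  dist-between {x} {y} {z} x≤y y≤z = ≈-trans (increasing (≤-trans x≤y y≤z)) (≈-trans
    (solve 3 (λ x y z → z :- x := (y :- x) :+ (z :- y)) ≈-refl x y z)
        (≈-sym (+-cong (increasing x≤y) (increasing y≤z))))
    where
    increasing : ∀ {x y} → x ≤ y → dist x y ≈ y - x
    increasing {x} {y} x≤y = ≈-trans (dist-sym x y) (abs-nonNeg (Δ x≤y))

  module Lacunary {A : Set} (pt : A → ℝ) (K : ℕ) where

    d : A → A → ℝ
    d x y = dist (pt x) (pt y)

    κ : ℝ
    κ = fromℕ K

    Growing : List A → Set
    Growing ys = ∀ {x y z} → x ∷ y ∷ z ∷ [] ⊆ ys → κ * d x y ≤ d y z

    NowhereLacunary : List A → Set
    NowhereLacunary ys = ∀ {x y z} → x ∷ y ∷ z ∷ [] ⊆ ys → d y z < κ * d x y × d x y < κ * d y z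

    Additive : List A → Set
    Additive ys = ∀ {x y z} → x ∷ y ∷ z ∷ [] ⊆ ys → d x z ≈ d x y + d y z

    -- With a and b the first two points, each later step has length more than
    -- d a b / κ², while each later point has distance less than κ * d a b from b.
    steps-advance : ∀ {a b} w ws → NowhereLacunary (a ∷ b ∷ w ∷ ws) → Additive (a ∷ b ∷ w ∷ ws) →
      ∃[ v ] a ∷ b ∷ v ∷ [] ⊆ a ∷ b ∷ w ∷ ws × κ * κ * d b w + fromℕ (length ws) * d a b ≤ κ * κ * d b v
    steps-advance {a} {b} w [] _ _ = w , ⊆-refl , ≤-reflexive (solve 2 (λ p q → p :+ con (+ 0) :* q := p) ≈-refl _ _)
    steps-advance {a} {b} w (w′ ∷ ws) nowhere additive =
      let v , v⊆ , le = steps-advance w′ ws (λ τ → nowhere (⊆-trans τ skip)) (λ τ → additive (⊆-trans τ skip))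
          ab<κbw  = proj₂ (nowhere {a} {b} {w} (≡.refl ∷ ≡.refl ∷ ≡.refl ∷ minimum _))
          bw<κww′ = proj₂ (nowhere {b} {w} {w′} (a ∷ʳ ≡.refl ∷ ≡.refl ∷ ≡.refl ∷ minimum _))
          bw′≈    = additive {b} {w} {w′} (a ∷ʳ ≡.refl ∷ ≡.refl ∷ ≡.refl ∷ minimum _)
      in v , ⊆-trans v⊆ skip , ≤-trans (≤-by (Δ (<⇒≤ ab<κbw) ⊕ 0≤fromℕ K ⊗ Δ (<⇒≤ bw<κww′))
           (≈-trans (+-congʳ (+-congʳ (*-congˡ bw′≈)))
             (solve 5 (λ k p q n D → (k :* k :* (p :+ q) :+ n :* D) :- (k :* k :* p :+ (con (+ 1) :+ n) :* D)
               := (k :* p :- D) :+ k :* (k :* q :- p)) ≈-refl κ (d b w) (d w w′) (fromℕ (length ws)) (d a b)))) le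
      where
      skip : a ∷ b ∷ w′ ∷ ws ⊆ a ∷ b ∷ w ∷ w′ ∷ ws
      skip = ≡.refl ∷ ≡.refl ∷ w ∷ʳ ⊆-refl

    -- For the point v reached by `steps-advance`, κ² * d b v is at least d a b times the length of
    -- `ws`, while d b v < κ * d a b. Hence that length is below κ³, and the other three points are
    -- added.
    nowhereLacunary-short : ∀ ys → NowhereLacunary ys → Additive ys → length ys ℕ.≤ K ℕ.^ 3 ℕ.+ 3
    nowhereLacunary-short []           _ _ = ℕ.z≤n
    nowhereLacunary-short (_ ∷ [])     _ _ = ℕP.≤-trans (ℕP.m≤m+n 1 2) (ℕP.m≤n+m 3 (K ℕ.^ 3))
    nowhereLacunary-short (_ ∷ _ ∷ []) _ _ = ℕP.≤-trans (ℕP.m≤m+n 2 1) (ℕP.m≤n+m 3 (K ℕ.^ 3))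
    nowhereLacunary-short (a ∷ b ∷ w ∷ ws) nowhere additive with length ws ℕP.≤? K ℕ.^ 3
    ... | yes short = ℕP.≤-trans (ℕP.+-monoʳ-≤ 3 short) (ℕP.≤-reflexive (ℕP.+-comm 3 (K ℕ.^ 3)))
    ... | no  long  =
      let v , v⊆ , le = steps-advance w ws nowhere additive
          bw<κab = proj₁ (nowhere {a} {b} {w} (≡.refl ∷ ≡.refl ∷ ≡.refl ∷ minimum _))
          bv<κab = proj₁ (nowhere v⊆)
          0<κab  = ≤-<-trans (0≤abs _) bw<κab
          0<ab : 0# < d a b
          0<ab = ≰⇒> λ ab≤0 → <⇒≱ 0<κab (≤-by (0≤fromℕ K ⊗ 0≤-x ab≤0)
                   (solve 2 (λ k D → con (+ 0) :- k :* D := k :* (:- D)) ≈-refl κ (d a b)))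
          cubed  : fromℕ (K ℕ.^ 3) ≈ κ * κ * κ
          cubed  = ≈-trans (fromℕ-* K (K ℕ.^ 2)) (≈-trans (*-congˡ
              (≈-trans (fromℕ-* K (K ℕ.^ 1)) (*-congˡ (fromℕ-* K 1))))
                     (solve 1 (λ k → k :* (k :* (k :* (con (+ 1) :+ con (+ 0)))) := k :* k :* k) ≈-refl κ))
      in contradiction le (<⇒≱ (<-by (0<ab ⊕< ((0≤fromℕ K ⊗ 0≤fromℕ K) ⊗ Δ (<⇒≤ bv<κab))
           ⊕< (0≤fromℕ K ⊗ 0≤fromℕ K) ⊗ 0≤abs (pt b - pt w) ⊕< Δ (fromℕ-mono (ℕP.≰⇒> long)) ⊗ <⇒≤ 0<ab)
           (≈-trans (solve 5 (λ k p q n D → (k :* k :* p :+ n :* D) :- k :* k :* q := 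
                D :+ (k :* k :* (k :* D :- q)) :+ k :* k :* p :+ (n :- (con (+ 1) :+ k :* k :* k)) :* D) ≈-refl
                κ (d b w) (d b v) (fromℕ (length ws)) (d a b))
             (+-congˡ (*-congʳ (+-congˡ (-‿cong (+-congˡ (≈-sym cubed)))))))))

    reversed : ∀ {x y z : A} {ys} → x ∷ y ∷ z ∷ [] ⊆ reverse ys → z ∷ y ∷ x ∷ [] ⊆ ys
    reversed {x} {y} {z} {ys} τ = ≡.subst (z ∷ y ∷ x ∷ [] ⊆_) (ListP.reverse-involutive ys) (reverse⁺ τ)

    -- On a homogeneous list all triples grow, or all shrink, or neither happens anywhere. Growth is
    -- the goal, shrinking becomes growth by reversal, and in the remaining case a monotone sublist
    -- has additive distances and is therefore short.
    lacunary-sublist : ∀ h xs → 2 ℕ.≤ h → K ℕ.^ 3 ℕ.+ 3 ℕ.< tower h → tower (24 ℕ.+ h) ℕ.≤ length xs →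
      ∃[ ys ] (ys ⊆ xs ⊎ reverse ys ⊆ xs) × tower h ℕ.≤ length ys × Growing ys
    lacunary-sublist h xs 2≤h K<tower large =
      -- Two applications to triples cost 9 levels each and one application to pairs costs 6, which
      -- leads from 24 + h over 15 + h and 6 + h down to h.
      growing (ramsey-predicate em 3 (15 ℕ.+ h) Grows xs (≤+ 15) large)
      where
      ≤+ : ∀ m → 2 ℕ.≤ m ℕ.+ h
      ≤+ m = ℕP.≤-trans 2≤h (ℕP.m≤n+m h m)

      Grows Shrinks Ascends : List A → Set
      Grows (x ∷ y ∷ z ∷ _) = κ * d x y ≤ d y z
      Grows _               = 0# ≤ 0#
      Shrinks (x ∷ y ∷ z ∷ _) = κ * d y z ≤ d x y
      Shrinks _               = 0# ≤ 0#
      Ascends (x ∷ y ∷ _) = pt x ≤ pt y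
      Ascends _           = 0# ≤ 0#

      Dichotomy : (List A → Set) → ℕ → ℕ → List A → Set
      Dichotomy P k h xs = ∃[ ys ] ys ⊆ xs × length ys ≡ tower h ×
        ((∀ {p} → p ⊆ ys → length p ≡ k → P p) ⊎ (∀ {p} → p ⊆ ys → length p ≡ k → ¬ P p))

      Goal : Set
      Goal = ∃[ ys ] (ys ⊆ xs ⊎ reverse ys ⊆ xs) × tower h ℕ.≤ length ys × Growing ys

      short : ∀ {ys} → length ys ≡ tower h → NowhereLacunary ys → Additive ys → Goal
      short {ys} |ys| nowhere additive = contradiction (nowhereLacunary-short ys nowhere additive)
        (ℕP.<⇒≱ (≡.subst (K ℕ.^ 3 ℕ.+ 3 ℕ.<_) (≡.sym |ys|) K<tower))

      monotone : ∀ {ys} → NowhereLacunary ys → Dichotomy Ascends 2 h ys → Goal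
      monotone nowhere (zs , zs⊆ , |zs| , inj₁ ascends) = short |zs| (λ τ → nowhere (⊆-trans τ zs⊆)) λ {x} {y} {z} τ →
        dist-between (ascends {x ∷ y ∷ []} (⊆-trans (≡.refl ∷ ≡.refl ∷ minimum _) τ) ≡.refl)
            (ascends {y ∷ z ∷ []} (∷ˡ⁻ τ) ≡.refl)
      monotone nowhere (zs , zs⊆ , |zs| , inj₂ descends) = short |zs| (λ τ → nowhere (⊆-trans τ zs⊆)) λ {x} {y} {z} τ →
        ≈-trans (dist-sym _ _) (≈-trans (dist-between
          (≰⇒≥ (descends {y ∷ z ∷ []} (∷ˡ⁻ τ) ≡.refl)) (≰⇒≥ (descends {x ∷ y ∷ []}
              (⊆-trans (≡.refl ∷ ≡.refl ∷ minimum _) τ) ≡.refl)))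
          (≈-trans (+-comm _ _) (+-cong (dist-sym _ _) (dist-sym _ _))))

      shrinking : ∀ {ys} → ys ⊆ xs → (∀ {x y z} → x ∷ y ∷ z ∷ [] ⊆ ys → d y z < κ * d x y) →
          Dichotomy Shrinks 3 (6 ℕ.+ h) ys → Goal
      shrinking ys⊆ not-growing (zs , zs⊆ , |zs| , inj₁ shrinks) = reverse zs ,
        inj₂ (≡.subst (_⊆ xs) (≡.sym (ListP.reverse-involutive zs)) (⊆-trans zs⊆ ys⊆)) ,
        ℕP.≤-trans (tower-mono-≤ (ℕP.m≤n+m h 6)) (ℕP.≤-reflexive (≡.sym (≡.trans (ListP.length-reverse zs) |zs|))) ,
        λ {x} {y} {z} τ → ≤-respˡ (*-congˡ (dist-sym _ _)) (≤-respʳ (dist-sym _ _)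
            (shrinks {z ∷ y ∷ x ∷ []} (reversed τ) ≡.refl))
      shrinking ys⊆ not-growing (zs , zs⊆ , |zs| , inj₂ not-shrinking) =
        monotone (λ {x} {y} {z} τ → not-growing (⊆-trans τ zs⊆) , ≰⇒> (not-shrinking {x ∷ y ∷ z ∷ []} τ ≡.refl))
          (ramsey-predicate em 2 h Ascends zs 2≤h (ℕP.≤-reflexive (≡.sym |zs|)))

      growing : Dichotomy Grows 3 (15 ℕ.+ h) xs → Goal
      growing (ys , ys⊆ , |ys| , inj₁ grows) = ys , inj₁ ys⊆ ,
        ℕP.≤-trans (tower-mono-≤ (ℕP.m≤n+m h 15)) (ℕP.≤-reflexive (≡.sym |ys|)) , λ {x} {y} {z} τ →
            grows {x ∷ y ∷ z ∷ []} τ ≡.refl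
      growing (ys , ys⊆ , |ys| , inj₂ not-growing) = shrinking ys⊆
          (λ {x} {y} {z} τ → ≰⇒> (not-growing {x ∷ y ∷ z ∷ []} τ ≡.refl))
        (ramsey-predicate em 3 (6 ℕ.+ h) Shrinks ys (≤+ 6) (ℕP.≤-reflexive (≡.sym |ys|)))

  -- Events

  infixl 6 _∖_
  -- Codes offer only complements and countable unions, so the difference is the complement of the
  -- union of the complement of `A` with `B`, where `B` is repeated to fill the sequence.
  _∖_ : Borel → Borel → Borel
  A ∖ B = complement (⋃ λ { zero → complement A ; (suc _) → B })

  ∖-intro : ∀ {A B y} → ⟦ A ⟧ y → ¬ ⟦ B ⟧ y → ⟦ A ∖ B ⟧ y
  ∖-intro y∈A y∉B (zero  , y∉A) = y∉A y∈A
  ∖-intro y∈A y∉B (suc _ , y∈B) = y∉B y∈B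

  ∖-elimˡ : ∀ {A B y} → ⟦ A ∖ B ⟧ y → ⟦ A ⟧ y
  ∖-elimˡ {A} {B} {y} y∈ with em {⟦ A ⟧ y}
  ... | yes y∈A = y∈A
  ... | no  y∉A = contradiction (zero , y∉A) y∈

  ∖-elimʳ : ∀ {A B y} → ⟦ A ∖ B ⟧ y → ¬ ⟦ B ⟧ y
  ∖-elimʳ y∈ y∈B = y∈ (1 , y∈B)

  ∅ : Borel
  ∅ = fst≤ 0# ∖ fst≤ 0#

  ∉∅ : ∀ {y} → ¬ ⟦ ∅ ⟧ y
  ∉∅ {y} y∈ = ∖-elimʳ {fst≤ 0#} {fst≤ 0#} {y} y∈ (∖-elimˡ {fst≤ 0#} {fst≤ 0#} {y} y∈)

  module Measure (μ : ProbabilityMeasure) where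

    private
      eventually-constant : ∀ {a : ℕ → ℝ} {l c} → (∀ m → a (2 ℕ.+ m) ≈ c) → a ⟶ l → l ≈ c
      eventually-constant {a} {l} {c} a≈c a⟶l = ⟶-unique {λ m → a (2 ℕ.+ m)}
        (λ η 0<η → let N , close = a⟶l η 0<η in N , λ m N≤m → close (2 ℕ.+ m) (ℕP.≤-trans N≤m (ℕP.m≤n+m m 2)))
        (⟶-cong (λ m → ≈-sym (a≈c m)) ≈-refl (⟶-const c))

    -- A sequence of empty events is disjoint and has an empty union. Its probability p is the limit
    -- of the sums p + p + ..., so that p + p ≤ p.
    Pr-∅ : Pr μ ∅ ≈ 0#
    Pr-∅ = ≤-antisym
      (≤-by (Δ (limit-≥ 2 (Pr-σ-add μ (λ _ → ∅) (λ _ y (y∈ , _) → ∉∅ {y} y∈)) twice))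
        (≈-trans (+-congˡ (-‿cong Pr-∅≈⋃)) (solve 2 (λ p q → con (+ 0) :- q := q :- (q :+ (q :+ con (+ 0))))
            ≈-refl (Pr μ ∅) (Pr μ (⋃ λ _ → ∅)))))
      (Pr-nonNeg μ ∅)
      where
      Pr-∅≈⋃ : Pr μ ∅ ≈ Pr μ (⋃ λ _ → ∅)
      Pr-∅≈⋃ = Pr-cong μ ((λ {y} y∈ → ⊥-elim (∉∅ {y} y∈)) , λ { {y} (_ , y∈) → y∈ })

      twice : ∀ m → 2 ℕ.≤ m → Pr μ (⋃ λ _ → ∅) + (Pr μ (⋃ λ _ → ∅) + 0#) ≤ partialSums (λ _ → Pr μ ∅) m
      twice m 2≤m = ≤-trans (≤-reflexive (+-cong (≈-sym Pr-∅≈⋃) (+-congʳ (≈-sym Pr-∅≈⋃))))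
        (monotone-chain (partialSums-increasing (λ _ → Pr-nonNeg μ ∅)) 2≤m)

    -- Countable additivity for `A`, `B` and empty events from then on. The union is an arbitrary
    -- code `C` with the right extension, which spares the caller a particular coding.
    Pr-disjoint-∪ : ∀ {A B C} → (∀ {y} → ⟦ A ⟧ y → ¬ ⟦ B ⟧ y) →
      (∀ {y} → ⟦ C ⟧ y → ⟦ A ⟧ y ⊎ ⟦ B ⟧ y) → (∀ {y} → ⟦ A ⟧ y → ⟦ C ⟧ y) → (∀ {y} → ⟦ B ⟧ y → ⟦ C ⟧ y) →
      Pr μ C ≈ Pr μ A + Pr μ B
    Pr-disjoint-∪ {A} {B} {C} disjoint split A⊆C B⊆C = ≈-trans (Pr-cong μ (C⊆⋃ , λ {y} → ⋃⊆C {y}))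
      (eventually-constant sums (Pr-σ-add μ pieces (λ {i} {j} i≢j y → pairwise i j i≢j y)))
      where
      pieces : ℕ → Borel
      pieces 0             = A
      pieces 1             = B
      pieces (suc (suc _)) = ∅

      C⊆⋃ : ⟦ C ⟧ U.⊆ ⟦ ⋃ pieces ⟧
      C⊆⋃ y∈C with split y∈C
      ... | inj₁ y∈A = 0 , y∈A
      ... | inj₂ y∈B = 1 , y∈B

      ⋃⊆C : ⟦ ⋃ pieces ⟧ U.⊆ ⟦ C ⟧
      ⋃⊆C     (0 , y∈A)           = A⊆C y∈A
      ⋃⊆C     (1 , y∈B)           = B⊆C y∈B
      ⋃⊆C {y} (suc (suc _) , y∈∅) = ⊥-elim (∉∅ {y} y∈∅)

      pairwise : ∀ i j → ¬ i ≡ j → ∀ y → ¬ (⟦ pieces i ⟧ y × ⟦ pieces j ⟧ y)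
      pairwise 0 0 i≢j y _ = i≢j ≡.refl
      pairwise 0 1 i≢j y (y∈A , y∈B) = disjoint y∈A y∈B
      pairwise 1 0 i≢j y (y∈B , y∈A) = disjoint y∈A y∈B
      pairwise 1 1 i≢j y _ = i≢j ≡.refl
      pairwise (suc (suc _)) _ i≢j y (y∈∅ , _) = ∉∅ {y} y∈∅
      pairwise 0 (suc (suc _)) i≢j y (_ , y∈∅) = ∉∅ {y} y∈∅
      pairwise 1 (suc (suc _)) i≢j y (_ , y∈∅) = ∉∅ {y} y∈∅

      sums : ∀ m → partialSums (λ k → Pr μ (pieces k)) (2 ℕ.+ m) ≈ Pr μ A + Pr μ B
      sums m = +-congˡ (≈-trans (+-congˡ (zeros m)) (+-identityʳ _))
        where
        zeros : ∀ m → partialSums (λ _ → Pr μ ∅) m ≈ 0#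
        zeros zero    = ≈-refl
        zeros (suc m) = ≈-trans (+-cong Pr-∅ (zeros m)) (+-identityˡ 0#)

    Pr-∖ : ∀ {A B} → ⟦ B ⟧ U.⊆ ⟦ A ⟧ → Pr μ (A ∖ B) ≈ Pr μ A - Pr μ B
    Pr-∖ {A} {B} B⊆A = ≈-trans (solve 2 (λ p q → p := (q :+ p) :- q) ≈-refl (Pr μ (A ∖ B)) (Pr μ B))
      (+-congʳ (≈-sym (Pr-disjoint-∪ {B} {A ∖ B} {A}
        (λ {y} y∈B y∈A∖B → ∖-elimʳ {A} {B} {y} y∈A∖B y∈B)
        (λ {y} y∈A → split y (em {⟦ B ⟧ y}) y∈A)
        B⊆A (λ {y} → ∖-elimˡ {A} {B} {y}))))
      where
      split : ∀ y → _ → ⟦ A ⟧ y → ⟦ B ⟧ y ⊎ ⟦ A ∖ B ⟧ y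
      split y (yes y∈B) y∈A = inj₁ y∈B
      split y (no  y∉B) y∈A = inj₂ (∖-intro {A} {B} {y} y∈A y∉B)

    Pr-mono : ∀ {A B} → ⟦ B ⟧ U.⊆ ⟦ A ⟧ → Pr μ B ≤ Pr μ A
    Pr-mono {A} {B} B⊆A = ≤-by (Pr-nonNeg μ (A ∖ B)) (≈-sym (Pr-∖ {A} {B} B⊆A))

    Pr≤1 : ∀ A → Pr μ A ≤ 1#
    Pr≤1 A = ≤-respʳ (Pr-total μ {complement ∅} (λ y → ∉∅ {y})) (Pr-mono {complement ∅} {A} (λ {y} _ → ∉∅ {y}))

    Pr-empty : ∀ A → (∀ y → ¬ ⟦ A ⟧ y) → Pr μ A ≈ 0#
    Pr-empty A empty = ≈-trans (Pr-cong μ ((λ {y} y∈A → ⊥-elim (empty y y∈A)) , λ {y} y∈∅ → ⊥-elim (∉∅ {y} y∈∅))) Pr-∅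

  -- The optimal radius

  -- Kept general in the order because `least-feasible` takes a minimum over feasible radii and a
  -- maximum over distances up to a given radius.
  select : ∀ {_≼_ : ℝ → ℝ → Set} → (∀ x → x ≼ x) → (∀ {x y z} → x ≼ y → y ≼ z → x ≼ z) → (∀ x y → x ≼ y ⊎ y ≼ x) →
    ∀ (P : ℝ → Set) rs → (∃[ r ] r ∈ₗ rs × P r) → ∃[ r ] r ∈ₗ rs × P r × (∀ {r′} → r′ ∈ₗ rs → P r′ → r ≼ r′)
  select ≼-refl ≼-trans ≼-total P [] (_ , () , _)
  select {_≼_} ≼-refl ≼-trans ≼-total P (x ∷ rs) (r₀ , r₀∈ , Pr₀) with em {∃[ r ] r ∈ₗ rs × P r}
  ... | no ¬rest = x , here ≡.refl , Px r₀∈ Pr₀ , λ { (here ≡.refl) _ → ≼-refl x ; (there r∈) Pr →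
      contradiction (_ , r∈ , Pr) ¬rest }
    where
    Px : ∀ {r} → r ∈ₗ x ∷ rs → P r → P x
    Px (here ≡.refl) Pr = Pr
    Px (there r∈)    Pr = contradiction (_ , r∈ , Pr) ¬rest
  ... | yes rest =
    let r , r∈ , Pr , best = select {_≼_} ≼-refl ≼-trans ≼-total P rs rest in choose r r∈ Pr best em
    where
    choose : ∀ r → r ∈ₗ rs → P r → (∀ {r′} → r′ ∈ₗ rs → P r′ → r ≼ r′) → Dec (P x × x ≼ r) →
      ∃[ r ] r ∈ₗ x ∷ rs × P r × (∀ {r′} → r′ ∈ₗ x ∷ rs → P r′ → r ≼ r′)
    choose r r∈ Pr best (yes (Px , x≼r)) = x , here ≡.refl , Px ,
      λ { (here ≡.refl) _ → ≼-refl x ; (there r′∈) Pr′ → ≼-trans x≼r (best r′∈ Pr′) }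
    choose r r∈ Pr best (no ¬better) = r , there r∈ , Pr ,
      λ { (here ≡.refl) Px → worse Px ; (there r′∈) Pr′ → best r′∈ Pr′ }
      where
      worse : P x → r ≼ x
      worse Px with ≼-total x r
      ... | inj₁ x≼r = contradiction (Px , x≼r) ¬better
      ... | inj₂ r≼x = r≼x

  module _ (X : FiniteSubset) where
    open FiniteSubset X

    -- Shrinking a feasible radius to the largest distance not exceeding it keeps
    -- it feasible, so the minimum is taken over finitely many radii.
    least-feasible : ∀ {n} (S : Database X n) t {ρ} → IsFeasibleRadius X S t ρ →
      ∃[ r ] IsFeasibleRadius X S t r × (∀ r′ → IsFeasibleRadius X S t r′ → r ≤ r′)
    least-feasible {n} S t feasible-ρ =
      let r₀ , r₀∈ , feasible-r₀ , _ = round feasible-ρ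
          r , _ , feasible , least = select {_≤_} (λ _ → ≤-refl) ≤-trans ≤-total (IsFeasibleRadius X S t)
              radii (r₀ , r₀∈ , feasible-r₀)
      in r , feasible , λ r′ feasible-r′ →
          let r″ , r″∈ , feasible-r″ , r″≤r′ = round feasible-r′ in ≤-trans (least r″∈ feasible-r″) r″≤r′
      where
      distance : Fin n → Fin size → ℝ
      distance i c = dist (point (Vec.lookup S i)) (point c)

      radii : List ℝ
      radii = 0# ∷ cartesianProductWith distance (allFin n) (allFin size)

      0≤radii : ∀ {r} → r ∈ₗ radii → 0# ≤ r
      0≤radii (here ≡.refl) = ≤-refl
      0≤radii (there r∈) with ∈-cartesianProductWith⁻ distance (allFin n) (allFin size) r∈
      ... | _ , _ , _ , _ , ≡.refl = 0≤abs _

      round : ∀ {r} → IsFeasibleRadius X S t r → ∃[ r′ ] r′ ∈ₗ radii × IsFeasibleRadius X S t r′ × r′ ≤ r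
      round {r} (0≤r , c , I , t≤∣I∣ , within) =
        let r′ , r′∈ , r′≤r , largest = select {λ x y → y ≤ x} (λ _ → ≤-refl) (λ y≤x z≤y → ≤-trans z≤y y≤x)
                (λ x y → ≤-total y x)
              (_≤ r) radii (0# , here ≡.refl , 0≤r)
        in r′ , r′∈ , (0≤radii r′∈ , c , I , t≤∣I∣ , λ i i∈I →
             largest (there (∈-cartesianProductWith⁺ distance (∈-allFin i) (∈-allFin c))) (within i i∈I)) , r′≤r

    -- The description in `r-opt` denotes something only if the minimum is attained; otherwise it is
    -- the supremum of an empty set, about which nothing is known.
    r-opt-bounds : ∀ {n} (S : Database X n) t {ρ} → IsFeasibleRadius X S t ρ → 0# ≤ r-opt X S t × r-opt X S t ≤ ρ
    r-opt-bounds S t feasible-ρ =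
      let r , feasible , least = least-feasible S t feasible-ρ
          r-opt≈r = the-≈ (feasible , least) λ (feasible-u , least-u) →
              ≤-antisym (least-u r feasible) (least _ feasible-u)
      in ≤-respʳ (≈-sym r-opt≈r) (proj₁ feasible) , ≤-respˡ (≈-sym r-opt≈r) (least _ feasible-ρ)

    ball-nonempty : ∀ {n} {S : Database X n} {c r k} → 0# < k → BallContains X S c r k →
        ∃[ i ] dist (point (Vec.lookup S i)) c ≤ r
    ball-nonempty {n} 0<k (I , k≤∣I∣ , within) with SubsetP.nonempty? I
    ... | yes (i , i∈I) = i , within i i∈I
    ... | no  empty     = contradiction k≤∣I∣ (<⇒≱ (≤-<-trans (≤-reflexive (≈-reflexive (≡.cong fromℕ
            (≡.trans (≡.cong ∣_∣ (SubsetP.Empty-unique empty)) (SubsetP.∣⊥∣≡0 n))))) 0<k))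

  -- The region |c - b| ≤ θ, r ≤ θ, up to the boundary point c = b - θ.
  region : ℝ → ℝ → Borel
  region b θ = (fst≤ (b + θ) ∖ fst≤ (b - θ)) ∖ complement (snd≤ θ)

  -- Strictness of the distance keeps c away from b - θ, the boundary point that removing a closed
  -- half-plane takes out of the region.
  region-intro : ∀ {b θ c r} → dist b c < θ → r ≤ θ → ⟦ region b θ ⟧ (c , r)
  region-intro {b} {θ} {c} {r} near r≤θ = ∖-intro {fst≤ (b + θ) ∖ fst≤ (b - θ)} {complement (snd≤ θ)}
    (∖-intro {fst≤ (b + θ)} {fst≤ (b - θ)}
      (≤-by (Δ (≤-trans (-x≤abs (b - c)) (<⇒≤ near))) (solve 3 (λ b θ c → b :+ θ :- c := θ :- :- (b :- c))
          ≈-refl b θ c))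
      (λ c≤b-θ → <⇒≱ near (≤-trans (≤-by (Δ c≤b-θ) (solve 3 (λ b θ c → b :- c :- θ := b :- θ :- c) ≈-refl b θ c))
          (x≤abs (b - c)))))
    (λ r≰θ → r≰θ r≤θ)

  region-elim : ∀ {b θ c r} → ⟦ region b θ ⟧ (c , r) → (c ≤ b + θ × ¬ c ≤ b - θ) × r ≤ θ
  region-elim {b} {θ} {c} {r} y∈ =
    let box = ∖-elimˡ {fst≤ (b + θ) ∖ fst≤ (b - θ)} {complement (snd≤ θ)} {c , r} y∈
    in (∖-elimˡ {fst≤ (b + θ)} {fst≤ (b - θ)} {c , r} box , ∖-elimʳ {fst≤ (b + θ)} {fst≤ (b - θ)} {c , r} box) , r≤θ
    where
    r≤θ : r ≤ θ
    r≤θ with em {r ≤ θ}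
    ... | yes le = le
    ... | no ¬le = contradiction ¬le (∖-elimʳ {fst≤ (b + θ) ∖ fst≤ (b - θ)} {complement (snd≤ θ)} {c , r} y∈)

  region-dist : ∀ {b θ c r} → ⟦ region b θ ⟧ (c , r) → dist b c ≤ θ
  region-dist {b} {θ} {c} y∈ = let (c≤ , c≰) , _ = region-elim y∈ in
    abs-≤ (≤-by (Δ (≰⇒≥ c≰)) (solve 3 (λ b θ c → θ :- (b :- c) := c :- (b :- θ)) ≈-refl b θ c))
          (≤-by (Δ c≤) (solve 3 (λ b θ c → θ :- :- (b :- c) := b :+ θ :- c) ≈-refl b θ c))

  region-mono : ∀ {b θ θ′} → θ ≤ θ′ → ⟦ region b θ ⟧ U.⊆ ⟦ region b θ′ ⟧
  region-mono {b} {θ} {θ′} θ≤θ′ {c , r} y∈ = let (c≤ , c≰) , r≤ = region-elim y∈ in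
    ∖-intro {fst≤ (b + θ′) ∖ fst≤ (b - θ′)} {complement (snd≤ θ′)}
      (∖-intro {fst≤ (b + θ′)} {fst≤ (b - θ′)}
        (≤-trans c≤ (≤-by (Δ θ≤θ′) (solve 3 (λ b θ θ′ → b :+ θ′ :- (b :+ θ) := θ′ :- θ) ≈-refl b θ θ′)))
        (λ c≤b-θ′ → c≰ (≤-trans c≤b-θ′ (≤-by (Δ θ≤θ′) (solve 3 (λ b θ θ′ → b :- θ :- (b :- θ′) := θ′ :- θ)
            ≈-refl b θ θ′)))))
      (λ r≰θ′ → r≰θ′ (≤-trans r≤ θ≤θ′))

  -- Databases from lists

  -- Padding and truncation give every list a database, so that the colouring passed to Ramsey's
  -- theorem is defined on lists of all lengths.
  pad : ∀ {A : Set} n → A → List A → Vec A n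
  pad zero    d xs       = []
  pad (suc n) d []       = d ∷ pad n d []
  pad (suc n) d (x ∷ xs) = x ∷ pad n d xs

  lookup-pad-∈ : ∀ {A : Set} {n} d (xs : List A) → length xs ≡ n → ∀ i → Vec.lookup (pad n d xs) i ∈ₗ xs
  lookup-pad-∈ {n = suc n} d (x ∷ xs) eq zero    = here ≡.refl
  lookup-pad-∈ {n = suc n} d (x ∷ xs) eq (suc i) = there (lookup-pad-∈ d xs (ℕP.suc-injective eq) i)

  neighboring-refl : ∀ {A : Set} {n} (S : Vec A n) → Neighboring S S
  neighboring-refl S i j i≢ _ = contradiction ≡.refl i≢

  neighboring-pad : ∀ {A : Set} n d (p : List A) x x′ s → Neighboring (pad n d (p ++ x ∷ s)) (pad n d (p ++ x′ ∷ s))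
  neighboring-pad (suc n) d []      x x′ s zero    zero    _  _  = ≡.refl
  neighboring-pad (suc n) d []      x x′ s (suc i) _       i≢ _  = contradiction ≡.refl i≢
  neighboring-pad (suc n) d []      x x′ s zero    (suc j) _  j≢ = contradiction ≡.refl j≢
  neighboring-pad (suc n) d (_ ∷ p) x x′ s zero    _       i≢ _  = contradiction ≡.refl i≢
  neighboring-pad (suc n) d (_ ∷ p) x x′ s (suc i) zero    _  j≢ = contradiction ≡.refl j≢
  neighboring-pad (suc n) d (_ ∷ p) x x′ s (suc i) (suc j) i≢ j≢ = ≡.cong suc (neighboring-pad n d p x x′ s i j i≢ j≢)

  -- If the exchanged element is the head, it is the separator, which is dropped, and the two
  -- databases coincide.
  neighboring-tail : ∀ {A : Set} n d (p : List A) x x′ s →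
    Neighboring (pad n d (drop 1 (p ++ x ∷ s))) (pad n d (drop 1 (p ++ x′ ∷ s)))
  neighboring-tail n d []      x x′ s = neighboring-refl (pad n d s)
  neighboring-tail n d (_ ∷ p) x x′ s = neighboring-pad n d p x x′ s

  -- Increments along a list

  final : ∀ {A : Set} → A → List A → A
  final x []       = x
  final x (y ∷ ys) = final y ys

  gap : ∀ {A : Set} → (A → ℝ) → List A → ℕ → ℝ
  gap φ (x ∷ y ∷ _)  zero    = φ y - φ x
  gap φ (_ ∷ y ∷ ys) (suc a) = gap φ (y ∷ ys) a
  gap φ _            _       = 0#

  gap-++ : ∀ {A : Set} (φ : A → ℝ) p {x y s} → gap φ (p ++ x ∷ y ∷ s) (length p) ≡ φ y - φ x
  gap-++ φ []          = ≡.refl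
  gap-++ φ (_ ∷ [])    = ≡.refl
  gap-++ φ (_ ∷ z ∷ p) = gap-++ φ (z ∷ p)

  gaps-telescope : ∀ {A : Set} (φ : A → ℝ) {g} x xs → (∀ a → a ℕ.< length xs → gap φ (x ∷ xs) a ≤ g) →
    φ (final x xs) - φ x ≤ fromℕ (length xs) * g
  gaps-telescope φ {g} x [] small = ≤-reflexive (solve 2 (λ p g → p :- p := con (+ 0) :* g) ≈-refl (φ x) g)
  gaps-telescope φ {g} x (y ∷ ys) small = ≤-by
    (Δ (small 0 (ℕ.s≤s ℕ.z≤n)) ⊕ Δ (gaps-telescope φ y ys (λ a a< → small (suc a) (ℕ.s≤s a<))))
    (solve 5 (λ p q r n g → (con (+ 1) :+ n) :* g :- (r :- p) := (g :- (q :- p)) :+ (n :* g :- (r :- q))) ≈-refl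
      (φ x) (φ y) (φ (final y ys)) (fromℕ (length ys)) g)

  final-maximal : ∀ {A : Set} (u : A → ℝ) x xs → (∀ {y z} → y ∷ z ∷ [] ⊆ x ∷ xs → u y ≤ u z) →
    ∀ {y} → y ∈ₗ x ∷ xs → u y ≤ u (final x xs)
  final-maximal u x []        mono (here ≡.refl) = ≤-refl
  final-maximal u x (x′ ∷ xs) mono (here ≡.refl) = ≤-trans (mono (≡.refl ∷ ≡.refl ∷ minimum _))
    (final-maximal u x′ xs (λ τ → mono (x ∷ʳ τ)) (here ≡.refl))
  final-maximal u x (x′ ∷ xs) mono (there y∈)    = final-maximal u x′ xs (λ τ → mono (x ∷ʳ τ)) y∈

  final-∈ : ∀ {A : Set} (x : A) xs → final x xs ∈ₗ x ∷ xs
  final-∈ x []       = here ≡.refl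
  final-∈ x (y ∷ ys) = there (final-∈ y ys)

  chop : ∀ {A : Set} a b (xs : List A) → a ℕ.+ b ℕ.≤ length xs →
      ∃[ p ] ∃[ s ] p ++ s ≡ xs × length p ≡ a × b ℕ.≤ length s
  chop zero    b xs       le = [] , xs , ≡.refl , ≡.refl , le
  chop (suc a) b (x ∷ xs) le =
      let p , s , eq , |p| , b≤ = chop a b xs (ℕ.s≤s⁻¹ le) in x ∷ p , s , ≡.cong (x ∷_) eq , ≡.cong suc |p| , b≤

  -- The privacy argument on a lacunary sequence

  dp-twice : ∀ {U : Set} {n ε δ} {M : Algorithm U n} → DifferentiallyPrivate ε δ M → ∀ {S S′ S″} →
    Neighboring S S′ → Neighboring S′ S″ → ∀ T → Pr (M S) T ≤ exp ε * (exp ε * Pr (M S″) T + δ) + δ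
  dp-twice {ε = ε} {δ} {M} dp {S} {S′} {S″} near near′ T = ≤-trans (dp S S′ near T)
    (≤-by (<⇒≤ (0<exp ε) ⊗ Δ (dp S′ S″ near′ T))
      (solve 4 (λ e p q d → (e :* q :+ d) :- (e :* p :+ d) := e :* (q :- p)) ≈-refl (exp ε) (Pr (M S′) T)
          (exp ε * Pr (M S″) T + δ) δ))

  -- Since e ≤ 2, two exchanged rows give γ ≤ 4τ + 3δ. Multiplied by 4ν this yields 16ντ ≥ 3 -
  -- 12/200, which is more than 2. Scaling by 100 keeps all coefficients integral.
  increment-transfer : ∀ {e ν γ τ δ} → 0# ≤ e → e ≤ fromℕ 2 → 0# ≤ ν → 0# ≤ τ → fromℕ 200 * (ν * δ) ≤ 1# →
    γ ≤ e * (e * τ + δ) + δ → fromℕ 3 ≤ fromℕ 4 * ν * γ → 1# ≤ fromℕ 8 * ν * τ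
  increment-transfer {e} {ν} {γ} {τ} {δ} 0≤e e≤2 0≤ν 0≤τ νδ≤ γ≤ 3≤ = *-cancelʳ-≤ (0<fromℕ-suc 99) (≤-by
    (0≤fromℕ 200 ⊗ (0≤ν ⊗ 0≤τ) ⊗ (Δ e≤2 ⊗ (0≤fromℕ 2 ⊕ 0≤e)) ⊕ 0≤fromℕ 200 ⊗ (0≤ν ⊗ Δ γ≤) ⊕ 0≤fromℕ 50 ⊗ Δ 3≤
      ⊕ (0≤1 ⊕ 0≤e) ⊗ Δ νδ≤ ⊕ Δ e≤2 ⊕ 0≤fromℕ 47)
    (solve 5 (λ e n g t d → con (+ 8) :* n :* t :* con (+ 100) :- con (+ 1) :* con (+ 100)
      := con (+ 200) :* (n :* t) :* ((con (+ 2) :- e) :* (con (+ 2) :+ e)) :+ con (+ 200)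
          :* (n :* (e :* (e :* t :+ d) :+ d :- g))
         :+ con (+ 50) :* (con (+ 4) :* n :* g :- con (+ 3)) :+ (con (+ 1) :+ e)
             :* (con (+ 1) :- con (+ 200) :* (n :* d))
         :+ (con (+ 2) :- e) :+ con (+ 47)) ≈-refl e ν γ τ δ))

  module Attack
    (X : FiniteSubset) (n : ℕ) (1≤n : 1 ℕ.≤ n) (t : ℕ) (t≤n : t ℕ.≤ n) {ε β δ Δ′ w W : ℝ}
    (exp-ε≤2 : exp ε ≤ fromℕ 2) (0<β : 0# < β) (β<1/8 : β * fromℕ 8 < 1#) (νδ≤ : fromℕ 200 * (fromℕ n * δ) ≤ 1#)
    (Δ<t : Δ′ < fromℕ t) (w≤W : w ≤ W) (0≤W : 0# ≤ W)
    (M : Algorithm (Fin (FiniteSubset.size X)) n) (dp : DifferentiallyPrivate ε δ M)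
        (solves : Solves1Cluster X t Δ′ w β M)
    (b : Fin (FiniteSubset.size X)) (us : List (Fin (FiniteSubset.size X)))
    (positive : ∀ {x} → x ∈ₗ us → 0# < dist (FiniteSubset.point X b) (FiniteSubset.point X x))
    (lacunary : ∀ {x y} → x ∷ y ∷ [] ⊆ us →
       (fromℕ 5 + fromℕ 2 * W) * dist (FiniteSubset.point X b) (FiniteSubset.point X x)
           ≤ dist (FiniteSubset.point X b) (FiniteSubset.point X y))
    where

    open FiniteSubset X

    ν : ℝ
    ν = fromℕ n

    0≤ν : 0# ≤ ν
    0≤ν = 0≤fromℕ n

    u θ : Fin size → ℝ
    u x = dist (point b) (point x)
    -- A row s met by the interval gives |c - b| ≤ u s + r ≤ (1 + W) * u z∗. The 2 in place of 1
    -- makes this strict, as `region-intro` demands.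
    θ x = (fromℕ 2 + W) * u x

    u-mono : ∀ {x y} → x ∷ y ∷ [] ⊆ us → u x ≤ u y
    u-mono {x} {y} τ = ≤-by (Δ (lacunary τ) ⊕ (0≤fromℕ 4 ⊕ 0≤fromℕ 2 ⊗ 0≤W) ⊗ 0≤abs (point b - point x))
      (solve 3 (λ p q W → q :- p := (q :- (con (+ 5) :+ con (+ 2) :* W) :* p) :+ (con (+ 4) :+ con (+ 2) :* W)
          :* p) ≈-refl (u x) (u y) W)

    θ-mono : ∀ {x y} → u x ≤ u y → θ x ≤ θ y
    θ-mono le = *-monoʳ-≤ (0≤fromℕ 2 ⊕ 0≤W) le

    R[_] : Fin size → Borel
    R[ x ] = region (point b) (θ x)

    -- The first element of the list is only a separator, not a row.
    db : List (Fin size) → Database X n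
    db zs = pad n b (drop 1 zs)

    profile : List (Fin size) → Fin size → ℝ
    profile zs x = Pr (M (db zs)) R[ x ]

    module _ {z rest} (sub : z ∷ rest ⊆ us) (|rest| : length rest ≡ n) where

      z∗ : Fin size
      z∗ = final z rest

      u≤u∗ : ∀ {y} → y ∈ₗ z ∷ rest → u y ≤ u z∗
      u≤u∗ = final-maximal u z rest (λ τ → u-mono (⊆-trans τ sub))

      -- The ball around `b`, which is itself a point of the domain, contains all n rows, and t ≤ n.
      feasible : IsFeasibleRadius X (db (z ∷ rest)) t (u z∗)
      feasible = 0≤abs _ , b , ⊤ , fromℕ-mono (ℕP.≤-trans t≤n (ℕP.≤-reflexive (≡.sym (SubsetP.∣⊤∣≡n n)))) ,
        λ i _ → ≤-respˡ (dist-sym _ _) (u≤u∗ (there (lookup-pad-∈ b rest |rest| i)))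

      output-between : ∀ {c r} → BallContains X (db (z ∷ rest)) c r (fromℕ t - Δ′) × r ≤ w * r-opt X (db (z ∷ rest)) t →
        ⟦ R[ z∗ ] ∖ R[ z ] ⟧ (c , r)
      output-between {c} {r} (ball , r≤) =
        let i , s-near        = ball-nonempty X {S = db (z ∷ rest)} {c = c} (Δ< Δ<t) ball
            s                 = Vec.lookup (db (z ∷ rest)) i
            s∈                = lookup-pad-∈ b rest |rest| i
            0≤ropt , ropt≤    = r-opt-bounds X (db (z ∷ rest)) t feasible
            us≤u∗             = u≤u∗ (there s∈)
            0<u∗              = positive (lookup sub (final-∈ z rest))
            r≤Wu∗ : r ≤ W * u z∗
            r≤Wu∗ = ≤-trans r≤ (≤-by (Δ w≤W ⊗ 0≤ropt ⊕ 0≤W ⊗ Δ ropt≤)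
              (solve 4 (λ w W p q → W :* q :- w :* p := (W :- w) :* p :+ W :* (q :- p))
                  ≈-refl w W (r-opt X (db (z ∷ rest)) t) (u z∗)))
            c-near : dist (point b) c < θ z∗
            c-near = ≤-<-trans (dist-triangle (point b) (point s) c) (<-by (0<u∗ ⊕< Δ us≤u∗ ⊕< Δ s-near ⊕< Δ r≤Wu∗)
              (solve 5 (λ p q a r W → (con (+ 2) :+ W) :* q :- (p :+ a) := q :+ (q :- p) :+ (r :- a)
                  :+ (W :* q :- r)) ≈-refl
                (u s) (u z∗) (dist (point s) c) r W))
            r≤θ : r ≤ θ z∗
            r≤θ = ≤-by (Δ r≤Wu∗ ⊕ 0≤fromℕ 2 ⊗ <⇒≤ 0<u∗) (solve 3
                (λ W q r → (con (+ 2) :+ W) :* q :- r := (W :* q :- r) :+ con (+ 2) :* q) ≈-refl W (u z∗) r)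
        in ∖-intro {R[ z∗ ]} {R[ z ]} (region-intro c-near r≤θ) λ y∈ →
             -- Inside the smaller region the row s would satisfy u s ≤ |c - b| + r + r - r with
             -- both |c - b| and r at most θ z, that is u s ≤ (4 + 2W) * u z. The lacunarity factor
             -- 5 + 2W exceeds this by one positive u z.
             <⇒≱ (<-by (positive (lookup sub (here ≡.refl)) ⊕< Δ (region-dist y∈) ⊕< Δ (proj₂ (region-elim y∈))
                 ⊕< Δ s-near
                 ⊕< Δ (≤-respʳ (+-congˡ (dist-sym c (point s))) (dist-triangle (point b) c (point s))))
               (solve 6 (λ p q a e r W → (con (+ 5) :+ con (+ 2) :* W) :* p :- q
                 := p :+ ((con (+ 2) :+ W) :* p :- e) :+ ((con (+ 2) :+ W) :* p :- r) :+ (r :- a) :+ (e :+ a :- q))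
                     ≈-refl
                 (u z) (u s) (dist (point s) c) (dist (point b) c) r W))
             (lacunary (⊆-trans (≡.refl ∷ from∈ s∈) sub))

      profile-increase : 1# - β ≤ profile (z ∷ rest) z∗ - profile (z ∷ rest) z
      profile-increase =
        let A , A⊆ , Pr-A = solves (db (z ∷ rest))
            open Measure (M (db (z ∷ rest)))
        in ≤-respʳ (Pr-∖ {R[ z∗ ]} {R[ z ]} (region-mono (θ-mono (u≤u∗ (here ≡.refl)))))
             (≤-trans Pr-A (Pr-mono {R[ z∗ ] ∖ R[ z ]} {A} (λ y∈A → output-between (A⊆ y∈A))))

      -- The n increments add up to at least 1 - β, which exceeds 3/4, so they cannot all be at most
      -- 3/(4n).
      large-gap : ∃[ a ] a ℕ.< n × fromℕ 3 ≤ fromℕ 4 * ν * gap (profile (z ∷ rest)) (z ∷ rest) a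
      large-gap with em {∃[ a ] a ℕ.< n × fromℕ 3 ≤ fromℕ 4 * ν * gap (profile (z ∷ rest)) (z ∷ rest) a}
      ... | yes found = found
      ... | no  none  = contradiction
            (*-monoʳ-≤ (0≤fromℕ 4) (≤-trans profile-increase (gaps-telescope (profile (z ∷ rest)) {g} z rest small)))
            (<⇒≱ (≤-<-trans (≤-reflexive 4νg≈3) (<-by (Δ< β<1/8 ⊕< 0≤fromℕ 4 ⊗ <⇒≤ 0<β)
              (solve 1 (λ β → con (+ 4) :* (con (+ 1) :- β) :- con (+ 3) := (con (+ 1) :- β :* con (+ 8))
                  :+ con (+ 4) :* β) ≈-refl β))))
        where
        0<4ν : 0# < fromℕ 4 * ν
        0<4ν = 0<fromℕ-suc 3 ⊗< 0<fromℕ 1≤n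

        g : ℝ
        g = fromℕ 3 / (fromℕ 4 * ν)

        4νg≈3 : fromℕ 4 * (fromℕ (length rest) * g) ≈ fromℕ 3
        4νg≈3 = ≈-trans (*-congˡ (*-congʳ (≈-reflexive (≡.cong fromℕ |rest|))))
          (≈-trans (solve 3 (λ f n g → f :* (n :* g) := g :* (f :* n)) ≈-refl (fromℕ 4) ν g) (/-* (fromℕ 3) 0<4ν))

        small : ∀ a → a ℕ.< length rest → gap (profile (z ∷ rest)) (z ∷ rest) a ≤ g
        small a a< = ≤-/ 0<4ν (≤-respˡ (*-comm _ _) (≰⇒≥ λ 3≤ → none (a , ≡.subst (a ℕ.<_) |rest| a< , 3≤)))

    Good : Fin n → List (Fin size) → Set
    Good a zs = fromℕ 3 ≤ fromℕ 4 * ν * gap (profile zs) zs (toℕ a)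

    colourᵈ : ∀ {zs} → Dec (∃[ a ] Good a zs) → Fin n
    colourᵈ (yes (a , _)) = a
    colourᵈ (no _)        = fromℕ< 1≤n

    -- A position of a large increment, chosen by excluded middle. Lists without one get the default
    -- position 0, a case that `colour-good` excludes for lists of n + 1 elements of `us`.
    colour : List (Fin size) → Fin n
    colour zs = colourᵈ {zs} em

    colour-good : ∀ {zs} → zs ⊆ us → length zs ≡ suc n → Good (colour zs) zs
    colour-good {z ∷ rest} sub |zs| = good em
      where
      good : (d : Dec (∃[ a ] Good a (z ∷ rest))) → Good (colourᵈ {z ∷ rest} d) (z ∷ rest)
      good (yes (_ , good-a)) = good-a
      good (no none) = let a , a<n , large = large-gap sub (ℕP.suc-injective |zs|) in
        contradiction (fromℕ< a<n ,
          ≡.subst (λ k → fromℕ 3 ≤ fromℕ 4 * ν * gap (profile (z ∷ rest)) (z ∷ rest) k)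
              (≡.sym (FinP.toℕ-fromℕ< a<n)) large) none

    -- Between the prefix and the suffix the pair x ∷ y ∷ [] varies.  Changing it
    -- affects at most two rows, so one reference database has an increment of
    -- order 1/n between any two elements of the middle part.
    module _ {qs pre mid suf} (qs⊆ : qs ⊆ us) (a : Fin n) (good : ∀ zs → zs ⊆ qs → length zs ≡ suc n → Good a zs)
      (embed : pre ++ mid ++ suf ⊆ qs) (|pre| : length pre ≡ toℕ a) (|suf| : toℕ a ℕ.+ suc (length suf) ≡ n)
      (w v : Fin size) where

      rows : Fin size → Fin size → List (Fin size)
      rows x y = pre ++ x ∷ y ∷ suf

      ψ : Fin size → ℝ
      ψ = profile (rows w v)

      near-reference : ∀ x y → Neighboring (db (rows x y)) (db (rows x v)) × Neighboring (db (rows x v)) (db (rows w v))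
      near-reference x y =
        ≡.subst₂ (λ s s′ → Neighboring (db s) (db s′)) (ListP.++-assoc pre (x ∷ []) (y ∷ suf))
            (ListP.++-assoc pre (x ∷ []) (v ∷ suf))
          (neighboring-tail n b (pre ++ x ∷ []) y v suf) ,
        neighboring-tail n b pre x w (v ∷ suf)

      -- The increment at position a of the list `rows x y` is the probability of `R[ y ] ∖ R[ x ]`.
      -- This event makes sense for every database, so privacy carries its probability over to the
      -- reference database, where it is ψ y - ψ x.
      increment : ∀ {x y} → x ∷ y ∷ [] ⊆ mid → 1# ≤ fromℕ 8 * ν * (ψ y - ψ x)
      increment {x} {y} xy⊆ =
        let rows⊆ : rows x y ⊆ qs
            rows⊆ = ⊆-trans (++⁺ (⊆-refl {x = pre}) (++⁺ xy⊆ (⊆-refl {x = suf}))) embed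
            xy⊆us = ⊆-trans xy⊆ (⊆-trans (⊆-trans (mid⊆ pre) embed) qs⊆)
            R⊆R   = λ {z} → region-mono (θ-mono (u-mono xy⊆us)) {z}
            module μ = Measure (M (db (rows x y)))
            module μ∗ = Measure (M (db (rows w v)))
            near , near′ = near-reference x y
            γ≤ : profile (rows x y) y - profile (rows x y) x ≤ exp ε * (exp ε * (ψ y - ψ x) + δ) + δ
            γ≤ = ≤-respˡ (μ.Pr-∖ {R[ y ]} {R[ x ]} R⊆R) (≤-respʳ
                (+-congʳ (*-congˡ (+-congʳ (*-congˡ (μ∗.Pr-∖ {R[ y ]} {R[ x ]} R⊆R)))))
                   (dp-twice {M = M} dp {db (rows x y)} {db (rows x v)} {db (rows w v)} near near′ (R[ y ] ∖ R[ x ])))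
        in increment-transfer (<⇒≤ (0<exp ε)) exp-ε≤2 0≤ν (Δ (μ∗.Pr-mono {R[ y ]} {R[ x ]} R⊆R)) νδ≤ γ≤
             (≤-respʳ (*-congˡ (≈-reflexive (≡.trans (≡.cong (gap (profile (rows x y)) (rows x y)) (≡.sym |pre|))
                 (gap-++ (profile (rows x y)) pre))))
               (good (rows x y) rows⊆ (|rows| x y)))
        where
        mid⊆ : ∀ pre → mid ⊆ pre ++ mid ++ suf
        mid⊆ []      = ≡.subst (_⊆ mid ++ suf) (ListP.++-identityʳ mid) (++⁺ (⊆-refl {x = mid}) (minimum suf))
        mid⊆ (z ∷ p) = z ∷ʳ mid⊆ p

        |rows| : ∀ x y → length (rows x y) ≡ suc n
        |rows| x y = ≡.trans (ListP.length-++ pre) (≡.trans (≡.cong (ℕ._+ (2 ℕ.+ length suf)) |pre|)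
          (≡.trans (ℕP.+-suc (toℕ a) (suc (length suf))) (≡.cong suc |suf|)))

      advance : ∀ x xs → x ∷ xs ⊆ mid → fromℕ (length xs) ≤ fromℕ 8 * ν * (ψ (final x xs) - ψ x)
      advance x []       _ = ≤-reflexive (solve 2 (λ n p → con (+ 0) := n :* (p :- p)) ≈-refl (fromℕ 8 * ν) (ψ x))
      advance x (y ∷ xs) τ = ≤-by (Δ (increment (⊆-trans (≡.refl ∷ ≡.refl ∷ minimum xs) τ)) ⊕ Δ (advance y xs (∷ˡ⁻ τ)))
        (solve 5 (λ n p q r l → n :* (r :- p) :- (con (+ 1) :+ l) := (n :* (q :- p) :- con (+ 1))
            :+ (n :* (r :- q) :- l)) ≈-refl
          (fromℕ 8 * ν) (ψ x) (ψ y) (ψ (final y xs)) (fromℕ (length xs)))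

      mid-short : ∀ x xs → x ∷ xs ⊆ mid → length xs ℕ.≤ 8 ℕ.* n
      mid-short x xs τ with length xs ℕP.≤? 8 ℕ.* n
      ... | yes short = short
      ... | no  long  = contradiction (advance x xs τ) (<⇒≱ (<-by
            (0<1 ⊕< Δ (fromℕ-mono (ℕP.≰⇒> long)) ⊕< (0≤fromℕ 8 ⊗ 0≤ν)
                ⊗ (Δ (Measure.Pr≤1 (M (db (rows w v))) R[ final x xs ]) ⊕ Pr-nonNeg (M (db (rows w v))) R[ x ]))
            (≈-trans (solve 4 (λ l m p q → l :- m :* (q :- p) := con (+ 1) :+ (l :- (con (+ 1) :+ m))
                :+ m :* (con (+ 1) :- q :+ p)) ≈-refl
                (fromℕ (length xs)) (fromℕ 8 * ν) (ψ x) (ψ (final x xs)))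
              (+-congʳ (+-congˡ (+-congˡ (-‿cong (+-congˡ (≈-sym (fromℕ-* 8 n))))))))))

    no-homogeneous : ∀ qs (a : Fin n) → qs ⊆ us → (∀ zs → zs ⊆ qs → length zs ≡ suc n → Good a zs) →
      ¬ n ℕ.+ (2 ℕ.+ 8 ℕ.* n ℕ.+ n) ℕ.≤ length qs
    no-homogeneous qs a qs⊆ good room =
      -- A prefix of a elements, two varying entries and a suffix of n - 1 - a elements make n + 1.
      -- The 8n + 2 elements of the middle part allow 8n + 1 steps, one too many; its first two
      -- elements also serve as the reference pair.
      let pre , qs₁ , qs≡ , |pre| , room₁  = chop (toℕ a) (2 ℕ.+ 8 ℕ.* n ℕ.+ n) qs
            (ℕP.≤-trans (ℕP.+-monoˡ-≤ _ (ℕP.<⇒≤ (FinP.toℕ<n a))) room)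
          mid , qs₂ , qs₁≡ , |mid| , room₂ = chop (2 ℕ.+ 8 ℕ.* n) n qs₁ room₁
          suf , qs₃ , qs₂≡ , |suf| , _     = chop (n ℕ.∸ suc (toℕ a)) 0 qs₂
            (ℕP.≤-trans (ℕP.≤-reflexive (ℕP.+-identityʳ _)) (ℕP.≤-trans (ℕP.m∸n≤m n (suc (toℕ a))) room₂))
          embed : pre ++ mid ++ suf ⊆ qs
          embed = ≡.subst (pre ++ mid ++ suf ⊆_) qs≡ (++⁺ (⊆-refl {x = pre})
            (≡.subst (mid ++ suf ⊆_) qs₁≡ (++⁺ (⊆-refl {x = mid}) (≡.subst (suf ⊆_) qs₂≡ (prefix suf qs₃)))))
          |a+suf| = ≡.trans (≡.cong (λ k → toℕ a ℕ.+ suc k) |suf|)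
              (≡.trans (ℕP.+-suc (toℕ a) _) (ℕP.m+[n∸m]≡n (FinP.toℕ<n a)))
      in too-long mid |mid| λ w v rest τ →
           mid-short {pre = pre} {mid} {suf} qs⊆ a good embed |pre| |a+suf| w v w (v ∷ rest) τ
      where
      prefix : ∀ (p s : List (Fin size)) → p ⊆ p ++ s
      prefix p s = ≡.subst (_⊆ p ++ s) (ListP.++-identityʳ p) (++⁺ (⊆-refl {x = p}) (minimum s))

      too-long : ∀ (mid : List (Fin size)) → length mid ≡ 2 ℕ.+ 8 ℕ.* n →
        ¬ (∀ w v rest → w ∷ v ∷ rest ⊆ mid → suc (length rest) ℕ.≤ 8 ℕ.* n)
      too-long (w ∷ v ∷ rest) |mid| short = ℕP.<⇒≱ (ℕP.≤-reflexive (≡.sym (ℕP.suc-injective |mid|)))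
          (short w v rest ⊆-refl)

    us-short : ∀ h → 2 ℕ.≤ h → n ℕ.+ (2 ℕ.+ 8 ℕ.* n ℕ.+ n) ℕ.≤ tower h → ¬ tower (suc n ℕ.* 3 ℕ.+ h) ℕ.≤ length us
    us-short h 2≤h room large =
      let qs , qs⊆ , |qs| , homogeneous = ramsey {{ℕ.>-nonZero 1≤n}} (suc n)
              h colour us (ℕP.≤-trans (ℕP.m≤m+n n _) room) 2≤h large
          room′    = ℕP.≤-trans room (ℕP.≤-reflexive (≡.sym |qs|))
          sample   = take (suc n) qs
          |sample| = ≡.trans (ListP.length-take (suc n) qs) (ℕP.m≤n⇒m⊓n≡m (ℕP.≤-trans
                       (ℕP.≤-trans (ℕP.≤-reflexive (ℕP.+-comm 1 n)) (ℕP.+-monoʳ-≤ n (ℕ.s≤s ℕ.z≤n))) room′))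
      in no-homogeneous qs (colour sample) qs⊆ (λ zs zs⊆ |zs| →
           ≡.subst (λ a → Good a zs) (homogeneous {zs} {sample} zs⊆ (take-⊆ (suc n) qs) |zs| |sample|)
             (colour-good {zs} (⊆-trans zs⊆ qs⊆) |zs|)) room′

  -- From the attack to the bound on the domain

  -- A successful output needs a ball with at least t - Δ′ > 0 rows. Without rows there is none, so
  -- the success event is empty although its probability is at least 1 - β > 0.
  no-algorithm-without-rows : ∀ X {t Δ′ w β} {M : Algorithm (Fin (FiniteSubset.size X)) 0} →
    t ℕ.≤ 0 → Δ′ < fromℕ t → β < 1# → ¬ Solves1Cluster X t Δ′ w β M
  no-algorithm-without-rows X {t} {Δ′} {w} {β} {M} t≤0 Δ<t β<1 solves =
    let A , A⊆ , Pr-A = solves Vec.[] in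
    <⇒≱ (Δ< β<1) (≤-trans Pr-A (≤-reflexive (Measure.Pr-empty (M Vec.[]) A λ (c , r) y∈A →
      no-row (ball-nonempty X {S = Vec.[]} {c = c} (Δ< Δ<t) (proj₁ (A⊆ y∈A))))))
    where
    no-row : ∀ {P : Fin 0 → Set} → ¬ ∃ P
    no-row (() , _)

  AllPairs-pair : ∀ {A : Set} {_~_ : A → A → Set} {xs x y} → AllPairs _~_ xs → x ∷ y ∷ [] ⊆ xs → x ~ y
  AllPairs-pair (_ ∷ rest)    (_ ∷ʳ τ)      = AllPairs-pair rest τ
  AllPairs-pair (related ∷ _) (≡.refl ∷ τ) = All.lookup related (lookup τ (here ≡.refl))

  dist-positive : ∀ {x y} → ¬ x ≈ y → 0# < dist x y
  dist-positive {x} {y} x≉y = ≰⇒> λ d≤0 → x≉y (≤-antisym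
    (≤-by (Δ (≤-trans (x≤abs (x - y)) d≤0)) (solve 2 (λ x y → y :- x := con (+ 0) :- (x :- y)) ≈-refl x y))
    (≤-by (Δ (≤-trans (-x≤abs (x - y)) d≤0)) (solve 2 (λ x y → x :- y := con (+ 0) :- :- (x :- y)) ≈-refl x y)))

  2*tower≤tower-suc : ∀ n → 2 ℕ.* tower n ℕ.≤ tower (suc n)
  2*tower≤tower-suc n = double (ℕP.≤-trans (ℕ.s≤s ℕ.z≤n) (n<tower n))
    where
    double : ∀ {x} → 1 ℕ.≤ x → 2 ℕ.* x ℕ.≤ 2 ℕ.^ x
    double {suc x} _ = ℕP.*-monoʳ-≤ 2 (n<2^n x)

  -- `Growing` compares d b x with d x y. Passing to the distance of y from `b` by the triangle
  -- inequality costs 1 and leaves the factor 5 + 2W required by `Attack`.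
  growth-factor : ℕ → ℕ
  growth-factor n = 6 ℕ.+ 2 ℕ.* tower n

  -- The factor is at most 8 * `tower n`, which three further levels absorb. The cube triples an
  -- exponent and fits into one more level, and adding 3 into another.
  growth-factor^3 : ∀ n → growth-factor n ℕ.^ 3 ℕ.+ 3 ℕ.< tower (5 ℕ.+ n)
  growth-factor^3 n = begin-strict
    growth-factor n ℕ.^ 3 ℕ.+ 3        ≤⟨ ℕP.+-monoˡ-≤ 3 (ℕP.^-monoˡ-≤ 3 factor≤) ⟩
    tower (3 ℕ.+ n) ℕ.^ 3 ℕ.+ 3        ≡⟨ ≡.cong (ℕ._+ 3) (ℕP.^-*-assoc 2 (tower (2 ℕ.+ n)) 3) ⟩
    2 ℕ.^ (tower (2 ℕ.+ n) ℕ.* 3) ℕ.+ 3 ≤⟨ ℕP.+-monoˡ-≤ 3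
        (ℕP.^-monoʳ-≤ 2 (ℕP.≤-trans (ℕP.≤-reflexive (ℕP.*-comm (tower (2 ℕ.+ n)) 3))
            (3*n≤2^n (tower-mono-≤ (ℕP.m≤m+n 2 n))))) ⟩
    tower (4 ℕ.+ n) ℕ.+ 3              <⟨ ℕP.+-monoʳ-< (tower (4 ℕ.+ n))
        (ℕP.<-≤-trans (ℕP.m≤m+n 4 n) (ℕP.<⇒≤ (n<tower (4 ℕ.+ n)))) ⟩
    tower (4 ℕ.+ n) ℕ.+ tower (4 ℕ.+ n) ≡⟨ ≡.cong (tower (4 ℕ.+ n) ℕ.+_) (ℕP.+-identityʳ _) ⟨
    2 ℕ.* tower (4 ℕ.+ n)              ≤⟨ 2*tower≤tower-suc (4 ℕ.+ n) ⟩
    tower (5 ℕ.+ n)                    ∎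
    where
    open ℕP.≤-Reasoning
    factor≤ : growth-factor n ℕ.≤ tower (3 ℕ.+ n)
    factor≤ = begin
      6 ℕ.+ 2 ℕ.* tower n              ≤⟨ ℕP.+-monoˡ-≤ (2 ℕ.* tower n)
          (ℕP.*-monoʳ-≤ 6 (ℕP.≤-trans (ℕ.s≤s ℕ.z≤n) (n<tower n))) ⟩
      6 ℕ.* tower n ℕ.+ 2 ℕ.* tower n  ≡⟨ ℕP.*-distribʳ-+ (tower n) 6 2 ⟨
      8 ℕ.* tower n                    ≡⟨ ℕP.*-assoc 4 2 (tower n) ⟩
      4 ℕ.* (2 ℕ.* tower n)            ≤⟨ ℕP.*-monoʳ-≤ 4 (2*tower≤tower-suc n) ⟩
      4 ℕ.* tower (1 ℕ.+ n)            ≡⟨ ℕP.*-assoc 2 2 (tower (1 ℕ.+ n)) ⟩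
      2 ℕ.* (2 ℕ.* tower (1 ℕ.+ n))    ≤⟨ ℕP.*-monoʳ-≤ 2 (2*tower≤tower-suc (1 ℕ.+ n)) ⟩
      2 ℕ.* tower (2 ℕ.+ n)            ≤⟨ 2*tower≤tower-suc (2 ℕ.+ n) ⟩
      tower (3 ℕ.+ n)                  ∎

  16*n≤tower : ∀ n → 16 ℕ.* suc n ℕ.≤ tower (4 ℕ.+ n)
  16*n≤tower n = ℕP.≤-trans (ℕP.*-monoʳ-≤ 16 (n<tower n)) (doublings 4)
    where
    doublings : ∀ k → 2 ℕ.^ k ℕ.* tower n ℕ.≤ tower (k ℕ.+ n)
    doublings zero    = ℕP.≤-reflexive (ℕP.+-identityʳ _)
    doublings (suc k) = ℕP.≤-trans (ℕP.≤-reflexive (ℕP.*-assoc 2 (2 ℕ.^ k) (tower n)))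
      (ℕP.≤-trans (ℕP.*-monoʳ-≤ 2 (doublings k)) (2*tower≤tower-suc (k ℕ.+ n)))

  10n+2≤tower : ∀ n → n ℕ.+ (2 ℕ.+ 8 ℕ.* n ℕ.+ n) ℕ.≤ tower (4 ℕ.+ n)
  10n+2≤tower n = ℕP.≤-trans (ℕP.≤-trans (ℕP.m≤m+n _ (14 ℕ.+ 6 ℕ.* n)) (ℕP.≤-reflexive (identity n))) (16*n≤tower n)
    where
    identity : ∀ n → n ℕ.+ (2 ℕ.+ 8 ℕ.* n ℕ.+ n) ℕ.+ (14 ℕ.+ 6 ℕ.* n) ≡ 16 ℕ.* suc n
    identity = ℕSolver.solve-∀

  size-bound : ∀ X n t {ε β δ Δ′ w} → 1 ℕ.≤ n → t ℕ.≤ n → exp ε ≤ fromℕ 2 → 0# < β → β * fromℕ 8 < 1# →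
    fromℕ 200 * (fromℕ n * δ) ≤ 1# → Δ′ < fromℕ t → w ≤ fromℕ (tower n) →
    (M : Algorithm (Fin (FiniteSubset.size X)) n) → DifferentiallyPrivate ε δ M → Solves1Cluster X t Δ′ w β M →
    FiniteSubset.size X ℕ.≤ tower (36 ℕ.* n)
  size-bound X n t 1≤n t≤n exp-ε≤2 0<β β<1/8 νδ≤ Δ<t w≤W M dp solves with FiniteSubset.size X ℕP.≤? tower (36 ℕ.* n)
  ... | yes small = small
  ... | no  large = contradiction
    (lacunary-sublist h₁ (allFin size) (ℕ.s≤s (ℕ.s≤s ℕ.z≤n))
      (ℕP.<-≤-trans (growth-factor^3 n) (tower-mono-≤ 5+n≤h₁))
      (ℕP.≤-trans (tower-mono-≤ 24+h₁≤36n) (ℕP.≤-trans (ℕP.<⇒≤ (ℕP.≰⇒> large))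
          (ℕP.≤-reflexive (≡.sym (ListP.length-tabulate (λ i → i)))))))
    no-lacunary
    where
    open FiniteSubset X
    open Lacunary point (growth-factor n)

    h h₁ : ℕ
    h  = 4 ℕ.+ n
    -- The outer successor pays for the base point: without its head, a list of length at least
    -- tower (suc m) still has at least tower m elements.
    h₁ = suc (suc n ℕ.* 3 ℕ.+ h)

    5+n≤h₁ : 5 ℕ.+ n ℕ.≤ h₁
    5+n≤h₁ = ℕ.s≤s (ℕP.m≤n+m h (suc n ℕ.* 3))

    -- The levels are 24 for the lacunary sublist, 1 for the base point, 3(n + 1) for lists of n + 1
    -- elements and n + 4 for the final room. They add up to 4n + 32, and n ≥ 1.
    24+h₁≤36n : 24 ℕ.+ h₁ ℕ.≤ 36 ℕ.* n
    24+h₁≤36n = ℕP.≤-trans (ℕP.≤-reflexive (identity n)) (ℕP.≤-trans (ℕP.+-monoˡ-≤ (4 ℕ.* n) (ℕP.*-monoʳ-≤ 32 1≤n))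
      (ℕP.≤-reflexive (≡.sym (ℕP.*-distribʳ-+ n 32 4))))
      where
      identity : ∀ n → 24 ℕ.+ suc (suc n ℕ.* 3 ℕ.+ (4 ℕ.+ n)) ≡ 32 ℕ.* 1 ℕ.+ 4 ℕ.* n
      identity = ℕSolver.solve-∀

    W : ℝ
    W = fromℕ (tower n)

    distinct : ∀ {x y ys} → ys ⊆ allFin size ⊎ reverse ys ⊆ allFin size → x ∷ y ∷ [] ⊆ ys → ¬ x ≡ y
    distinct (inj₁ ys⊆) τ x≡y = AllPairs-pair (allFin⁺ size) (⊆-trans τ ys⊆) x≡y
    distinct (inj₂ ys⊆) τ x≡y = AllPairs-pair (allFin⁺ size) (⊆-trans (reverse⁺ τ) ys⊆) (≡.sym x≡y)

    no-lacunary : ¬ (∃[ ys ] (ys ⊆ allFin size ⊎ reverse ys ⊆ allFin size) × tower h₁ ℕ.≤ length ys × Growing ys)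
    no-lacunary ([]     , _   , long , _)    = ℕP.<⇒≱ (ℕP.≤-<-trans ℕ.z≤n (n<tower h₁)) long
    no-lacunary (b ∷ us , ys⊆ , long , grow) = Attack.us-short X n 1≤n t t≤n exp-ε≤2 0<β β<1/8 νδ≤ Δ<t w≤W
        (0≤fromℕ (tower n)) M dp solves b us
      (λ x∈ → dist-positive λ eq → distinct ys⊆ (≡.refl ∷ from∈ x∈) (point-injective eq)) lacunary
      h (ℕ.s≤s (ℕ.s≤s ℕ.z≤n)) (10n+2≤tower n) (ℕ.s≤s⁻¹ (ℕP.≤-trans (n<2^n (tower (suc n ℕ.* 3 ℕ.+ h))) long))
      where
      lacunary : ∀ {x y} → x ∷ y ∷ [] ⊆ us → (fromℕ 5 + fromℕ 2 * W) * dist (point b) (point x) ≤ dist (point b)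
          (point y)
      lacunary {x} {y} τ = ≤-by (Δ (grow (≡.refl ∷ τ)) ⊕ Δ
          (≤-respʳ (+-congʳ (dist-sym (point x) (point b))) (dist-triangle (point x) (point b) (point y))))
        (≈-trans (solve 4 (λ W p q a → q :- (con (+ 5) :+ con (+ 2) :* W)
            :* p := (a :- (con (+ 6) :+ con (+ 2) :* W) :* p) :+ (p :+ q :- a)) ≈-refl
            W (dist (point b) (point x)) (dist (point b) (point y)) (dist (point x) (point y)))
          (+-congʳ (+-congˡ (-‿cong (*-congʳ (≈-sym (≈-trans (fromℕ-+ 6 (2 ℕ.* tower n))
              (+-congˡ (fromℕ-* 2 (tower n))))))))))

  <1/⇒*<1 : ∀ {x y} → 0# < y → x < 1# / y → x * y < 1#
  <1/⇒*<1 {x} {y} 0<y x< = <-≤-trans (<-by (Δ< x< ⊗< 0<y)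
      (solve 3 (λ x y q → q :* y :- x :* y := (q :- x) :* y) ≈-refl x y (1# / y)))
    (≤-reflexive (/-* 1# 0<y))

  ≤1/⇒*≤1 : ∀ {x y} → 0# < y → x ≤ 1# / y → x * y ≤ 1#
  ≤1/⇒*≤1 {x} {y} 0<y x≤ = ≤-trans (≤-by (Δ x≤ ⊗ <⇒≤ 0<y)
      (solve 3 (λ x y q → q :* y :- x :* y := (q :- x) :* y) ≈-refl x y (1# / y)))
    (≤-reflexive (/-* 1# 0<y))

  exp-ε≤2 : ∀ {ε} → 0# < ε → ε * fromℕ 8 < 1# → exp ε ≤ fromℕ 2
  exp-ε≤2 {ε} 0<ε 8ε<1 = ≤-trans (exp≤ (<⇒≤ 0<ε) ε<1) (/-≤ (Δ< ε<1)
    (≤-by (Δ (<⇒≤ 8ε<1) ⊕ 0≤fromℕ 6 ⊗ <⇒≤ 0<ε)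
      (solve 1 (λ e → con (+ 2) :* (con (+ 1) :- e) :- con (+ 1) := (con (+ 1) :- e :* con (+ 8)) :+ con (+ 6)
          :* e) ≈-refl ε)))
    where
    ε<1 : ε < 1#
    ε<1 = <-by (Δ< 8ε<1 ⊕< 0≤fromℕ 7 ⊗ <⇒≤ 0<ε)
      (solve 1 (λ e → con (+ 1) :- e := (con (+ 1) :- e :* con (+ 8)) :+ con (+ 7) :* e) ≈-refl ε)

  -- A negative δ makes the product nonpositive; for the others n ≤ n² reduces the claim to the
  -- assumed bound. The sign matters because multiplying by δ has to preserve the inequality.
  200nδ≤1 : ∀ {n δ} → 1 ℕ.≤ n → δ ≤ 1# / fromℕ (200 ℕ.* n ℕ.^ 2) → fromℕ 200 * (fromℕ n * δ) ≤ 1#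
  200nδ≤1 {n} {δ} 1≤n δ≤ with ≤-total 0# δ
  ... | inj₂ δ≤0 = ≤-trans (≤-by (0≤fromℕ 200 ⊗ (0≤fromℕ n ⊗ 0≤-x δ≤0))
          (solve 3 (λ c n d → con (+ 0) :- c :* (n :* d) := c :* (n :* (:- d))) ≈-refl (fromℕ 200) (fromℕ n) δ)) 0≤1
  ... | inj₁ 0≤δ = ≤-trans (≤-by (0≤fromℕ 200 ⊗ (0≤fromℕ n ⊗ 0≤δ) ⊗ Δ 1≤ν)
          (≈-trans (+-congʳ (*-congˡ square)) (solve 3 (λ c n d →
              d :* (c :* (n :* n)) :- c :* (n :* d) := c :* (n :* d) :* (n :- con (+ 1))) ≈-refl (fromℕ 200)
                  (fromℕ n) δ)))
        (≤1/⇒*≤1 (0<fromℕ (ℕP.*-mono-≤ {1} {200} (ℕ.s≤s ℕ.z≤n) (ℕP.^-monoˡ-≤ 2 1≤n))) δ≤)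
    where
    1≤ν : 1# ≤ fromℕ n
    1≤ν = ≤-trans (≤-reflexive (≈-sym (+-identityʳ 1#))) (fromℕ-mono 1≤n)

    square : fromℕ (200 ℕ.* n ℕ.^ 2) ≈ fromℕ 200 * (fromℕ n * fromℕ n)
    square = ≈-trans (fromℕ-* 200 (n ℕ.^ 2)) (*-congˡ (≈-trans (fromℕ-* n (n ℕ.^ 1)) (*-congˡ (≈-trans (fromℕ-* n 1)
      (≈-trans (*-congˡ (+-identityʳ 1#)) (*-identityʳ (fromℕ n)))))))

  log*-size-≤ : ∀ X n t (M : Algorithm (Fin (FiniteSubset.size X)) n) {ε β δ Δ′ w} →
    0# < ε → ε < 1# / fromℕ 8 → 0# < β → β < 1# / fromℕ 8 → (.{{NonZero n}} → δ ≤ 1# / fromℕ (200 ℕ.* n ℕ.^ 2)) →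
    Δ′ < fromℕ t → t ℕ.≤ n → w ≤ (1# / fromℕ 4) * towerℝ (log₂ (fifthRoot (fromℕ n) / fromℕ 40)) →
    DifferentiallyPrivate ε δ M → Solves1Cluster X t Δ′ w β M →
    (1# / fromℕ 36) * log* (fromℕ (FiniteSubset.size X)) ≤ fromℕ n
  log*-size-≤ X zero t M {β = β} 0<ε ε<1/8 0<β β<1/8 δ≤ Δ<t t≤n w≤ dp solves =
    contradiction solves (no-algorithm-without-rows X {M = M} t≤n Δ<t
      (<-by (Δ< (<1/⇒*<1 (0<fromℕ-suc 7) β<1/8) ⊕< 0≤fromℕ 7 ⊗ <⇒≤ 0<β)
        (solve 1 (λ e → con (+ 1) :- e := (con (+ 1) :- e :* con (+ 8)) :+ con (+ 7) :* e) ≈-refl β)))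
  log*-size-≤ X n@(suc _) t M {w = w} 0<ε ε<1/8 0<β β<1/8 δ≤ Δ<t t≤n w≤ dp solves = begin
    (1# / fromℕ 36) * log* (fromℕ (FiniteSubset.size X))
      ≤⟨ *-monoʳ-≤ (<⇒≤ (0</ 0<1 (0<fromℕ-suc 35))) (log*-≤ (36 ℕ.* n) (fromℕ-mono size≤)) ⟩
    (1# / fromℕ 36) * fromℕ (36 ℕ.* n)      ≈⟨ *-congˡ (fromℕ-* 36 n) ⟩
    (1# / fromℕ 36) * (fromℕ 36 * fromℕ n)  ≈⟨ *-assoc _ _ _ ⟨
    (1# / fromℕ 36) * fromℕ 36 * fromℕ n    ≈⟨ *-congʳ (/-* 1# (0<fromℕ-suc 35)) ⟩
    1# * fromℕ n                            ≈⟨ *-identityˡ (fromℕ n) ⟩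
    fromℕ n                                 ∎
    where
    open ≤-Reasoning
    1≤n : 1 ℕ.≤ n
    1≤n = ℕ.s≤s ℕ.z≤n

    ¼ : ℝ
    ¼ = 1# / fromℕ 4

    0≤¼ : 0# ≤ ¼
    0≤¼ = <⇒≤ (0</ 0<1 (0<fromℕ-suc 3))

    ¼≤1 : ¼ ≤ 1#
    ¼≤1 = /-≤ (0<fromℕ-suc 3) (≤-by (0≤fromℕ 3) (solve 0 (con (+ 1) :* con (+ 4) :- con (+ 1) := con (+ 3)) ≈-refl))

    w≤W : w ≤ fromℕ (tower n)
    w≤W = begin
      w                                                   ≤⟨ w≤ ⟩
      ¼ * towerℝ (log₂ (fifthRoot (fromℕ n) / fromℕ 40))  ≤⟨ *-monoʳ-≤ 0≤¼ (width-bound 1≤n) ⟩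
      ¼ * fromℕ (tower n)                                 ≤⟨ *-mono-≤ 0≤¼ ¼≤1 (0≤fromℕ (tower n)) ≤-refl ⟩
      1# * fromℕ (tower n)                                ≈⟨ *-identityˡ _ ⟩
      fromℕ (tower n)                                     ∎

    size≤ : FiniteSubset.size X ℕ.≤ tower (36 ℕ.* n)
    size≤ = size-bound X n t 1≤n t≤n (exp-ε≤2 0<ε (<1/⇒*<1 (0<fromℕ-suc 7) ε<1/8)) 0<β (<1/⇒*<1 (0<fromℕ-suc 7) β<1/8)
      (200nδ≤1 1≤n δ≤) Δ<t w≤W M dp solves

corollary5p4 : ExcludedMiddle 0ℓ → (R : CompleteOrderedField) → let open OverReals R in
    ∀ (ε β : ℝ) →
    0# < ε → ε < 1# / fromℕ 8 →
    0# < β → β < 1# / fromℕ 8 →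
    ∃[ C ] (0# < C ×
    (∀ (δ : ℕ → ℝ) →
    (∀ n → .{{NonZero n}} → δ n ≤ 1# / fromℕ (200 ℕ.* n ℕ.^ 2)) →
    ∀ (X : FiniteSubset) (n t : ℕ) (Δ w : ℝ) →
    Δ < fromℕ t → t ℕ.≤ n →
    w ≤ (1# / fromℕ 4) * towerℝ (log₂ (fifthRoot (fromℕ n) / fromℕ 40)) →
    ∀ (M : Algorithm (Fin (FiniteSubset.size X)) n) →
    DifferentiallyPrivate ε (δ n) M →
    Solves1Cluster X t Δ w β M →
    C * log* (fromℕ (FiniteSubset.size X)) ≤ fromℕ n))
corollary5p4 em R ε β 0<ε ε<1/8 0<β β<1/8 =
  1# / fromℕ 36 , 0</ 0<1 (0<fromℕ-suc 35) , λ δ δ≤ X n t Δ′ w Δ<t t≤n w≤ M dp solves →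
    log*-size-≤ X n t M 0<ε ε<1/8 0<β β<1/8 (δ≤ n) Δ<t t≤n w≤ dp solves
  where
  open OverReals R
  open OverField em R
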